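{- For $\ell\ge 2$ let $t_\ell$ be the maximum of $t$ over all real $(t,y_1,\dots,y_\ell)$ with $y_1\ge y_2\ge\dots\ge y_\ell\ge 0$, $\sum_{i=1}^\ell y_i=1$ and $t\le\sum_{k=1}^m(i_{k+1}-1)y_{i_k}$ for every $\mathcal{Q}=\{i_1<\dots<i_m\}\subseteq\{1,\dots,\ell\}$ with $i_1=1$ (where $i_{m+1}:=\ell+1$). For every $\ell\in\{2,\dots,100\}$ and every instance of the multi-level Steiner tree problem with $\ell$ levels, the composite algorithm, using a Steiner tree subroutine of approximation ratio $\rho\ge 1$, returns a multi-level Steiner tree of cost at most $t_\ell\,\rho\cdot\mathrm{OPT}$, where, up to an error of less than $10^{ -3}$, the values are $t_2= 1.333$, $t_3= 1.500$, $t_4= 1.630$, $t_5= 1.713$, $t_6= 1.778$, $t_7= 1.828$, $t_8= 1.869$, $t_9= 1.905$, $t_{10}= 1.936$, $t_{11}= 1.963$, $t_{12}= 1.986$, $t_{13}= 2.007$, $t_{14}= 2.025$, $t_{15}= 2.041$, $t_{16}= 2.056$, $t_{17}= 2.070$, $t_{18}= 2.083$, $t_{19}= 2.094$, $t_{20}= 2.106$, $t_{50}= 2.265$, $t_{100}= 2.351$.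
   Context: Multi-level Steiner tree (MLST) problem: an instance is a connected undirected graph $G=(V,E)$ with edge weights $c\colon E\to\mathbb{R}^+$ and nested terminal sets $T_\ell\subset\dots\subset T_1\subseteq V$. A multi-level Steiner tree consists of nested edge sets $E_\ell\subseteq\dots\subseteq E_1\subseteq E$ such that $E_i$ spans (connects) $T_i$ for all $1\le i\le \ell$. Writing $c(F)=\sum_{e\in F}c(e)$, its cost is $\sum_{i=1}^\ell c(E_i)$. $\mathrm{OPT}$ denotes the minimum cost of an MLST. Steiner tree subroutine: for a graph with non-negative edge weights and a terminal set $T$, a Steiner tree is a tree in the graph that spans $T$; the subroutine returns a Steiner tree of cost at most $\rho$ times the minimum cost of a Steiner tree for the given weights and terminals. Composite approach over $\mathcal{Q}=\{i_1<\dots<i_m\}\subseteq\{1,\dots,\ell\}$ with $i_1=1$, with the convention $i_{m+1}=\ell+1$: compute with the subroutine a Steiner tree $E_{i_m}$ for $T_{i_m}$ in $G$. For $k=m-1,\dots,1$: set the weight of all edges of $E_{i_{k+1}}$ to $0$, compute with the subroutine a Steiner tree for $T_{i_k}$ in the reweighted graph, and let $E_{i_k}$ be the union of $E_{i_{k+1}}$ and the edges of this tree. For levels $j$ with $i_k<j<i_{k+1}$, the set $E_j$ is obtained from $E_{i_k}$ by (possibly) pruning edges unneeded for spanning $T_j$, keeping the edge sets nested ($E_{j+1}\subseteq E_j\subseteq E_{i_k}$, with $E_{\ell+1}=\emptyset$). $\mathrm{CMP}(\mathcal{Q})$ denotes the cost (with original weights) of the resulting MLST. The composite algorithm runs this for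 all $2^{\ell-1}$ subsets $\mathcal{Q}\subseteq\{1,\dots,\ell\}$ with $1\in\mathcal{Q}$ and returns the cheapest solution. -}

module Defs where

open import Data.Empty using () renaming (⊥ to Absurd)
open import Data.Bool using (if_then_else_)
open import Data.Fin as Fin using (Fin; zero; suc; toℕ; inject₁; fromℕ)
open import Data.Fin.Subset using (Subset; inside; outside; _∈_; _⊆_; _∪_; ⊤; ⊥; Nonempty)
open import Data.Integer as ℤ using ()
open import Data.List using (List; _∷_; [])
open import Data.Nat as ℕ using (ℕ; zero; suc)
import Data.Nat.Properties as ℕₚ
open import Data.Product using (Σ; ∃; ∃-syntax; _×_; _,_; proj₁; proj₂)
open import Data.Rational as ℚ using (ℚ; 0ℚ; 1ℚ; ½; _/_)
import Data.Rational.Properties as ℚₚ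
open import Data.Rational.Solver using (module +-*-Solver)
open import Data.Sum using (_⊎_)
open import Data.Vec using (lookup; _∷_; [])
import Data.Vec.Functional as Vector
open import Function.Definitions using (Injective)
open import Relation.Binary.Construct.Closure.ReflexiveTransitive using (Star)
open import Relation.Binary.PropositionalEquality
  using (_≡_; refl; sym; trans; cong; cong₂; subst)

-- Equality of reals is _≈_, not _≡_.

IsCauchy : (ℕ → ℚ) → Set
IsCauchy x = ∀ ε → 0ℚ ℚ.< ε →
  ∃[ N ] (∀ m n → N ℕ.≤ m → N ℕ.≤ n → ℚ.∣ x m ℚ.- x n ∣ ℚ.≤ ε)

record ℝ : Set where
  constructor mkℝ
  field
    seq    : ℕ → ℚ
    cauchy : IsCauchy seq

open ℝ public

infix  4 _≈_ _≤_ _<_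
infixl 6 _+_
infixl 7 _*_

_≤_ : ℝ → ℝ → Set
x ≤ y = ∀ ε → 0ℚ ℚ.< ε → ∃[ N ] (∀ n → N ℕ.≤ n → seq x n ℚ.≤ seq y n ℚ.+ ε)

_<_ : ℝ → ℝ → Set
x < y = ∃[ ε ] (0ℚ ℚ.< ε × ∃[ N ] (∀ n → N ℕ.≤ n → seq x n ℚ.+ ε ℚ.≤ seq y n))

_≈_ : ℝ → ℝ → Set
x ≈ y = x ≤ y × y ≤ x

fromℚ : ℚ → ℝ
fromℚ q = mkℝ (λ _ → q) λ ε 0<ε → 0 , λ _ _ _ _ →
  subst (λ d → ℚ.∣ d ∣ ℚ.≤ ε) (sym (ℚₚ.+-inverseʳ q)) (ℚₚ.<⇒≤ 0<ε)

fromℕ′ : ℕ → ℝ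
fromℕ′ n = fromℚ (ℤ.+ n / 1)

0ℝ 1ℝ : ℝ
0ℝ = fromℚ 0ℚ
1ℝ = fromℚ 1ℚ

private
  Bounded : (ℕ → ℚ) → Set
  Bounded z = ∃[ B ] (0ℚ ℚ.< B × ∃[ N ] (∀ n → N ℕ.≤ n → ℚ.∣ z n ∣ ℚ.≤ B))
  Close : (ℕ → ℚ) → ℚ → Set
  Close z δ = ∃[ N ] (∀ m n → N ℕ.≤ m → N ℕ.≤ n → ℚ.∣ z m ℚ.- z n ∣ ℚ.≤ δ)

private abstract
  0<* : ∀ {p q} → 0ℚ ℚ.< p → 0ℚ ℚ.< q → 0ℚ ℚ.< p ℚ.* q
  0<* {p} {q} 0<p 0<q = ℚₚ.positive⁻¹ (p ℚ.* q)
    {{ℚₚ.pos*pos⇒pos p {{ℚ.positive 0<p}} q {{ℚ.positive 0<q}}}}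

  ½ε+½ε≡ε : ∀ ε → ½ ℚ.* ε ℚ.+ ½ ℚ.* ε ≡ ε
  ½ε+½ε≡ε ε = trans (sym (ℚₚ.*-distribʳ-+ ε ½ ½)) (ℚₚ.*-identityˡ ε)

  bounded : ∀ x → IsCauchy x → Bounded x
  bounded x cx with cx 1ℚ (ℚₚ.positive⁻¹ 1ℚ)
  ... | N , close = 1ℚ ℚ.+ ℚ.∣ x N ∣
      , ℚₚ.+-mono-<-≤ (ℚₚ.positive⁻¹ 1ℚ) (ℚₚ.0≤∣p∣ (x N)) , N , λ n N≤n → begin
    ℚ.∣ x n ∣                         ≡⟨ cong ℚ.∣_∣ (split (x n) (x N)) ⟩
    ℚ.∣ (x n ℚ.- x N) ℚ.+ x N ∣       ≤⟨ ℚₚ.∣p+q∣≤∣p∣+∣q∣ (x n ℚ.- x N) (x N) ⟩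
    ℚ.∣ x n ℚ.- x N ∣ ℚ.+ ℚ.∣ x N ∣   ≤⟨ ℚₚ.+-monoˡ-≤ ℚ.∣ x N ∣ (close n N N≤n ℕₚ.≤-refl) ⟩
    1ℚ ℚ.+ ℚ.∣ x N ∣                  ∎
    where
    open ℚₚ.≤-Reasoning
    split : ∀ a b → a ≡ (a ℚ.- b) ℚ.+ b
    split = +-*-Solver.solve 2 (λ a b → a := (a :- b) :+ b) refl
      where open +-*-Solver

  *-mono-nonNeg : ∀ {p q r s} → 0ℚ ℚ.≤ r → 0ℚ ℚ.≤ q → p ℚ.≤ q → r ℚ.≤ s →
                  p ℚ.* r ℚ.≤ q ℚ.* s
  *-mono-nonNeg {p} {q} {r} {s} 0≤r 0≤q p≤q r≤s = ℚₚ.≤-trans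
    (ℚₚ.*-monoʳ-≤-nonNeg r {{ℚ.nonNegative 0≤r}} p≤q)
    (ℚₚ.*-monoˡ-≤-nonNeg q {{ℚ.nonNegative 0≤q}} r≤s)

  +-cauchy : ∀ x y → IsCauchy x → IsCauchy y → IsCauchy (λ n → x n ℚ.+ y n)
  +-cauchy x y cx cy ε 0<ε
    with cx (½ ℚ.* ε) (0<* (ℚₚ.positive⁻¹ ½) 0<ε) | cy (½ ℚ.* ε) (0<* (ℚₚ.positive⁻¹ ½) 0<ε)
  ... | M , px | N , py = M ℕ.⊔ N , λ m n Nm Nn → begin
    ℚ.∣ (x m ℚ.+ y m) ℚ.- (x n ℚ.+ y n) ∣
      ≡⟨ cong ℚ.∣_∣ (rearrange (x m) (y m) (x n) (y n)) ⟩
    ℚ.∣ (x m ℚ.- x n) ℚ.+ (y m ℚ.- y n) ∣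
      ≤⟨ ℚₚ.∣p+q∣≤∣p∣+∣q∣ (x m ℚ.- x n) (y m ℚ.- y n) ⟩
    ℚ.∣ x m ℚ.- x n ∣ ℚ.+ ℚ.∣ y m ℚ.- y n ∣
      ≤⟨ ℚₚ.+-mono-≤ (px m n (ℕₚ.m⊔n≤o⇒m≤o M N Nm) (ℕₚ.m⊔n≤o⇒m≤o M N Nn))
                     (py m n (ℕₚ.m⊔n≤o⇒n≤o M N Nm) (ℕₚ.m⊔n≤o⇒n≤o M N Nn)) ⟩
    ½ ℚ.* ε ℚ.+ ½ ℚ.* ε
      ≡⟨ ½ε+½ε≡ε ε ⟩
    ε ∎
    where
    open ℚₚ.≤-Reasoning
    rearrange : ∀ a b c d → (a ℚ.+ b) ℚ.- (c ℚ.+ d) ≡ (a ℚ.- c) ℚ.+ (b ℚ.- d)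
    rearrange = +-*-Solver.solve 4
      (λ a b c d → (a :+ b) :- (c :+ d) := (a :- c) :+ (b :- d)) refl
      where open +-*-Solver

  +-*-swap : ∀ a b c d → a ℚ.* b ℚ.- c ℚ.* d ≡ a ℚ.* (b ℚ.- d) ℚ.+ d ℚ.* (a ℚ.- c)
  +-*-swap = +-*-Solver.solve 4
    (λ a b c d → a :* b :- c :* d := a :* (b :- d) :+ d :* (a :- c)) refl
    where open +-*-Solver

  shrink : ∀ s ε → 0ℚ ℚ.< s → 0ℚ ℚ.< ε → ∃[ δ ] (0ℚ ℚ.< δ × s ℚ.* δ ≡ ε)
  shrink s ε 0<s 0<ε = s⁻¹ ℚ.* ε
    , 0<* (ℚₚ.positive⁻¹ s⁻¹ {{ℚₚ.1/pos⇒pos s {{ℚ.positive 0<s}}}}) 0<ε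
    , trans (sym (ℚₚ.*-assoc s s⁻¹ ε))
        (trans (cong (ℚ._* ε) (ℚₚ.*-inverseʳ s {{s≢0}})) (ℚₚ.*-identityˡ ε))
    where
    s≢0 : ℚ.NonZero s
    s≢0 = ℚₚ.pos⇒nonZero s {{ℚ.positive 0<s}}
    s⁻¹ : ℚ
    s⁻¹ = (ℚ.1/ s) {{s≢0}}

  *-close : ∀ {B C δ} a b c d → 0ℚ ℚ.< B → 0ℚ ℚ.< C → ℚ.∣ a ∣ ℚ.≤ B → ℚ.∣ d ∣ ℚ.≤ C →
            ℚ.∣ a ℚ.- c ∣ ℚ.≤ δ → ℚ.∣ b ℚ.- d ∣ ℚ.≤ δ →
            ℚ.∣ a ℚ.* b ℚ.- c ℚ.* d ∣ ℚ.≤ (B ℚ.+ C) ℚ.* δ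
  *-close {B} {C} {δ} a b c d 0<B 0<C a≤B d≤C ac bd = begin
    ℚ.∣ a ℚ.* b ℚ.- c ℚ.* d ∣
      ≡⟨ cong ℚ.∣_∣ (+-*-swap a b c d) ⟩
    ℚ.∣ a ℚ.* (b ℚ.- d) ℚ.+ d ℚ.* (a ℚ.- c) ∣
      ≤⟨ ℚₚ.∣p+q∣≤∣p∣+∣q∣ (a ℚ.* (b ℚ.- d)) (d ℚ.* (a ℚ.- c)) ⟩
    ℚ.∣ a ℚ.* (b ℚ.- d) ∣ ℚ.+ ℚ.∣ d ℚ.* (a ℚ.- c) ∣
      ≡⟨ cong₂ ℚ._+_ (ℚₚ.∣p*q∣≡∣p∣*∣q∣ a (b ℚ.- d)) (ℚₚ.∣p*q∣≡∣p∣*∣q∣ d (a ℚ.- c)) ⟩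
    ℚ.∣ a ∣ ℚ.* ℚ.∣ b ℚ.- d ∣ ℚ.+ ℚ.∣ d ∣ ℚ.* ℚ.∣ a ℚ.- c ∣
      ≤⟨ ℚₚ.+-mono-≤ (*-mono-nonNeg (ℚₚ.0≤∣p∣ (b ℚ.- d)) (ℚₚ.<⇒≤ 0<B) a≤B bd)
                     (*-mono-nonNeg (ℚₚ.0≤∣p∣ (a ℚ.- c)) (ℚₚ.<⇒≤ 0<C) d≤C ac) ⟩
    B ℚ.* δ ℚ.+ C ℚ.* δ
      ≡⟨ ℚₚ.*-distribʳ-+ δ B C ⟨
    (B ℚ.+ C) ℚ.* δ ∎
    where open ℚₚ.≤-Reasoning

  *-cauchy : ∀ x y → IsCauchy x → IsCauchy y → IsCauchy (λ n → x n ℚ.* y n)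
  *-cauchy x y cx cy ε 0<ε = go₁ (bounded x cx) (bounded y cy)
    where
    go₃ : ∀ δ → (bx : Bounded x) (by : Bounded y) →
          (proj₁ bx ℚ.+ proj₁ by) ℚ.* δ ≡ ε → Close x δ → Close y δ →
          Close (λ n → x n ℚ.* y n) ε
    go₃ δ (B , 0<B , K , bx) (C , 0<C , L , by) total (M , px) (N , py) =
      (K ℕ.⊔ L) ℕ.⊔ (M ℕ.⊔ N) , λ m n Nm Nn →
      let Km = ℕₚ.m⊔n≤o⇒m≤o (K ℕ.⊔ L) (M ℕ.⊔ N) Nm
          Ln = ℕₚ.m⊔n≤o⇒m≤o (K ℕ.⊔ L) (M ℕ.⊔ N) Nn
          Mm = ℕₚ.m⊔n≤o⇒n≤o (K ℕ.⊔ L) (M ℕ.⊔ N) Nm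
          Mn = ℕₚ.m⊔n≤o⇒n≤o (K ℕ.⊔ L) (M ℕ.⊔ N) Nn
      in ℚₚ.≤-trans
           (*-close (x m) (y m) (x n) (y n) 0<B 0<C
             (bx m (ℕₚ.m⊔n≤o⇒m≤o K L Km)) (by n (ℕₚ.m⊔n≤o⇒n≤o K L Ln))
             (px m n (ℕₚ.m⊔n≤o⇒m≤o M N Mm) (ℕₚ.m⊔n≤o⇒m≤o M N Mn))
             (py m n (ℕₚ.m⊔n≤o⇒n≤o M N Mm) (ℕₚ.m⊔n≤o⇒n≤o M N Mn)))
           (ℚₚ.≤-reflexive total)
    go₂ : (bx : Bounded x) (by : Bounded y) →
          ∃[ δ ] (0ℚ ℚ.< δ × (proj₁ bx ℚ.+ proj₁ by) ℚ.* δ ≡ ε) →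
          Close (λ n → x n ℚ.* y n) ε
    go₂ bx by (δ , 0<δ , total) = go₃ δ bx by total (cx δ 0<δ) (cy δ 0<δ)
    go₁ : Bounded x → Bounded y → Close (λ n → x n ℚ.* y n) ε
    go₁ bx by = go₂ bx by
      (shrink (proj₁ bx ℚ.+ proj₁ by) ε (ℚₚ.+-mono-< (proj₁ (proj₂ bx)) (proj₁ (proj₂ by))) 0<ε)

_+_ : ℝ → ℝ → ℝ
x + y = mkℝ (λ n → seq x n ℚ.+ seq y n) (+-cauchy (seq x) (seq y) (cauchy x) (cauchy y))

_*_ : ℝ → ℝ → ℝ
x * y = mkℝ (λ n → seq x n ℚ.* seq y n) (*-cauchy (seq x) (seq y) (cauchy x) (cauchy y))

∑ : ∀ {n} → (Fin n → ℝ) → ℝ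
∑ = Vector.foldr _+_ 0ℝ

∑∈ : ∀ {n} → Subset n → (Fin n → ℝ) → ℝ
∑∈ S f = ∑ λ i → if lookup S i then f i else 0ℝ

IsMinimum : (ℝ → Set) → ℝ → Set
IsMinimum P m = P m × (∀ x → P x → m ≤ x)

IsMaximum : (ℝ → Set) → ℝ → Set
IsMaximum P m = P m × (∀ x → P x → x ≤ m)

-- Each undirected edge is listed once, with its smaller endpoint as source.
record Graph : Set where
  field
    order   : ℕ
    size    : ℕ
    source  : Fin size → Fin order
    target  : Fin size → Fin order
    ordered : ∀ e → source e Fin.< target e
    simple  : ∀ e e′ → source e ≡ source e′ → target e ≡ target e′ → e ≡ e′

  Vertex  = Fin order
  Edge    = Fin size
  EdgeSet = Subset size

  Adjacent : EdgeSet → Vertex → Vertex → Set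
  Adjacent F u v = ∃[ e ] (e ∈ F ×
    ((source e ≡ u × target e ≡ v) ⊎ (source e ≡ v × target e ≡ u)))

  Reachable : EdgeSet → Vertex → Vertex → Set
  Reachable F = Star (Adjacent F)

  Spans : EdgeSet → Subset order → Set
  Spans F T = ∀ u v → u ∈ T → v ∈ T → Reachable F u v

  -- A cycle has k + 3 pairwise distinct vertices.
  record Cycle (F : EdgeSet) : Set where
    field
      {k}      : ℕ
      vertex   : Fin (3 ℕ.+ k) → Vertex
      distinct : Injective _≡_ _≡_ vertex
      step     : ∀ i → Adjacent F (vertex (inject₁ i)) (vertex (suc i))
      close    : Adjacent F (vertex (fromℕ (2 ℕ.+ k))) (vertex zero)

  record IsTree (W : Subset order) (F : EdgeSet) : Set where
    field
      nonempty  : Nonempty W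
      within    : ∀ e → e ∈ F → source e ∈ W × target e ∈ W
      connected : Spans F W
      acyclic   : Cycle F → Absurd

  IsSteinerTree : Subset order → EdgeSet → Set
  IsSteinerTree T F = ∃[ W ] (T ⊆ W × IsTree W F)

  Connected : Set
  Connected = Vertex × (∀ u v → Reachable ⊤ u v)

open Graph public using (order; size)

NonNegative : ∀ {n} → (Fin n → ℝ) → Set
NonNegative w = ∀ e → 0ℝ ≤ w e

record SteinerSubroutine (ρ : ℝ) : Set where
  field
    solve : (G : Graph) → (Fin (size G) → ℝ) → Subset (order G) → Subset (size G)
    sound : ∀ G w T → Graph.Connected G → NonNegative w →
            Graph.IsSteinerTree G T (solve G w T)
    ratio : ∀ G w T → Graph.Connected G → NonNegative w →
            ∀ μ → IsMinimum (λ x → ∃[ F ] (Graph.IsSteinerTree G T F × ∑∈ F w ≈ x)) μ →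
            ∑∈ (solve G w T) w ≤ ρ * μ

-- Multi-level Steiner trees.  Levels 1, …, ℓ are represented by Fin ℓ, so level i
-- is the element with toℕ equal to i - 1.

record Instance (ℓ : ℕ) : Set where
  field
    graph     : Graph
    connected : Graph.Connected graph
    c         : Fin (size graph) → ℝ
    positive  : ∀ e → 0ℝ < c e
    T         : Fin ℓ → Subset (order graph)
    nested    : ∀ i j → i Fin.≤ j → T j ⊆ T i

module _ {ℓ : ℕ} (I : Instance ℓ) where
  open Instance I
  open Graph graph using (EdgeSet; Spans)

  IsMLST : (Fin ℓ → EdgeSet) → Set
  IsMLST E = (∀ i j → i Fin.≤ j → E j ⊆ E i) × (∀ i → Spans (E i) (T i))

  cost : (Fin ℓ → EdgeSet) → ℝ
  cost E = ∑ λ i → ∑∈ (E i) c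

  IsOPT : ℝ → Set
  IsOPT = IsMinimum (λ x → ∃[ E ] (IsMLST E × cost E ≈ x))

-- Sets of levels.  Fin (suc ℓ) represents 1, …, ℓ + 1, shifted in the same way.

-- The least element, or the top position if there is none.
least : ∀ {ℓ} → Subset ℓ → Fin (suc ℓ)
least []            = zero
least (inside  ∷ Q) = zero
least (outside ∷ Q) = suc (least Q)

-- next Q i_k = i_{k+1}, where i_{m+1} = ℓ + 1.  Because of the shift,
-- toℕ (next Q i_k) is the number i_{k+1} - 1.
next : ∀ {ℓ} → Subset ℓ → Fin ℓ → Fin (suc ℓ)
next (_ ∷ Q) zero    = suc (least Q)
next (_ ∷ Q) (suc i) = suc (next Q i)

StartsAtOne : ∀ {ℓ} → Subset ℓ → Set
StartsAtOne Q = least Q ≡ zero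

-- E_1, …, E_ℓ together with E_{ℓ+1} = ∅.
extend : ∀ {ℓ n} → (Fin ℓ → Subset n) → Fin (suc ℓ) → Subset n
extend {zero}  E _       = ⊥
extend {suc ℓ} E zero    = E zero
extend {suc ℓ} E (suc p) = extend (λ i → E (suc i)) p

module _ {ℓ : ℕ} (I : Instance ℓ) {ρ : ℝ} (A : SteinerSubroutine ρ) where
  open Instance I
  open Graph graph using (EdgeSet; Spans)
  open SteinerSubroutine A

  zeroOn : EdgeSet → (Fin (size graph) → ℝ)
  zeroOn F e = if lookup F e then 0ℝ else c e

  -- The possible outcomes of the composite approach over Q; the outcome is not
  -- unique because of the optional pruning.  At the top selected level,
  -- extend E (next Q i) is ∅, so the subroutine is run with the original weights.
  record IsCMP (Q : Subset ℓ) (E : Fin ℓ → EdgeSet) : Set where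
    field
      selected : ∀ i → i ∈ Q → let F = extend E (next Q i) in
                 E i ≡ F ∪ solve graph (zeroOn F) (T i)
      pruned   : ∀ i → i ∈ Q → ∀ j → i Fin.< j → toℕ j ℕ.< toℕ (next Q i) →
                 extend E (suc j) ⊆ E j × E j ⊆ E i × Spans (E j) (T j)

  record CompositeRun : Set where
    field
      result   : Subset ℓ → Fin ℓ → EdgeSet
      computed : ∀ Q → StartsAtOne Q → IsCMP Q (result Q)
      best     : Subset ℓ
      starts   : StartsAtOne best
      cheapest : ∀ Q → StartsAtOne Q → cost I (result best) ≤ cost I (result Q)

    output : Fin ℓ → EdgeSet
    output = result best

record Feasible (ℓ : ℕ) (t : ℝ) (y : Fin ℓ → ℝ) : Set where
  field
    antitone    : ∀ i j → i Fin.≤ j → y j ≤ y i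
    nonNegative : ∀ i → 0ℝ ≤ y i
    normalised  : ∑ y ≈ 1ℝ
    bound       : ∀ Q → StartsAtOne Q → t ≤ ∑∈ Q (λ i → fromℕ′ (toℕ (next Q i)) * y i)

IsLPValue : ℕ → ℝ → Set
IsLPValue ℓ = IsMaximum (λ t → ∃[ y ] Feasible ℓ t y)

-- Pairs (ℓ , v), where v / 1000 is the listed approximation of t_ℓ.
table : List (ℕ × ℕ)
table =
  (2 , 1333) ∷ (3 , 1500) ∷ (4 , 1630) ∷ (5 , 1713) ∷ (6 , 1778) ∷ (7 , 1828) ∷
  (8 , 1869) ∷ (9 , 1905) ∷ (10 , 1936) ∷ (11 , 1963) ∷ (12 , 1986) ∷ (13 , 2007) ∷
  (14 , 2025) ∷ (15 , 2041) ∷ (16 , 2056) ∷ (17 , 2070) ∷ (18 , 2083) ∷ (19 , 2094) ∷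
  (20 , 2106) ∷ (50 , 2265) ∷ (100 , 2351) ∷ []

-- |t - v/1000| < 1/1000
Within : ℝ → ℕ → Set
Within t v = t < fromℚ (ℤ.+ v / 1000 ℚ.+ ℤ.+ 1 / 1000)
           × fromℚ (ℤ.+ v / 1000 ℚ.- ℤ.+ 1 / 1000) < t

{-
Write Eᵢ* for the levels of an optimal solution and z i = ρ c(Eᵢ*).  Every Eᵢ* contains a Steiner
tree for Tᵢ, so one step of the composite approach adds cost at most z i to the tree of the next
selected level, and summing over the levels gives CMP(Q) ≤ ∑_{i ∈ Q} (next i - 1) z i for every Q.
As z is antitone and nonnegative, these inequalities are the constraints of the linear program,
without the normalisation; by homogeneity the cheapest CMP(Q) is at most t_ℓ ∑ z = t_ℓ ρ OPT.

Fourier-Motzkin elimination of y from the homogeneous program leaves finitely many rational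
inequalities between t and s = ∑ y; the tightest of them is t ≤ t_ℓ s, attained at a rational y.
The listed values are certified by a rounded y, whose least constraint is found as a shortest
path, and by rounded multipliers of the constraints.
-}
module Submission where

open import Defs
open import Algebra.Bundles using (CommutativeRing)
open import Data.Bool as Bool using (Bool; true; false; if_then_else_; _∨_; _∧_)
import Data.Bool.Properties as Boolₚ
open import Data.Fin as Fin using (Fin; zero; suc; toℕ; inject₁; fromℕ)
import Data.Fin.Properties as Finₚ
open import Data.Fin.Relation.Unary.Top using (view; ‵fromℕ; ‵inject₁)
open import Data.Fin.Subset using (Subset; inside; outside; _∉_; _⊆_; _∪_; ⊥; ⁅_⁆; ∣_∣)
  renaming (_∈_ to _∈ˢ_)
import Data.Fin.Subset.Properties as Subsetₚ
import Data.Integer as ℤ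
import Data.Integer.Properties as ℤₚ
open import Data.List as List using (List; []; _∷_; _++_; cartesianProductWith)
open import Data.List.Membership.Propositional using (_∈_)
import Data.List.Membership.Propositional.Properties as ∈ₚ
open import Data.List.Relation.Unary.All as All using (All; []; _∷_)
import Data.List.Relation.Unary.All.Properties as Allₚ
open import Data.List.Relation.Unary.Any using (Any; here; there)
open import Data.Nat as ℕ using (ℕ; zero; suc)
import Data.Nat.Properties as ℕₚ
open import Data.Product using (∃-syntax; _×_; _,_; proj₁; proj₂)
open import Data.Rational as ℚ using (ℚ; 0ℚ; 1ℚ; ½)
import Data.Rational.Properties as ℚₚ
open import Data.Rational.Solver using (module +-*-Solver)
import Data.Rational.Unnormalised as ℚᵘ
import Data.Rational.Unnormalised.Properties as ℚᵘₚ
open import Data.Sum using (_⊎_; inj₁; inj₂; swap; [_,_]′)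
open import Data.Vec as Vec using (Vec; lookup; []; _∷_; here; there)
import Data.Vec.Properties as Vecₚ
open import Function using (_∘_; _$_)
open import Function.Bundles using (Equivalence)
open import Relation.Binary.Bundles using (DecTotalOrder)
open import Relation.Binary.Construct.Closure.ReflexiveTransitive as Star using (_◅_; _◅◅_)
open import Relation.Binary.Definitions using (tri<; tri≈; tri>)
open import Relation.Binary.PropositionalEquality
  using (_≡_; _≢_; refl; sym; trans; cong; cong₂; subst; subst₂)
open import Relation.Nullary
  using (¬_; Dec; yes; no; contradiction; ¬?; _×-dec_; _⊎-dec_; ¬¬-excluded-middle)
open import Algebra.Properties.CommutativeMonoid.Sum ℚₚ.+-0-commutativeMonoid
  using (sum; sum-cong-≗; ∑-distrib-+; sum-replicate-zero)
open import Algebra.Properties.Semiring.Sum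
  (CommutativeRing.semiring ℚₚ.+-*-commutativeRing) using (*-distribˡ-sum)
open import Data.List.Extrema (DecTotalOrder.totalOrder ℚₚ.≤-decTotalOrder)
  using (max; min; xs≤max; ⊥≤max; max≤v⁺; min≤xs)
open +-*-Solver using (_:=_; _:+_; _:*_; _:-_; :-_; con)

-- The obstacle is constructive: reals are Cauchy sequences whose order is undecidable, so neither a
-- maximiser of the linear program nor a cheapest Steiner tree can be found by comparing real
-- numbers. The program has rational data, however, so its maximiser is built over `ℚ`, where
-- comparisons are decidable. Only the soundness of elimination has to reach real solutions, and it
-- uses nothing but sums and nonnegative rational multiples, which preserve nonnegativity up to
-- every ε of arbitrary rational sequences. The total `s` stays a variable because the total cost of
-- an instance may be zero and cannot be divided by.
--
-- Elimination explodes, and 100 levels have 2^99 admissible sets. The optimum is therefore never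
-- evaluated: the listed values are bounded from both sides by weak duality, with a dynamic program
-- in place of an enumeration of the sets.

-- Rational inequalities

p≤q⇒0≤q-p : ∀ {p q} → p ℚ.≤ q → 0ℚ ℚ.≤ q ℚ.- p
p≤q⇒0≤q-p {p} {q} p≤q =
  subst (ℚ._≤ q ℚ.- p) (ℚₚ.+-inverseʳ p) (ℚₚ.+-monoˡ-≤ (ℚ.- p) p≤q)

0≤q-p⇒p≤q : ∀ {p q} → 0ℚ ℚ.≤ q ℚ.- p → p ℚ.≤ q
0≤q-p⇒p≤q {p} {q} 0≤q-p = subst₂ ℚ._≤_ (ℚₚ.+-identityˡ p)
  (+-*-Solver.solve 2 (λ p q → q :- p :+ p := q) refl p q) (ℚₚ.+-monoˡ-≤ p 0≤q-p)

0≤+ : ∀ {p q} → 0ℚ ℚ.≤ p → 0ℚ ℚ.≤ q → 0ℚ ℚ.≤ p ℚ.+ q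
0≤+ = ℚₚ.+-mono-≤

0≤* : ∀ {p q} → 0ℚ ℚ.≤ p → 0ℚ ℚ.≤ q → 0ℚ ℚ.≤ p ℚ.* q
0≤* {p} {q} 0≤p 0≤q = ℚₚ.nonNegative⁻¹ (p ℚ.* q)
  {{ℚₚ.nonNeg*nonNeg⇒nonNeg p {{ℚ.nonNegative 0≤p}} q {{ℚ.nonNegative 0≤q}}}}

0<* : ∀ {p q} → 0ℚ ℚ.< p → 0ℚ ℚ.< q → 0ℚ ℚ.< p ℚ.* q
0<* {p} {q} 0<p 0<q = ℚₚ.positive⁻¹ (p ℚ.* q)
  {{ℚₚ.pos*pos⇒pos p {{ℚ.positive 0<p}} q {{ℚ.positive 0<q}}}}

0<½* : ∀ {ε} → 0ℚ ℚ.< ε → 0ℚ ℚ.< ½ ℚ.* ε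
0<½* = 0<* (ℚₚ.positive⁻¹ ½)

0≤1 : 0ℚ ℚ.≤ 1ℚ
0≤1 = ℚₚ.nonNegative⁻¹ 1ℚ

p≤∣p∣ : ∀ p → p ℚ.≤ ℚ.∣ p ∣
p≤∣p∣ p with ℚₚ.≤-total 0ℚ p
... | inj₁ 0≤p = ℚₚ.≤-reflexive (sym (ℚₚ.0≤p⇒∣p∣≡p 0≤p))
... | inj₂ p≤0 = ℚₚ.≤-trans p≤0 (ℚₚ.0≤∣p∣ p)

abstract
  reciprocal : ∀ {p} → 0ℚ ℚ.< p → ∃[ r ] (0ℚ ℚ.< r × r ℚ.* p ≡ 1ℚ)
  reciprocal {p} 0<p = r , ℚₚ.positive⁻¹ r {{ℚₚ.1/pos⇒pos p {{ℚ.positive 0<p}}}}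
    , ℚₚ.*-inverseˡ p {{p≢0}}
    where
    p≢0 : ℚ.NonZero p
    p≢0 = ℚₚ.pos⇒nonZero p {{ℚ.positive 0<p}}
    r : ℚ
    r = (ℚ.1/ p) {{p≢0}}

  scaled : ∀ {B ε} → 0ℚ ℚ.< B → 0ℚ ℚ.< ε → ∃[ δ ] (0ℚ ℚ.< δ × B ℚ.* δ ≡ ε)
  scaled {B} {ε} 0<B 0<ε with reciprocal 0<B
  ... | r , 0<r , rB≡1 = r ℚ.* ε , 0<* 0<r 0<ε
    , trans (+-*-Solver.solve 3 (λ b r e → b :* (r :* e) := r :* b :* e) refl B r ε)
        (trans (cong (ℚ._* ε) rB≡1) (ℚₚ.*-identityˡ ε))

≤-all-ε : ∀ {p q} → (∀ ε → 0ℚ ℚ.< ε → p ℚ.≤ q ℚ.+ ε) → p ℚ.≤ q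
≤-all-ε {p} {q} close = ℚₚ.≮⇒≥ λ q<p →
  let 0<d = subst (ℚ._< p ℚ.- q) (ℚₚ.+-inverseʳ q) (ℚₚ.+-monoˡ-< (ℚ.- q) q<p) in
  ℚₚ.<-irrefl refl (ℚₚ.<-≤-trans (0<½* 0<d) (0≤q-p⇒p≤q
    (subst (0ℚ ℚ.≤_)
      (+-*-Solver.solve 2 (λ p q → q :+ con ½ :* (p :- q) :- p
                                     := con 0ℚ :- con ½ :* (p :- q)) refl p q)
      (p≤q⇒0≤q-p (close _ (0<½* 0<d))))))

-- The order of ℝ

-- The order of `ℝ` without the Cauchy condition: `x ≤ y` amounts to `Nonneg` of the difference, and
-- the linear combinations formed during elimination need no proof of convergence.
record Nonneg (u : ℕ → ℚ) : Set where
  constructor nonneg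
  field
    eventually : ∀ ε → 0ℚ ℚ.< ε → ∃[ N ] (∀ n → N ℕ.≤ n → 0ℚ ℚ.≤ u n ℚ.+ ε)

open Nonneg

nonneg-const : ∀ {q} → 0ℚ ℚ.≤ q → Nonneg (λ _ → q)
nonneg-const 0≤q = nonneg λ ε 0<ε → 0 , λ _ _ → 0≤+ 0≤q (ℚₚ.<⇒≤ 0<ε)

nonneg-resp : ∀ {u v : ℕ → ℚ} → (∀ n → u n ≡ v n) → Nonneg u → Nonneg v
nonneg-resp u≗v u≥0 .eventually ε 0<ε with u≥0 .eventually ε 0<ε
... | N , bound = N , λ n N≤n → subst (λ q → 0ℚ ℚ.≤ q ℚ.+ ε) (u≗v n) (bound n N≤n)

nonneg-+ : ∀ {u v : ℕ → ℚ} → Nonneg u → Nonneg v → Nonneg (λ n → u n ℚ.+ v n)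
nonneg-+ {u} {v} u≥0 v≥0 .eventually ε 0<ε
  with u≥0 .eventually _ (0<½* 0<ε) | v≥0 .eventually _ (0<½* 0<ε)
... | M , f | N , g = M ℕ.⊔ N , λ n le → subst (0ℚ ℚ.≤_)
  (+-*-Solver.solve 3 (λ a b e → (a :+ con ½ :* e) :+ (b :+ con ½ :* e)
                                   := a :+ b :+ e) refl (u n) (v n) ε)
  (0≤+ (f n (ℕₚ.m⊔n≤o⇒m≤o M N le)) (g n (ℕₚ.m⊔n≤o⇒n≤o M N le)))

-- Where `a` is at most `B`, an error `δ` of `u` becomes at most `B δ`, so `δ` is chosen with
-- `B δ = ε`.
nonneg-* : ∀ (a u : ℕ → ℚ) → ∃[ N ] (∀ n → N ℕ.≤ n → 0ℚ ℚ.≤ a n) →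
           ∃[ B ] (0ℚ ℚ.< B × ∃[ N ] (∀ n → N ℕ.≤ n → a n ℚ.≤ B)) →
           Nonneg u → Nonneg (λ n → a n ℚ.* u n)
nonneg-* a u (K , a≥0) (B , 0<B , L , a≤B) u≥0 .eventually ε 0<ε with scaled 0<B 0<ε
... | δ , 0<δ , Bδ≡ε with u≥0 .eventually δ 0<δ
... | M , f = (K ℕ.⊔ L) ℕ.⊔ M , λ n le →
  let KL = ℕₚ.m⊔n≤o⇒m≤o (K ℕ.⊔ L) M le
      a-B = p≤q⇒0≤q-p (a≤B n (ℕₚ.m⊔n≤o⇒n≤o K L KL))
  in subst (0ℚ ℚ.≤_)
    (trans (+-*-Solver.solve 4 (λ a u b d → a :* (u :+ d) :+ (b :- a) :* d
                                              := a :* u :+ b :* d) refl (a n) (u n) B δ)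
      (cong (a n ℚ.* u n ℚ.+_) Bδ≡ε))
    (0≤+ (0≤* (a≥0 n (ℕₚ.m⊔n≤o⇒m≤o K L KL)) (f n (ℕₚ.m⊔n≤o⇒n≤o (K ℕ.⊔ L) M le)))
         (0≤* a-B (ℚₚ.<⇒≤ 0<δ)))

nonneg-scale : ∀ {r} {u : ℕ → ℚ} → 0ℚ ℚ.≤ r → Nonneg u → Nonneg (λ n → r ℚ.* u n)
nonneg-scale {r} {u} 0≤r = nonneg-* (λ _ → r) u (0 , λ _ _ → 0≤r)
  (r ℚ.+ 1ℚ , ℚₚ.+-mono-≤-< 0≤r (ℚₚ.positive⁻¹ 1ℚ) , 0
  , λ _ _ → subst (ℚ._≤ r ℚ.+ 1ℚ) (ℚₚ.+-identityʳ r) (ℚₚ.+-monoʳ-≤ r 0≤1))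

≤⇒nonneg : ∀ {x y} → x ≤ y → Nonneg (λ n → seq y n ℚ.- seq x n)
≤⇒nonneg {x} {y} x≤y .eventually ε 0<ε with x≤y ε 0<ε
... | N , f = N , λ n le → subst (0ℚ ℚ.≤_)
  (+-*-Solver.solve 3 (λ a b e → b :+ e :- a := b :- a :+ e) refl (seq x n) (seq y n) ε)
  (p≤q⇒0≤q-p (f n le))

nonneg⇒≤ : ∀ {x y} → Nonneg (λ n → seq y n ℚ.- seq x n) → x ≤ y
nonneg⇒≤ {x} {y} y-x≥0 ε 0<ε with y-x≥0 .eventually ε 0<ε
... | N , f = N , λ n le → 0≤q-p⇒p≤q (subst (0ℚ ℚ.≤_)
  (+-*-Solver.solve 3 (λ a b e → b :- a :+ e := b :+ e :- a) refl (seq x n) (seq y n) ε)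
  (f n le))

≤-pointwise : ∀ {x y} → (∀ n → seq x n ℚ.≤ seq y n) → x ≤ y
≤-pointwise {x} {y} x≤y = nonneg⇒≤ {x} {y} $ nonneg λ ε 0<ε →
  0 , λ n _ → 0≤+ (p≤q⇒0≤q-p (x≤y n)) (ℚₚ.<⇒≤ 0<ε)

≤-pointwise-≡ : ∀ {x y} → (∀ n → seq x n ≡ seq y n) → x ≤ y
≤-pointwise-≡ {x} {y} x≗y = ≤-pointwise {x} {y} (ℚₚ.≤-reflexive ∘ x≗y)

≤-refl : ∀ {x} → x ≤ x
≤-refl {x} = ≤-pointwise-≡ {x} {x} λ _ → refl

≤-trans : ∀ {x y z} → x ≤ y → y ≤ z → x ≤ z
≤-trans {x} {y} {z} x≤y y≤z = nonneg⇒≤ {x} {z} $ nonneg-resp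
  (λ n → +-*-Solver.solve 3 (λ a b c → (b :- a) :+ (c :- b) := c :- a) refl
    (seq x n) (seq y n) (seq z n))
  (nonneg-+ (≤⇒nonneg {x} {y} x≤y) (≤⇒nonneg {y} {z} y≤z))

+-mono-≤ : ∀ {w x y z} → w ≤ x → y ≤ z → w + y ≤ x + z
+-mono-≤ {w} {x} {y} {z} w≤x y≤z = nonneg⇒≤ {w + y} {x + z} $ nonneg-resp
  (λ n → +-*-Solver.solve 4 (λ a b c d → (b :- a) :+ (d :- c) := (b :+ d) :- (a :+ c)) refl
    (seq w n) (seq x n) (seq y n) (seq z n))
  (nonneg-+ (≤⇒nonneg {w} {x} w≤x) (≤⇒nonneg {y} {z} y≤z))

-- Stronger than `0ℝ ≤ x`, since no ε is granted. Late terms of such a number may multiply rational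
-- inequalities directly; `1ℝ ≤ ρ` makes `ρ` one of them.
EventuallyNonneg : ℝ → Set
EventuallyNonneg x = ∃[ N ] (∀ n → N ℕ.≤ n → 0ℚ ℚ.≤ seq x n)

eventually-bounded : ∀ x → ∃[ B ] (0ℚ ℚ.< B × ∃[ N ] (∀ n → N ℕ.≤ n → seq x n ℚ.≤ B))
eventually-bounded x with cauchy x 1ℚ (ℚₚ.positive⁻¹ 1ℚ)
... | N , close = 1ℚ ℚ.+ ℚ.∣ seq x N ∣
  , ℚₚ.+-mono-<-≤ (ℚₚ.positive⁻¹ 1ℚ) (ℚₚ.0≤∣p∣ (seq x N)) , N , λ n N≤n →
    let open ℚₚ.≤-Reasoning in begin
    seq x n
      ≡⟨ +-*-Solver.solve 2 (λ a b → a := a :- b :+ b) refl (seq x n) (seq x N) ⟩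
    (seq x n ℚ.- seq x N) ℚ.+ seq x N
      ≤⟨ ℚₚ.+-mono-≤ (ℚₚ.≤-trans (p≤∣p∣ _) (close n N N≤n ℕₚ.≤-refl)) (p≤∣p∣ _) ⟩
    1ℚ ℚ.+ ℚ.∣ seq x N ∣
      ∎

*-monoˡ-≤ : ∀ a {x y} → EventuallyNonneg a → x ≤ y → a * x ≤ a * y
*-monoˡ-≤ a {x} {y} 0≤a x≤y = nonneg⇒≤ {a * x} {a * y} $ nonneg-resp
  (λ n → +-*-Solver.solve 3 (λ a x y → a :* (y :- x) := a :* y :- a :* x) refl
    (seq a n) (seq x n) (seq y n))
  (nonneg-* (seq a) (λ n → seq y n ℚ.- seq x n) 0≤a (eventually-bounded a) (≤⇒nonneg {x} {y} x≤y))

1≤⇒eventuallyNonneg : ∀ {x} → 1ℝ ≤ x → EventuallyNonneg x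
1≤⇒eventuallyNonneg {x} 1≤x with 1≤x 1ℚ (ℚₚ.positive⁻¹ 1ℚ)
... | N , f = N , λ n le → subst (0ℚ ℚ.≤_)
  (+-*-Solver.solve 1 (λ a → a :+ con 1ℚ :- con 1ℚ := a) refl (seq x n)) (p≤q⇒0≤q-p (f n le))

<⇒≤ : ∀ {x y} → x < y → x ≤ y
<⇒≤ {x} {y} (δ , 0<δ , N , f) ε 0<ε = N , λ n le → ℚₚ.≤-trans
  (0≤q-p⇒p≤q (subst (0ℚ ℚ.≤_)
    (+-*-Solver.solve 3 (λ a b d → b :- (a :+ d) :+ d := b :- a) refl (seq x n) (seq y n) δ)
    (0≤+ (p≤q⇒0≤q-p (f n le)) (ℚₚ.<⇒≤ 0<δ))))
  (subst (ℚ._≤ seq y n ℚ.+ ε) (ℚₚ.+-identityʳ (seq y n)) (ℚₚ.+-monoʳ-≤ (seq y n) (ℚₚ.<⇒≤ 0<ε)))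

fromℚ-< : ∀ {p q} → p ℚ.< q → fromℚ p < fromℚ q
fromℚ-< {p} {q} p<q = q ℚ.- p
  , subst (ℚ._< q ℚ.- p) (ℚₚ.+-inverseʳ p) (ℚₚ.+-monoˡ-< (ℚ.- p) p<q)
  , 0 , λ _ _ → ℚₚ.≤-reflexive (+-*-Solver.solve 2 (λ p q → p :+ (q :- p) := q) refl p q)

fromℚ-≤ : ∀ {p q} → p ℚ.≤ q → fromℚ p ≤ fromℚ q
fromℚ-≤ {p} {q} p≤q = ≤-pointwise {fromℚ p} {fromℚ q} λ _ → p≤q

fromℚ-≤⁻¹ : ∀ {p q} → fromℚ p ≤ fromℚ q → p ℚ.≤ q
fromℚ-≤⁻¹ p≤q = ≤-all-ε λ ε 0<ε → let N , f = p≤q ε 0<ε in f N ℕₚ.≤-refl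

-- Which of x ≤ y and y < x holds is decided up to ε by a late enough pair of terms.
≮⇒≥ : ∀ {x y} → ¬ (y < x) → x ≤ y
≮⇒≥ {x} {y} y≮x ε 0<ε
  with cauchy x (½ ℚ.* (½ ℚ.* ε)) (0<½* (0<½* 0<ε)) | cauchy y (½ ℚ.* (½ ℚ.* ε)) (0<½* (0<½* 0<ε))
... | M , cx | N , cy = go (seq x K ℚₚ.≤? seq y K ℚ.+ ½ ℚ.* ε)
  where
  K = M ℕ.⊔ N
  q = ½ ℚ.* (½ ℚ.* ε)
  near : ∀ a b → ℚ.∣ a ℚ.- b ∣ ℚ.≤ q → a ℚ.≤ b ℚ.+ q
  near a b le = 0≤q-p⇒p≤q (subst (0ℚ ℚ.≤_)
    (+-*-Solver.solve 3 (λ a b q → q :- (a :- b) := b :+ q :- a) refl a b q)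
    (p≤q⇒0≤q-p (ℚₚ.≤-trans (p≤∣p∣ (a ℚ.- b)) le)))
  go : Dec (seq x K ℚ.≤ seq y K ℚ.+ ½ ℚ.* ε) → ∃[ L ] (∀ n → L ℕ.≤ n → seq x n ℚ.≤ seq y n ℚ.+ ε)
  go (yes le) = K , λ n K≤n → 0≤q-p⇒p≤q (subst (0ℚ ℚ.≤_)
    (+-*-Solver.solve 5 (λ xn yn xk yk e →
        (xk :+ con ½ :* (con ½ :* e) :- xn) :+ (yn :+ con ½ :* (con ½ :* e) :- yk)
          :+ (yk :+ con ½ :* e :- xk) := yn :+ e :- xn) refl
      (seq x n) (seq y n) (seq x K) (seq y K) ε)
    (0≤+ (0≤+ (p≤q⇒0≤q-p (near (seq x n) (seq x K) (cx n K (ℕₚ.m⊔n≤o⇒m≤o M N K≤n) (ℕₚ.m≤m⊔n M N))))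
              (p≤q⇒0≤q-p (near (seq y K) (seq y n) (cy K n (ℕₚ.m≤n⊔m M N) (ℕₚ.m⊔n≤o⇒n≤o M N K≤n)))))
         (p≤q⇒0≤q-p le)))
  go (no ≰) = contradiction
    ( d , subst (ℚ._< d) (ℚₚ.+-inverseʳ r) (ℚₚ.+-monoˡ-< (ℚ.- r) (ℚₚ.≰⇒> ≰)) , K , λ n K≤n →
      0≤q-p⇒p≤q (subst (0ℚ ℚ.≤_)
        (+-*-Solver.solve 5 (λ xn yn xk yk e →
          (xn :+ con ½ :* (con ½ :* e) :- xk) :+ (yk :+ con ½ :* (con ½ :* e) :- yn)
            := xn :- (yn :+ (xk :- (yk :+ con ½ :* e)))) refl
          (seq x n) (seq y n) (seq x K) (seq y K) ε)
        (0≤+ (p≤q⇒0≤q-p (near (seq x K) (seq x n) (cx K n (ℕₚ.m≤m⊔n M N) (ℕₚ.m⊔n≤o⇒m≤o M N K≤n))))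
             (p≤q⇒0≤q-p (near (seq y n) (seq y K) (cy n K (ℕₚ.m⊔n≤o⇒n≤o M N K≤n) (ℕₚ.m≤n⊔m M N)))))) )
    y≮x
    where
    r = seq y K ℚ.+ ½ ℚ.* ε
    d = seq x K ℚ.- r

-- A strict inequality carries a gap `δ` that refutes `x ≤ y`, so `¬ ¬ (x ≤ y)` refutes `y < x`.
-- This admits classical arguments wherever the goal is an inequality `≤`.
≤-stable : ∀ {x y} → ¬ ¬ (x ≤ y) → x ≤ y
≤-stable {x} {y} ¬¬x≤y = ≮⇒≥ {x} {y} λ y<x → ¬¬x≤y (≤⇒≯ y<x)
  where
  ≤⇒≯ : y < x → ¬ (x ≤ y)
  ≤⇒≯ (δ , 0<δ , M , f) x≤y with x≤y (½ ℚ.* δ) (0<½* 0<δ)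
  ... | N , g = ℚₚ.<-irrefl refl (ℚₚ.<-≤-trans (0<½* 0<δ) (0≤q-p⇒p≤q (subst (0ℚ ℚ.≤_)
    (+-*-Solver.solve 3 (λ x y d → (x :- (y :+ d)) :+ (y :+ con ½ :* d :- x)
                                     := con 0ℚ :- con ½ :* d) refl (seq x K) (seq y K) δ)
    (0≤+ (p≤q⇒0≤q-p (f K (ℕₚ.m≤m⊔n M N))) (p≤q⇒0≤q-p (g K (ℕₚ.m≤n⊔m M N)))))))
    where K = M ℕ.⊔ N

≰⇒≥ : ∀ {x y} → ¬ (x ≤ y) → y ≤ x
≰⇒≥ {x} {y} x≰y = ≤-stable {y} {x} λ y≰x → x≰y (≮⇒≥ {x} {y} λ y<x → y≰x (<⇒≤ {y} {x} y<x))

-- Finite sums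

seq-∑ : ∀ {n} (f : Fin n → ℝ) k → seq (∑ f) k ≡ sum (λ i → seq (f i) k)
seq-∑ {zero}  f k = refl
seq-∑ {suc n} f k = cong (seq (f zero) k ℚ.+_) (seq-∑ (f ∘ suc) k)

∑-mono-≤ : ∀ {n} {f g : Fin n → ℝ} → (∀ i → f i ≤ g i) → ∑ f ≤ ∑ g
∑-mono-≤ {zero}          f≤g = ≤-refl {0ℝ}
∑-mono-≤ {suc n} {f} {g} f≤g =
  +-mono-≤ {f zero} {g zero} {∑ (f ∘ suc)} {∑ (g ∘ suc)} (f≤g zero) (∑-mono-≤ (f≤g ∘ suc))

∑-+ : ∀ {n} (f g : Fin n → ℝ) → ∑ (λ i → f i + g i) ≤ ∑ f + ∑ g
∑-+ f g = ≤-pointwise-≡ {∑ (λ i → f i + g i)} {∑ f + ∑ g} λ k →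
  trans (seq-∑ (λ i → f i + g i) k)
    (trans (∑-distrib-+ (λ i → seq (f i) k) (λ i → seq (g i) k))
      (sym (cong₂ ℚ._+_ (seq-∑ f k) (seq-∑ g k))))

module ≤-Reasoning where
  infix  3 _∎
  infixr 2 step-≤
  infix  1 begin_
  infix  4 _IsRelatedTo_

  -- `x ≤ y` unfolds to a statement about `seq`, from which unification cannot recover `x` and `y`;
  -- the record keeps both visible.
  record _IsRelatedTo_ (x y : ℝ) : Set where
    constructor relTo
    field related : x ≤ y

  begin_ : ∀ {x y} → x IsRelatedTo y → x ≤ y
  begin relTo x≤y = x≤y

  step-≤ : ∀ x {y z} → y IsRelatedTo z → x ≤ y → x IsRelatedTo z
  step-≤ x {y} {z} (relTo y≤z) x≤y = relTo (≤-trans {x} {y} {z} x≤y y≤z)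

  _∎ : ∀ x → x IsRelatedTo x
  x ∎ = relTo (≤-refl {x})

  syntax step-≤ x y≤z x≤y = x ≤⟨ x≤y ⟩ y≤z

-- Linear forms with rational coefficients

-- The form x ↦ ∑ᵢ coefᵢ xᵢ + a t + b s, with two distinguished variables that are never
-- eliminated.
record Form (n : ℕ) : Set where
  constructor form
  field
    coef : Fin n → ℚ
    a b  : ℚ

open Form

dot : ∀ {n} → (Fin n → ℚ) → (Fin n → ℚ) → ℚ
dot c x = sum λ i → c i ℚ.* x i

eval : ∀ {n} → Form n → (Fin n → ℚ) → ℚ → ℚ → ℚ
eval f x t s = dot (coef f) x ℚ.+ (a f ℚ.* t ℚ.+ b f ℚ.* s)

dot-+ : ∀ {n} (c d x : Fin n → ℚ) → dot (λ i → c i ℚ.+ d i) x ≡ dot c x ℚ.+ dot d x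
dot-+ c d x = trans (sum-cong-≗ λ i → ℚₚ.*-distribʳ-+ (x i) (c i) (d i))
  (∑-distrib-+ (λ i → c i ℚ.* x i) (λ i → d i ℚ.* x i))

dot-* : ∀ {n} r (c x : Fin n → ℚ) → dot (λ i → r ℚ.* c i) x ≡ r ℚ.* dot c x
dot-* r c x = trans (sum-cong-≗ λ i → ℚₚ.*-assoc r (c i) (x i))
  (sym (*-distribˡ-sum r (λ i → c i ℚ.* x i)))

_⊕_ : ∀ {n} → Form n → Form n → Form n
f ⊕ g = form (λ i → coef f i ℚ.+ coef g i) (a f ℚ.+ a g) (b f ℚ.+ b g)

_⊛_ : ∀ {n} → ℚ → Form n → Form n
r ⊛ f = form (λ i → r ℚ.* coef f i) (r ℚ.* a f) (r ℚ.* b f)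

eval-⊕ : ∀ {n} (f g : Form n) x t s → eval (f ⊕ g) x t s ≡ eval f x t s ℚ.+ eval g x t s
eval-⊕ f g x t s = trans (cong (ℚ._+ _) (dot-+ (coef f) (coef g) x))
  (+-*-Solver.solve 8
    (λ c d a a′ b b′ t s → c :+ d :+ ((a :+ a′) :* t :+ (b :+ b′) :* s)
      := (c :+ (a :* t :+ b :* s)) :+ (d :+ (a′ :* t :+ b′ :* s))) refl
    (dot (coef f) x) (dot (coef g) x) (a f) (a g) (b f) (b g) t s)

eval-⊛ : ∀ {n} r (f : Form n) x t s → eval (r ⊛ f) x t s ≡ r ℚ.* eval f x t s
eval-⊛ r f x t s = trans (cong (ℚ._+ _) (dot-* r (coef f) x))
  (+-*-Solver.solve 6
    (λ r c a b t s → r :* c :+ (r :* a :* t :+ r :* b :* s)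
      := r :* (c :+ (a :* t :+ b :* s))) refl
    r (dot (coef f) x) (a f) (b f) t s)

tailForm : ∀ {n} → Form (suc n) → Form n
tailForm f = form (coef f ∘ suc) (a f) (b f)

cons : ∀ {n} {A : Set} → A → (Fin n → A) → Fin (suc n) → A
cons x xs zero    = x
cons x xs (suc i) = xs i

-- Fourier–Motzkin elimination

-- The form is divided by the absolute value of its leading coefficient: `f ≥ 0` then reads
-- `x₀ ≥ - g` for `lower` and `x₀ ≤ g` for `upper`. Identities are stored rather than inequalities,
-- so that they serve rational points and sequences alike.
data Isolated {n} (f : Form (suc n)) : Set where
  free  : ∀ g → (∀ x t s → eval g (x ∘ suc) t s ≡ eval f x t s) → Isolated f
  lower : ∀ r g → 0ℚ ℚ.< r →
          (∀ x t s → x zero ℚ.+ eval g (x ∘ suc) t s ≡ r ℚ.* eval f x t s) → Isolated f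
  upper : ∀ r g → 0ℚ ℚ.< r →
          (∀ x t s → eval g (x ∘ suc) t s ℚ.- x zero ≡ r ℚ.* eval f x t s) → Isolated f

isolate : ∀ {n} (f : Form (suc n)) → Isolated f
isolate f with ℚₚ.<-cmp 0ℚ (coef f zero)
... | tri≈ _ 0≡c _ = free (tailForm f) λ x t s →
  trans (+-*-Solver.solve 3 (λ x d e → d :+ e := con 0ℚ :* x :+ d :+ e) refl
          (x zero) (dot (coef f ∘ suc) (x ∘ suc)) (a f ℚ.* t ℚ.+ b f ℚ.* s))
    (cong (λ c → c ℚ.* x zero ℚ.+ dot (coef f ∘ suc) (x ∘ suc) ℚ.+ (a f ℚ.* t ℚ.+ b f ℚ.* s)) 0≡c)
... | tri< 0<c _ _ = let r , 0<r , rc≡1 = reciprocal 0<c in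
  lower r (r ⊛ tailForm f) 0<r λ x t s →
    trans (cong₂ ℚ._+_ (trans (sym (ℚₚ.*-identityˡ (x zero))) (cong (ℚ._* x zero) (sym rc≡1)))
      (eval-⊛ r (tailForm f) (x ∘ suc) t s))
    (+-*-Solver.solve 5 (λ r c x d e → r :* c :* x :+ r :* (d :+ e) := r :* (c :* x :+ d :+ e)) refl
      r (coef f zero) (x zero) (dot (coef f ∘ suc) (x ∘ suc)) (a f ℚ.* t ℚ.+ b f ℚ.* s))
... | tri> _ _ c<0 = let r , 0<r , r-c≡1 = reciprocal (ℚₚ.neg-antimono-< c<0) in
  upper r (r ⊛ tailForm f) 0<r λ x t s →
    trans (cong₂ (λ p q → p ℚ.- q) (eval-⊛ r (tailForm f) (x ∘ suc) t s)
      (trans (sym (ℚₚ.*-identityˡ (x zero))) (cong (ℚ._* x zero) (sym r-c≡1))))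
    (+-*-Solver.solve 5
      (λ r c x d e → r :* (d :+ e) :- r :* (:- c) :* x := r :* (c :* x :+ d :+ e)) refl
      r (coef f zero) (x zero) (dot (coef f ∘ suc) (x ∘ suc)) (a f ℚ.* t ℚ.+ b f ℚ.* s))

record Split (n : ℕ) : Set where
  constructor split
  field
    lowers uppers frees : List (Form n)

open Split

split-one : ∀ {n} {f : Form (suc n)} → Isolated f → Split n → Split n
split-one (free g _)      (split ls us fs) = split ls us (g ∷ fs)
split-one (lower _ g _ _) (split ls us fs) = split (g ∷ ls) us fs
split-one (upper _ g _ _) (split ls us fs) = split ls (g ∷ us) fs

split-all : ∀ {n} → List (Form (suc n)) → Split n
split-all []       = split [] [] []
split-all (f ∷ fs) = split-one (isolate f) (split-all fs)

-- A lower bound `- l` and an upper bound `u` are compatible exactly when `l ⊕ u` is nonnegative.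
eliminate : ∀ {n} → List (Form (suc n)) → List (Form n)
eliminate fs = let split ls us zs = split-all fs in cartesianProductWith _⊕_ ls us ++ zs

-- Soundness is proved for sequences, because it has to bound real solutions; completeness only at
-- rational points, because it is there that a maximiser is constructed.
AsymptoticallyNonneg : ∀ {n} → (ℕ → Fin n → ℚ) → (ℕ → ℚ) → (ℕ → ℚ) → Form n → Set
AsymptoticallyNonneg x t s f = Nonneg λ k → eval f (x k) (t k) (s k)

module _ {n} (x : ℕ → Fin (suc n) → ℚ) (t s : ℕ → ℚ) where
  private
    Above Below : Form n → Set
    Above g = Nonneg λ k → x k zero ℚ.+ eval g (x k ∘ suc) (t k) (s k)
    Below g = Nonneg λ k → eval g (x k ∘ suc) (t k) (s k) ℚ.- x k zero

    Holds : Split n → Set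
    Holds S = All Above (lowers S) × All Below (uppers S)
      × All (AsymptoticallyNonneg (λ k → x k ∘ suc) t s) (frees S)

    holds-one : ∀ {f} (i : Isolated f) {S} → AsymptoticallyNonneg x t s f →
                Holds S → Holds (split-one i S)
    holds-one (free g eq) p (ls , us , fs) =
      ls , us , nonneg-resp (λ k → sym (eq (x k) (t k) (s k))) p ∷ fs
    holds-one (lower r g 0<r eq) p (ls , us , fs) =
      nonneg-resp (λ k → sym (eq (x k) (t k) (s k))) (nonneg-scale (ℚₚ.<⇒≤ 0<r) p) ∷ ls , us , fs
    holds-one (upper r g 0<r eq) p (ls , us , fs) =
      ls , nonneg-resp (λ k → sym (eq (x k) (t k) (s k))) (nonneg-scale (ℚₚ.<⇒≤ 0<r) p) ∷ us , fs

    holds-all : ∀ {fs} → All (AsymptoticallyNonneg x t s) fs → Holds (split-all fs)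
    holds-all []       = [] , [] , []
    holds-all {f ∷ fs} (p ∷ ps) = holds-one (isolate f) p (holds-all ps)

    pairwise : ∀ {ls us} → All Above ls → All Below us →
               All (AsymptoticallyNonneg (λ k → x k ∘ suc) t s) (cartesianProductWith _⊕_ ls us)
    pairwise []                _  = []
    pairwise {l ∷ _} {us} (above ∷ ls) bs =
      Allₚ.++⁺ (Allₚ.map⁺ (All.map (λ {u} → add u) bs)) (pairwise ls bs)
      where
      add : ∀ u → Below u → AsymptoticallyNonneg (λ k → x k ∘ suc) t s (l ⊕ u)
      add u below = nonneg-resp (λ k → trans
        (+-*-Solver.solve 3 (λ x l u → (x :+ l) :+ (u :- x) := l :+ u) refl (x k zero)
          (eval l (x k ∘ suc) (t k) (s k)) (eval u (x k ∘ suc) (t k) (s k)))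
        (sym (eval-⊕ l u (x k ∘ suc) (t k) (s k)))) (nonneg-+ above below)

  eliminate-sound : ∀ {fs} → All (AsymptoticallyNonneg x t s) fs →
                    All (AsymptoticallyNonneg (λ k → x k ∘ suc) t s) (eliminate fs)
  eliminate-sound ps = let ls , us , fs = holds-all ps in Allₚ.++⁺ (pairwise ls us) fs

between : ∀ ls us → All (λ l → All (l ℚ.≤_) us) ls →
          ∃[ x ] (All (ℚ._≤ x) ls × All (x ℚ.≤_) us)
between []       us _ = min 0ℚ us , [] , min≤xs 0ℚ us
between (l ∷ ls) us (l≤us ∷ ls≤us) = max l ls , ⊥≤max l ls ∷ xs≤max l ls
  , All.tabulate λ u∈us → max≤v⁺ (All.lookup l≤us u∈us) (All.map (λ l≤us → All.lookup l≤us u∈us) ls≤us)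

module _ {n} (xs : Fin n → ℚ) (t s : ℚ) where
  private
    value : Form n → ℚ
    value g = eval g xs t s

    separated : ∀ ls us → All (λ g → 0ℚ ℚ.≤ value g) (cartesianProductWith _⊕_ ls us) →
                All (λ l → All (l ℚ.≤_) (List.map value us)) (List.map (λ g → ℚ.- value g) ls)
    separated []       us _  = []
    separated (l ∷ ls) us ps =
      Allₚ.map⁺ (All.map (λ {u} 0≤l+u → 0≤q-p⇒p≤q (subst (0ℚ ℚ.≤_)
        (trans (eval-⊕ l u xs t s)
          (+-*-Solver.solve 2 (λ l u → l :+ u := u :- (:- l)) refl (value l) (value u))) 0≤l+u))
        (Allₚ.map⁻ (Allₚ.++⁻ˡ (List.map (l ⊕_) us) ps)))
      ∷ separated ls us (Allₚ.++⁻ʳ (List.map (l ⊕_) us) ps)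

    restore : ∀ x fs → All (λ g → ℚ.- value g ℚ.≤ x) (lowers (split-all fs)) →
              All (λ g → x ℚ.≤ value g) (uppers (split-all fs)) →
              All (λ g → 0ℚ ℚ.≤ value g) (frees (split-all fs)) →
              All (λ f → 0ℚ ℚ.≤ eval f (cons x xs) t s) fs
    restore x []       _  _  _ = []
    restore x (f ∷ fs) ls us zs with isolate f
    ... | free g eq = subst (0ℚ ℚ.≤_) (eq (cons x xs) t s) (All.head zs)
                      ∷ restore x fs ls us (All.tail zs)
    ... | lower r g 0<r eq = ℚₚ.*-cancelˡ-≤-pos r {{ℚ.positive 0<r}}
                               (subst₂ ℚ._≤_ (sym (ℚₚ.*-zeroʳ r)) (trans
                                 (+-*-Solver.solve 2 (λ x v → x :- (:- v) := x :+ v) refl x (value g))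
                                 (eq (cons x xs) t s))
                                 (p≤q⇒0≤q-p (All.head ls)))
                             ∷ restore x fs (All.tail ls) us zs
    ... | upper r g 0<r eq = ℚₚ.*-cancelˡ-≤-pos r {{ℚ.positive 0<r}}
                               (subst₂ ℚ._≤_ (sym (ℚₚ.*-zeroʳ r)) (eq (cons x xs) t s)
                                 (p≤q⇒0≤q-p (All.head us)))
                             ∷ restore x fs ls (All.tail us) zs

  eliminate-complete : ∀ fs → All (λ g → 0ℚ ℚ.≤ eval g xs t s) (eliminate fs) →
                       ∃[ x ] All (λ f → 0ℚ ℚ.≤ eval f (cons x xs) t s) fs
  eliminate-complete fs ps =
    let split ls us zs = split-all fs
        x , ls≤x , x≤us = between (List.map (λ g → ℚ.- value g) ls) (List.map value us)
          (separated ls us (Allₚ.++⁻ˡ (cartesianProductWith _⊕_ ls us) ps))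
    in x , restore x fs (Allₚ.map⁻ ls≤x) (Allₚ.map⁻ x≤us)
             (Allₚ.++⁻ʳ (cartesianProductWith _⊕_ ls us) ps)

project : ∀ {n} → List (Form n) → List (Form 0)
project {zero}  fs = fs
project {suc n} fs = project (eliminate fs)

project-sound : ∀ {n} (x : ℕ → Fin n → ℚ) t s {fs} → All (AsymptoticallyNonneg x t s) fs →
                ∃[ x₀ ] All (AsymptoticallyNonneg x₀ t s) (project fs)
project-sound {zero}  x t s ps = x , ps
project-sound {suc n} x t s ps = project-sound (λ k → x k ∘ suc) t s (eliminate-sound x t s ps)

project-complete : ∀ {n} t s (fs : List (Form n)) →
                   (∀ x₀ → All (λ g → 0ℚ ℚ.≤ eval g x₀ t s) (project fs)) →
                   ∃[ x ] All (λ f → 0ℚ ℚ.≤ eval f x t s) fs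
project-complete {zero}  t s fs ps = (λ ()) , ps (λ ())
project-complete {suc n} t s fs ps =
  let xs , qs = project-complete t s (eliminate fs) ps
      x , rs  = eliminate-complete xs t s fs qs
  in cons x xs , rs

-- The optimum of a homogeneous system

-- At `s = 1` a form without variables is `a t + b`. Only forms with `a < 0` limit `t` from above,
-- at the root `- b / a`, and `attained` records the least such root.
data Tightest (fs : List (Form 0)) : Set where
  unbounded : All (λ f → 0ℚ ℚ.≤ a f) fs → Tightest fs
  attained   : ∀ t → 0ℚ ℚ.≤ t → All (λ f → 0ℚ ℚ.≤ a f ℚ.* t ℚ.+ b f) fs →
              Any (λ f → a f ℚ.< 0ℚ × a f ℚ.* t ℚ.+ b f ≡ 0ℚ) fs → Tightest fs

tightest : ∀ fs → All (λ f → 0ℚ ℚ.≤ b f) fs → Tightest fs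
tightest []       _ = unbounded []
tightest (f ∷ fs) (0≤b ∷ 0≤bs) with a f ℚₚ.<? 0ℚ | tightest fs 0≤bs
... | no a≮0  | unbounded 0≤as = unbounded (ℚₚ.≮⇒≥ a≮0 ∷ 0≤as)
... | no a≮0  | attained t 0≤t hold tight =
  attained t 0≤t (0≤+ (0≤* (ℚₚ.≮⇒≥ a≮0) 0≤t) 0≤b ∷ hold) (there tight)
... | yes a<0 | rest = go rest
  where
  inverse : ∃[ r ] (0ℚ ℚ.< r × r ℚ.* (ℚ.- a f) ≡ 1ℚ)
  inverse = reciprocal (ℚₚ.neg-antimono-< a<0)
  r : ℚ
  r = proj₁ inverse
  t₀ : ℚ
  t₀ = r ℚ.* b f
  0≤t₀ : 0ℚ ℚ.≤ t₀
  0≤t₀ = 0≤* (ℚₚ.<⇒≤ (proj₁ (proj₂ inverse))) 0≤b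
  zero-at-t₀ : a f ℚ.* t₀ ℚ.+ b f ≡ 0ℚ
  zero-at-t₀ = trans
    (+-*-Solver.solve 3 (λ a b r → a :* (r :* b) :+ b := b :- r :* (:- a) :* b) refl (a f) (b f) r)
    (trans (cong (λ z → b f ℚ.- z ℚ.* b f) (proj₂ (proj₂ inverse)))
      (+-*-Solver.solve 1 (λ b → b :- con 1ℚ :* b := con 0ℚ) refl (b f)))
  -- Lowering the bound to `t₀` spoils no form: with slope `≥ 0` both summands are nonnegative, and
  -- with slope `≤ 0` the value grows as `t` decreases.
  smaller : ∀ {t g} → t₀ ℚ.≤ t → 0ℚ ℚ.≤ b g → 0ℚ ℚ.≤ a g ℚ.* t ℚ.+ b g → 0ℚ ℚ.≤ a g ℚ.* t₀ ℚ.+ b g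
  smaller {t} {g} t₀≤t 0≤b 0≤ with ℚₚ.≤-total 0ℚ (a g)
  ... | inj₁ 0≤a = 0≤+ (0≤* 0≤a 0≤t₀) 0≤b
  ... | inj₂ a≤0 = subst (0ℚ ℚ.≤_)
    (+-*-Solver.solve 4 (λ a b t t₀ → (a :* t :+ b) :+ (:- a) :* (t :- t₀) := a :* t₀ :+ b) refl
      (a g) (b g) t t₀)
    (0≤+ 0≤ (0≤* (ℚₚ.neg-antimono-≤ a≤0) (p≤q⇒0≤q-p t₀≤t)))
  go : Tightest fs → Tightest (f ∷ fs)
  go (unbounded 0≤as) = attained t₀ 0≤t₀
    (ℚₚ.≤-reflexive (sym zero-at-t₀)
      ∷ All.zipWith (λ (0≤a , 0≤b) → 0≤+ (0≤* 0≤a 0≤t₀) 0≤b) (0≤as , 0≤bs))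
    (here (a<0 , zero-at-t₀))
  go (attained t 0≤t hold tight) with ℚₚ.≤-total t₀ t
  ... | inj₁ t₀≤t = attained t₀ 0≤t₀
    (ℚₚ.≤-reflexive (sym zero-at-t₀)
      ∷ All.zipWith (λ {g} (0≤b , 0≤) → smaller {t} {g} t₀≤t 0≤b 0≤) (0≤bs , hold))
    (here (a<0 , zero-at-t₀))
  ... | inj₂ t≤t₀ = attained t 0≤t
    (subst₂ ℚ._≤_ zero-at-t₀ refl (0≤q-p⇒p≤q (subst (0ℚ ℚ.≤_)
        (+-*-Solver.solve 4 (λ a b t t₀ → (:- a) :* (t₀ :- t) := a :* t :+ b :- (a :* t₀ :+ b)) refl
          (a f) (b f) t t₀)
        (0≤* (ℚₚ.<⇒≤ (ℚₚ.neg-antimono-< a<0)) (p≤q⇒0≤q-p t≤t₀)))) ∷ hold)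
    (there tight)

-- The largest t for which a homogeneous system is solvable with s = 1; the slope of t in s
-- bounds every asymptotic solution.
record Optimum {n} (fs : List (Form n)) : Set where
  field
    value    : ℚ
    0≤value  : 0ℚ ℚ.≤ value
    point    : Fin n → ℚ
    feasible : All (λ f → 0ℚ ℚ.≤ eval f point value 1ℚ) fs
    maximal  : ∀ x t s → All (AsymptoticallyNonneg x t s) fs →
               Nonneg λ k → value ℚ.* s k ℚ.- t k

-- The point at `t = 0` forces the constant terms `b` of all projected forms to be nonnegative. If
-- no projected form had a negative slope, `t = B` would satisfy them all and lift to a solution,
-- against the infeasibility of `B`.
optimum : ∀ {n} (fs : List (Form n)) →
          ∃[ x ] All (λ f → 0ℚ ℚ.≤ eval f x 0ℚ 1ℚ) fs →
          ∀ B → ¬ (∃[ x ] All (λ f → 0ℚ ℚ.≤ eval f x B 1ℚ) fs) → 0ℚ ℚ.≤ B →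
          Optimum fs
optimum fs (x , x-feasible) B infeasible 0≤B = go (tightest (project fs) 0≤bs)
  where
  at-one : ∀ (f : Form 0) x₀ t → eval f x₀ t 1ℚ ≡ a f ℚ.* t ℚ.+ b f
  at-one f x₀ t = trans (ℚₚ.+-identityˡ _) (cong (a f ℚ.* t ℚ.+_) (ℚₚ.*-identityʳ (b f)))

  0≤bs : All (λ f → 0ℚ ℚ.≤ b f) (project fs)
  0≤bs = All.map
    (λ {f} p → subst (0ℚ ℚ.≤_)
      (trans (at-one f (λ ()) 0ℚ) (trans (cong (ℚ._+ b f) (ℚₚ.*-zeroʳ (a f))) (ℚₚ.+-identityˡ (b f))))
      (≤-all-ε λ ε 0<ε → let N , le = eventually p ε 0<ε in le N ℕₚ.≤-refl))
    (proj₂ (project-sound (λ _ → x) (λ _ → 0ℚ) (λ _ → 1ℚ) (All.map nonneg-const x-feasible)))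

  go : Tightest (project fs) → Optimum fs
  go (unbounded 0≤as) = contradiction
    (project-complete B 1ℚ fs λ x₀ →
      All.zipWith (λ {f} (0≤a , 0≤b) → subst (0ℚ ℚ.≤_) (sym (at-one f x₀ B)) (0≤+ (0≤* 0≤a 0≤B) 0≤b))
        (0≤as , 0≤bs))
    infeasible
  go (attained t* 0≤t* hold tight) = record
    { value    = t*
    ; 0≤value  = 0≤t*
    ; point    = proj₁ solution
    ; feasible = proj₂ solution
    ; maximal  = λ x t s ps →
        let x₀ , qs = project-sound x t s ps in bind t s x₀ tight qs
    }
    where
    solution : ∃[ x ] All (λ f → 0ℚ ℚ.≤ eval f x t* 1ℚ) fs
    solution = project-complete t* 1ℚ fs λ x₀ →
      All.map (λ {f} → subst (0ℚ ℚ.≤_) (sym (at-one f x₀ t*))) hold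

    -- As `b = - a t*`, the tight form equals `- a (t* s - t)`, and scaling by the reciprocal of
    -- `- a` leaves the claim. Nothing is divided by `s`.
    bind : ∀ t s x₀ {gs} → Any (λ f → a f ℚ.< 0ℚ × a f ℚ.* t* ℚ.+ b f ≡ 0ℚ) gs →
           All (AsymptoticallyNonneg x₀ t s) gs → Nonneg λ k → t* ℚ.* s k ℚ.- t k
    bind t s x₀ (there tight) (_ ∷ ps) = bind t s x₀ tight ps
    bind t s x₀ {f ∷ _} (here (a<0 , at+b≡0)) (p ∷ _) with reciprocal (ℚₚ.neg-antimono-< a<0)
    ... | r , 0<r , r-a≡1 = nonneg-resp
      (λ k → trans
        (+-*-Solver.solve 6 (λ r a b t* t s → r :* (con 0ℚ :+ (a :* t :+ b :* s))
          := r :* (:- a) :* (t* :* s :- t) :+ r :* (a :* t* :+ b) :* s) refl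
          r (a f) (b f) t* (t k) (s k))
        (trans (cong₂ (λ u v → u ℚ.* (t* ℚ.* s k ℚ.- t k) ℚ.+ r ℚ.* v ℚ.* s k) r-a≡1 at+b≡0)
          (+-*-Solver.solve 4 (λ r t* t s → con 1ℚ :* (t* :* s :- t) :+ r :* con 0ℚ :* s
            := t* :* s :- t) refl r t* (t k) (s k))))
      (nonneg-scale (ℚₚ.<⇒≤ 0<r) p)

-- The linear program

ι : ℕ → ℚ
ι n = ℤ.+ n ℚ./ 1

unit : ∀ {n} → Fin n → Fin n → ℚ
unit zero    = cons 1ℚ λ _ → 0ℚ
unit (suc i) = cons 0ℚ (unit i)

dot-zero : ∀ {n} (x : Fin n → ℚ) → dot (λ _ → 0ℚ) x ≡ 0ℚ
dot-zero {n} x = trans (sum-cong-≗ λ i → ℚₚ.*-zeroˡ (x i)) (sum-replicate-zero n)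

dot-unit : ∀ {n} (i : Fin n) x → dot (unit i) x ≡ x i
dot-unit zero    x = trans
  (cong₂ ℚ._+_ (ℚₚ.*-identityˡ (x zero)) (dot-zero (x ∘ suc))) (ℚₚ.+-identityʳ (x zero))
dot-unit (suc i) x = trans
  (cong₂ ℚ._+_ (ℚₚ.*-zeroˡ (x zero)) (dot-unit i (x ∘ suc))) (ℚₚ.+-identityˡ (x (suc i)))

sum-nonneg : ∀ {n} {x : Fin n → ℚ} → (∀ i → 0ℚ ℚ.≤ x i) → 0ℚ ℚ.≤ sum x
sum-nonneg {zero}  0≤x = ℚₚ.≤-refl
sum-nonneg {suc n} 0≤x = 0≤+ (0≤x zero) (sum-nonneg (0≤x ∘ suc))

weight : ∀ {n} → Subset n → Fin n → ℚ
weight Q i = if lookup Q i then ι (toℕ (next Q i)) else 0ℚ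

dropForm : ∀ {m} → Fin m → Form (suc m)
dropForm i = form (λ j → unit (inject₁ i) j ℚ.+ (ℚ.- 1ℚ) ℚ.* unit (suc i) j) 0ℚ 0ℚ

nonnegForm : ∀ {n} → Fin n → Form n
nonnegForm i = form (unit i) 0ℚ 0ℚ

-- This is `r (∑ y - s)`; the signs `r = 1` and `r = -1` together express the homogenised
-- normalisation `∑ y = s`.
totalForm : ∀ {n} → ℚ → Form n
totalForm r = form (λ _ → r) 0ℚ (ℚ.- r)

boundForm : ∀ {n} → Subset n → Form n
boundForm Q = form (weight Q) (ℚ.- 1ℚ) 0ℚ

subsets : ∀ n → List (Subset n)
subsets zero    = [] ∷ []
subsets (suc n) = List.map (inside ∷_) (subsets n) ++ List.map (outside ∷_) (subsets n)

∈-subsets : ∀ {n} (Q : Subset n) → Q ∈ subsets n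
∈-subsets []            = here refl
∈-subsets (inside  ∷ Q) = ∈ₚ.∈-++⁺ˡ (∈ₚ.∈-map⁺ (inside ∷_) (∈-subsets Q))
∈-subsets (outside ∷ Q) = ∈ₚ.∈-++⁺ʳ _ (∈ₚ.∈-map⁺ (outside ∷_) (∈-subsets Q))

constraints : ∀ m → List (Form (suc m))
constraints m = List.tabulate dropForm ++ List.tabulate nonnegForm ++
  totalForm 1ℚ ∷ totalForm (ℚ.- 1ℚ) ∷ List.map (boundForm ∘ (inside ∷_)) (subsets m)

module _ {m} {P : Form (suc m) → Set} where
  record Constraints : Set where
    field
      drops  : ∀ i → P (dropForm i)
      signs  : ∀ i → P (nonnegForm i)
      total⁺ : P (totalForm 1ℚ)
      total⁻ : P (totalForm (ℚ.- 1ℚ))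
      bounds : ∀ Q → P (boundForm (inside ∷ Q))

  constraints⁺ : Constraints → All P (constraints m)
  constraints⁺ c = Allₚ.++⁺ (Allₚ.tabulate⁺ drops) (Allₚ.++⁺ (Allₚ.tabulate⁺ signs)
    (total⁺ ∷ total⁻ ∷ Allₚ.map⁺ (All.tabulate λ {Q} _ → bounds Q)))
    where open Constraints c

  constraints⁻ : All P (constraints m) → Constraints
  constraints⁻ ps with Allₚ.++⁻ (List.tabulate dropForm) ps
  ... | ds , ps′ with Allₚ.++⁻ (List.tabulate nonnegForm) ps′
  ... | ns , p ∷ q ∷ bs = record
    { drops  = Allₚ.tabulate⁻ ds
    ; signs  = Allₚ.tabulate⁻ ns
    ; total⁺ = p
    ; total⁻ = q
    ; bounds = λ Q → All.lookup (Allₚ.map⁻ bs) (∈-subsets Q)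
    }

module _ {m} (y : Fin (suc m) → ℚ) (t s : ℚ) where
  eval-drop : ∀ i → eval (dropForm i) y t s ≡ y (inject₁ i) ℚ.- y (suc i)
  eval-drop i = trans
    (cong (ℚ._+ (0ℚ ℚ.* t ℚ.+ 0ℚ ℚ.* s))
      (trans (dot-+ (unit (inject₁ i)) (λ j → (ℚ.- 1ℚ) ℚ.* unit (suc i) j) y)
        (cong₂ ℚ._+_ (dot-unit (inject₁ i) y)
          (trans (dot-* (ℚ.- 1ℚ) (unit (suc i)) y) (cong (ℚ.- 1ℚ ℚ.*_) (dot-unit (suc i) y))))))
    (+-*-Solver.solve 4 (λ p q t s → p :+ (:- con 1ℚ) :* q :+ (con 0ℚ :* t :+ con 0ℚ :* s) := p :- q)
      refl (y (inject₁ i)) (y (suc i)) t s)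

  eval-nonneg : ∀ i → eval (nonnegForm i) y t s ≡ y i
  eval-nonneg i = trans (cong (ℚ._+ (0ℚ ℚ.* t ℚ.+ 0ℚ ℚ.* s)) (dot-unit i y))
    (+-*-Solver.solve 3 (λ p t s → p :+ (con 0ℚ :* t :+ con 0ℚ :* s) := p) refl (y i) t s)

  eval-total : ∀ r → eval (totalForm r) y t s ≡ r ℚ.* (sum y ℚ.- s)
  eval-total r = trans (cong (ℚ._+ (0ℚ ℚ.* t ℚ.+ (ℚ.- r) ℚ.* s)) (sym (*-distribˡ-sum r y)))
    (+-*-Solver.solve 4 (λ r p t s → r :* p :+ (con 0ℚ :* t :+ (:- r) :* s) := r :* (p :- s))
      refl r (sum y) t s)

  eval-bound : ∀ Q → eval (boundForm Q) y t s ≡ dot (weight Q) y ℚ.- t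
  eval-bound Q = +-*-Solver.solve 3 (λ p t s → p :+ ((:- con 1ℚ) :* t :+ con 0ℚ :* s) := p :- t)
    refl (dot (weight Q) y) t s

antitone⁺ : ∀ {m} (y : Fin (suc m) → ℚ) → (∀ i → y (suc i) ℚ.≤ y (inject₁ i)) →
            ∀ i j → i Fin.≤ j → y j ℚ.≤ y i
antitone⁺         y step zero    zero    _           = ℚₚ.≤-refl
antitone⁺ {suc m} y step zero    (suc j) _           =
  ℚₚ.≤-trans (antitone⁺ (y ∘ suc) (step ∘ suc) zero j ℕ.z≤n) (step zero)
antitone⁺ {suc m} y step (suc i) (suc j) (ℕ.s≤s i≤j) = antitone⁺ (y ∘ suc) (step ∘ suc) i j i≤j

startsAtOne⁻ : ∀ {m} (P : Subset (suc m) → Set) → (∀ Q → P (inside ∷ Q)) →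
               ∀ Q → StartsAtOne Q → P Q
startsAtOne⁻ P p (inside ∷ Q) _ = p Q

seq-bound : ∀ {n} (Q : Subset n) (y : Fin n → ℝ) k →
            seq (∑∈ Q λ i → fromℕ′ (toℕ (next Q i)) * y i) k ≡ dot (weight Q) (λ i → seq (y i) k)
seq-bound Q y k = trans
  (seq-∑ (λ i → if lookup Q i then fromℕ′ (toℕ (next Q i)) * y i else 0ℝ) k)
  (sum-cong-≗ λ i → go (lookup Q i) i)
  where
  go : ∀ b i → seq (if b then fromℕ′ (toℕ (next Q i)) * y i else 0ℝ) k
       ≡ (if b then ι (toℕ (next Q i)) else 0ℚ) ℚ.* seq (y i) k
  go true  i = refl
  go false i = sym (ℚₚ.*-zeroˡ (seq (y i) k))

0≤ι : ∀ n → 0ℚ ℚ.≤ ι n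
0≤ι n = ℚₚ.nonNegative⁻¹ (ι n) {{ℚₚ.normalize-nonNeg n 1}}

-- `maximal` admits an arbitrary real total `s`, so that it applies to the costs of an instance and
-- to integer certificates without normalising either.
record LPOptimum (m : ℕ) : Set where
  field
    value   : ℚ
    0≤value : 0ℚ ℚ.≤ value
    y       : Fin (suc m) → ℚ
    drops   : ∀ i → y (suc i) ℚ.≤ y (inject₁ i)
    0≤y     : ∀ i → 0ℚ ℚ.≤ y i
    total   : sum y ≡ 1ℚ
    bounded : ∀ Q → StartsAtOne Q → value ℚ.≤ dot (weight Q) y
    maximal : ∀ (t s : ℝ) (y : Fin (suc m) → ℝ) → (∀ i j → i Fin.≤ j → y j ≤ y i) →
              (∀ i → 0ℝ ≤ y i) → ∑ y ≈ s →
              (∀ Q → StartsAtOne Q → t ≤ ∑∈ Q λ i → fromℕ′ (toℕ (next Q i)) * y i) →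
              t ≤ fromℚ value * s

abstract
  -- Abstract, so that type checking never unfolds the elimination, each step of which may square
  -- the number of forms. Everything later relies on the record fields alone.
  lp-optimum : ∀ m → LPOptimum m
  lp-optimum m = record
    { value   = value
    ; 0≤value = 0≤value
    ; y       = y
    ; drops   = λ i → 0≤q-p⇒p≤q (subst (0ℚ ℚ.≤_) (eval-drop y value 1ℚ i) (drops i))
    ; 0≤y     = λ i → subst (0ℚ ℚ.≤_) (eval-nonneg y value 1ℚ i) (signs i)
    ; total   = ℚₚ.≤-antisym
        (0≤q-p⇒p≤q (subst (0ℚ ℚ.≤_) (trans (eval-total y value 1ℚ (ℚ.- 1ℚ))
          (+-*-Solver.solve 1 (λ p → (:- con 1ℚ) :* (p :- con 1ℚ) := con 1ℚ :- p) refl (sum y))) total⁻))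
        (0≤q-p⇒p≤q (subst (0ℚ ℚ.≤_) (trans (eval-total y value 1ℚ 1ℚ)
          (ℚₚ.*-identityˡ _)) total⁺))
    ; bounded = startsAtOne⁻ (λ Q → value ℚ.≤ dot (weight Q) y) λ Q →
        0≤q-p⇒p≤q (subst (0ℚ ℚ.≤_) (eval-bound y value 1ℚ (inside ∷ Q)) (bounds Q))
    ; maximal = λ t s y anti 0≤y ∑y≈s bound → nonneg⇒≤ {t} {fromℚ value * s} $
        maximal (λ k i → seq (y i) k) (seq t) (seq s) $ constraints⁺ record
        { drops  = λ i → nonneg-resp
            (λ k → sym (eval-drop (λ i → seq (y i) k) (seq t k) (seq s k) i))
            (≤⇒nonneg {y (suc i)} {y (inject₁ i)} (anti (inject₁ i) (suc i) (inject₁≤suc i)))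
        ; signs  = λ i → nonneg-resp
            (λ k → trans (ℚₚ.+-identityʳ _) (sym (eval-nonneg (λ i → seq (y i) k) (seq t k) (seq s k) i)))
            (≤⇒nonneg {0ℝ} {y i} (0≤y i))
        ; total⁺ = nonneg-resp
            (λ k → trans (cong (ℚ._- seq s k) (seq-∑ y k)) (sym (trans
              (eval-total (λ i → seq (y i) k) (seq t k) (seq s k) 1ℚ) (ℚₚ.*-identityˡ _))))
            (≤⇒nonneg {s} {∑ y} (proj₂ ∑y≈s))
        ; total⁻ = nonneg-resp
            (λ k → trans (cong (λ p → seq s k ℚ.- p) (seq-∑ y k)) (sym (trans
              (eval-total (λ i → seq (y i) k) (seq t k) (seq s k) (ℚ.- 1ℚ))
              (+-*-Solver.solve 2 (λ p s → (:- con 1ℚ) :* (p :- s) := s :- p) refl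
                (sum λ i → seq (y i) k) (seq s k)))))
            (≤⇒nonneg {∑ y} {s} (proj₁ ∑y≈s))
        ; bounds = λ Q → nonneg-resp
            (λ k → trans (cong (ℚ._- seq t k) (seq-bound (inside ∷ Q) y k))
              (sym (eval-bound (λ i → seq (y i) k) (seq t k) (seq s k) (inside ∷ Q))))
            (≤⇒nonneg {t} {∑∈ (inside ∷ Q) λ i → fromℕ′ (toℕ (next (inside ∷ Q) i)) * y i}
              (bound (inside ∷ Q) refl))
        }
    }
    where
    inject₁≤suc : ∀ {m} (i : Fin m) → inject₁ i Fin.≤ suc i
    inject₁≤suc zero    = ℕ.z≤n
    inject₁≤suc (suc i) = ℕ.s≤s (inject₁≤suc i)

    -- All weight on level 1 is feasible with `t = 0`.
    first : Fin (suc m) → ℚ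
    first = unit zero

    0≤unit : ∀ {n} (i j : Fin n) → 0ℚ ℚ.≤ unit i j
    0≤unit zero    zero    = 0≤1
    0≤unit zero    (suc j) = ℚₚ.≤-refl
    0≤unit (suc i) zero    = ℚₚ.≤-refl
    0≤unit (suc i) (suc j) = 0≤unit i j

    0≤weight : ∀ {n} (Q : Subset n) i → 0ℚ ℚ.≤ weight Q i
    0≤weight Q i with lookup Q i
    ... | true  = 0≤ι (toℕ (next Q i))
    ... | false = ℚₚ.≤-refl

    sum-first : sum first ≡ 1ℚ
    sum-first = trans (cong (1ℚ ℚ.+_) (sum-replicate-zero m)) (ℚₚ.+-identityʳ 1ℚ)

    first-drops : ∀ {m} (i : Fin m) → unit {suc m} zero (suc i) ℚ.≤ unit zero (inject₁ i)
    first-drops zero    = 0≤1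
    first-drops (suc i) = ℚₚ.≤-refl

    first-feasible : All (λ f → 0ℚ ℚ.≤ eval f first 0ℚ 1ℚ) (constraints m)
    first-feasible = constraints⁺ record
      { drops  = λ i → subst (0ℚ ℚ.≤_) (sym (eval-drop first 0ℚ 1ℚ i)) (p≤q⇒0≤q-p (first-drops i))
      ; signs  = λ i → subst (0ℚ ℚ.≤_) (sym (eval-nonneg first 0ℚ 1ℚ i)) (0≤unit zero i)
      ; total⁺ = total 1ℚ
      ; total⁻ = total (ℚ.- 1ℚ)
      ; bounds = λ Q → subst (0ℚ ℚ.≤_) (sym (eval-bound first 0ℚ 1ℚ (inside ∷ Q)))
          (p≤q⇒0≤q-p (sum-nonneg λ i → 0≤* (0≤weight (inside ∷ Q) i) (0≤unit zero i)))
      }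
      where
      total : ∀ r → 0ℚ ℚ.≤ eval (totalForm r) first 0ℚ 1ℚ
      total r = ℚₚ.≤-reflexive (sym (trans (eval-total first 0ℚ 1ℚ r)
        (trans (cong (λ p → r ℚ.* (p ℚ.- 1ℚ)) sum-first) (ℚₚ.*-zeroʳ r))))

    -- The set of level 1 alone has the single coefficient `top`, the number of levels, so its
    -- constraint gives `t ≤ top * y₁ ≤ top`. Hence `top + 1` is infeasible.
    Q₁ : Subset (suc m)
    Q₁ = inside ∷ ⊥

    top : ℚ
    top = weight Q₁ zero

    weight-tail : ∀ i → weight Q₁ (suc i) ≡ 0ℚ
    weight-tail i = cong (λ b → if b then ι (toℕ (next Q₁ (suc i))) else 0ℚ) (Vecₚ.lookup-replicate i outside)

    infeasible : ¬ (∃[ y ] All (λ f → 0ℚ ℚ.≤ eval f y (top ℚ.+ 1ℚ) 1ℚ) (constraints m))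
    infeasible (y , ps) = ℚₚ.<-irrefl refl (ℚₚ.<-≤-trans (ℚₚ.positive⁻¹ 1ℚ)
      (0≤q-p⇒p≤q (subst (0ℚ ℚ.≤_)
        (+-*-Solver.solve 3 (λ w y r → (w :* y :- (w :+ con 1ℚ)) :+ w :* (con 1ℚ :- (y :+ r)) :+ w :* r
           := con 0ℚ :- con 1ℚ) refl top (y zero) rest)
        (0≤+ (0≤+ le₁ (0≤* (0≤weight Q₁ zero) le₂)) (0≤* (0≤weight Q₁ zero) 0≤rest)))))
      where
      open Constraints (constraints⁻ ps)
      rest : ℚ
      rest = sum (y ∘ suc)
      0≤rest : 0ℚ ℚ.≤ rest
      0≤rest = sum-nonneg λ i → subst (0ℚ ℚ.≤_) (eval-nonneg y (top ℚ.+ 1ℚ) 1ℚ (suc i)) (signs (suc i))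
      le₁ : 0ℚ ℚ.≤ top ℚ.* y zero ℚ.- (top ℚ.+ 1ℚ)
      le₁ = subst (0ℚ ℚ.≤_) (trans (eval-bound y (top ℚ.+ 1ℚ) 1ℚ Q₁)
        (cong (ℚ._- (top ℚ.+ 1ℚ)) (trans
          (cong (top ℚ.* y zero ℚ.+_) (trans (sum-cong-≗ λ i → cong (ℚ._* y (suc i)) (weight-tail i))
            (dot-zero (y ∘ suc))))
          (ℚₚ.+-identityʳ (top ℚ.* y zero))))) (bounds ⊥)
      le₂ : 0ℚ ℚ.≤ 1ℚ ℚ.- (y zero ℚ.+ rest)
      le₂ = subst (0ℚ ℚ.≤_) (trans (eval-total y (top ℚ.+ 1ℚ) 1ℚ (ℚ.- 1ℚ))
        (+-*-Solver.solve 1 (λ p → (:- con 1ℚ) :* (p :- con 1ℚ) := con 1ℚ :- p) refl (sum y))) total⁻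

    open Optimum (optimum (constraints m) (first , first-feasible) (top ℚ.+ 1ℚ) infeasible
                   (0≤+ (0≤weight Q₁ zero) 0≤1)) renaming (point to y)
    open Constraints (constraints⁻ feasible)

module _ {m} (o : LPOptimum m) where
  open LPOptimum o

  lp-value : IsLPValue (suc m) (fromℚ value)
  lp-value = (fromℚ ∘ y , record
      { antitone    = λ i j i≤j → fromℚ-≤ (antitone⁺ y drops i j i≤j)
      ; nonNegative = λ i → fromℚ-≤ (0≤y i)
      ; normalised  = ≤-pointwise-≡ {∑ (fromℚ ∘ y)} {1ℝ} ∑≡1
                    , ≤-pointwise-≡ {1ℝ} {∑ (fromℚ ∘ y)} (sym ∘ ∑≡1)
      ; bound       = λ Q s → ≤-pointwise {fromℚ value} {∑∈ Q λ i → fromℕ′ (toℕ (next Q i)) * fromℚ (y i)}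
          λ k → subst (value ℚ.≤_) (sym (seq-bound Q (fromℚ ∘ y) k)) (bounded Q s)
      })
    , λ t (y , f) → let open Feasible f in
      ≤-trans {t} {fromℚ value * 1ℝ} {fromℚ value}
        (maximal t 1ℝ y antitone nonNegative normalised bound)
        (≤-pointwise-≡ {fromℚ value * 1ℝ} {fromℚ value} λ _ → ℚₚ.*-identityʳ value)
    where
    ∑≡1 : ∀ k → seq (∑ (fromℚ ∘ y)) k ≡ 1ℚ
    ∑≡1 k = trans (seq-∑ (fromℚ ∘ y) k) total

-- Steiner trees inside spanning edge sets

module _ (G : Graph) where
  open Graph G hiding (order; size)

  adjacent-mono : ∀ {F F′ u v} → F ⊆ F′ → Adjacent F u v → Adjacent F′ u v
  adjacent-mono F⊆F′ (e , e∈F , ends) = e , F⊆F′ e∈F , ends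

  adjacent-sym : ∀ {F u v} → Adjacent F u v → Adjacent F v u
  adjacent-sym (e , e∈F , ends) = e , e∈F , swap ends

  reachable-mono : ∀ {F F′ u v} → F ⊆ F′ → Reachable F u v → Reachable F′ u v
  reachable-mono F⊆F′ = Star.map (adjacent-mono F⊆F′)

  reachable-sym : ∀ {F u v} → Reachable F u v → Reachable F v u
  reachable-sym = Star.reverse adjacent-sym

  steiner⇒spans : ∀ {T F F′} → IsSteinerTree T F → F ⊆ F′ → Spans F′ T
  steiner⇒spans (W , T⊆W , tree) F⊆F′ u v u∈T v∈T =
    reachable-mono F⊆F′ (IsTree.connected tree u v (T⊆W u∈T) (T⊆W v∈T))

  -- The only fact about cycles used for pendant vertices: a vertex with a single neighbour lies on
  -- no cycle.
  cycle-neighbours : ∀ {F} (C : Cycle F) → let open Cycle C in ∀ i →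
    ∃[ j ] ∃[ j′ ] (j ≢ j′ × Adjacent F (vertex i) (vertex j) × Adjacent F (vertex i) (vertex j′))
  cycle-neighbours C zero = suc zero , fromℕ _ , (λ ()) , step zero , adjacent-sym close
    where open Cycle C
  cycle-neighbours C (suc i) with view i
  ... | ‵fromℕ     = inject₁ i , zero , (λ ()) , adjacent-sym (step i) , close
    where open Cycle C
  ... | ‵inject₁ j = inject₁ i , suc (suc j) , distinct-sides , adjacent-sym (step i) , step (suc j)
    where
    open Cycle C
    distinct-sides : inject₁ (inject₁ j) ≢ suc (suc j)
    distinct-sides eq = ℕₚ.m≢1+n+m (toℕ j) {1}
      (trans (sym (trans (Finₚ.toℕ-inject₁ (inject₁ j)) (Finₚ.toℕ-inject₁ j))) (cong toℕ eq))

  module Pendant {W F} (tree : IsTree W F) {u x} (u∈W : u ∈ˢ W) (x∉W : x ∉ W)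
                 (e : Edge) (ends : (source e ≡ u × target e ≡ x) ⊎ (source e ≡ x × target e ≡ u)) where
    open IsTree tree

    private
      W′ = W ∪ ⁅ x ⁆
      F′ = F ∪ ⁅ e ⁆

      x∈W′ : x ∈ˢ W′
      x∈W′ = Subsetₚ.q⊆p∪q W ⁅ x ⁆ (Subsetₚ.x∈⁅x⁆ x)

      W⊆W′ : W ⊆ W′
      W⊆W′ = Subsetₚ.p⊆p∪q ⁅ x ⁆

      ends∈W : ∀ {v w} → Adjacent F v w → v ∈ˢ W × w ∈ˢ W
      ends∈W (e , e∈F , inj₁ (refl , refl)) = within e e∈F
      ends∈W (e , e∈F , inj₂ (refl , refl)) = let s , t = within e e∈F in t , s

      old-or-new : ∀ {v w} → Adjacent F′ v w → Adjacent F v w ⊎ ((v ≡ u × w ≡ x) ⊎ (v ≡ x × w ≡ u))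
      old-or-new (e′ , e′∈F′ , ends′) with Subsetₚ.x∈p∪q⁻ F ⁅ e ⁆ e′∈F′
      ... | inj₁ e′∈F = inj₁ (e′ , e′∈F , ends′)
      ... | inj₂ e′∈e with refl ← Subsetₚ.x∈⁅y⁆⇒x≡y e e′∈e = inj₂ (compare ends ends′)
        where
        compare : ∀ {v w} → (source e ≡ u × target e ≡ x) ⊎ (source e ≡ x × target e ≡ u) →
                  (source e ≡ v × target e ≡ w) ⊎ (source e ≡ w × target e ≡ v) →
                  (v ≡ u × w ≡ x) ⊎ (v ≡ x × w ≡ u)
        compare (inj₁ (p , q)) (inj₁ (r , s)) = inj₁ (trans (sym r) p , trans (sym s) q)
        compare (inj₁ (p , q)) (inj₂ (r , s)) = inj₂ (trans (sym s) q , trans (sym r) p)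
        compare (inj₂ (p , q)) (inj₁ (r , s)) = inj₂ (trans (sym r) p , trans (sym s) q)
        compare (inj₂ (p , q)) (inj₂ (r , s)) = inj₁ (trans (sym s) q , trans (sym r) p)

      neighbour-of-x : ∀ {w} → Adjacent F′ x w → w ≡ u
      neighbour-of-x adj with old-or-new adj
      ... | inj₁ old            = contradiction (proj₁ (ends∈W old)) x∉W
      ... | inj₂ (inj₁ (x≡u , _)) = contradiction (subst (_∈ˢ W) (sym x≡u) u∈W) x∉W
      ... | inj₂ (inj₂ (_ , w≡u)) = w≡u

      avoiding-x : ∀ {v w} → v ≢ x → w ≢ x → Adjacent F′ v w → Adjacent F v w
      avoiding-x v≢x w≢x adj with old-or-new adj
      ... | inj₁ old              = old
      ... | inj₂ (inj₁ (_ , w≡x)) = contradiction w≡x w≢x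
      ... | inj₂ (inj₂ (v≡x , _)) = contradiction v≡x v≢x

      -- A cycle through `x` would give `x` two distinct neighbours, but `u` is the only one; a
      -- cycle that avoids `x` uses old edges only.
      acyclic′ : ¬ Cycle F′
      acyclic′ C with Finₚ.any? (λ i → Cycle.vertex C i Finₚ.≟ x)
      ... | yes (i , refl) =
        let j , j′ , j≢j′ , adj , adj′ = cycle-neighbours C i
        in j≢j′ (distinct (trans (neighbour-of-x adj) (sym (neighbour-of-x adj′))))
        where open Cycle C
      ... | no x∉C = acyclic record
        { vertex   = vertex
        ; distinct = distinct
        ; step     = λ i → avoiding-x (λ eq → x∉C (inject₁ i , eq)) (λ eq → x∉C (suc i , eq)) (step i)
        ; close    = avoiding-x (λ eq → x∉C (_ , eq)) (λ eq → x∉C (zero , eq)) close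
        }
        where open Cycle C

      to-u : ∀ {v} → v ∈ˢ W′ → Reachable F′ v u
      to-u {v} v∈W′ with Subsetₚ.x∈p∪q⁻ W ⁅ x ⁆ v∈W′
      ... | inj₁ v∈W = reachable-mono (Subsetₚ.p⊆p∪q ⁅ e ⁆) (connected v u v∈W u∈W)
      ... | inj₂ v∈x with refl ← Subsetₚ.x∈⁅y⁆⇒x≡y x v∈x =
        (e , Subsetₚ.q⊆p∪q F ⁅ e ⁆ (Subsetₚ.x∈⁅x⁆ e) , swap ends) ◅ Star.ε

      within′ : ∀ e′ → e′ ∈ˢ F′ → source e′ ∈ˢ W′ × target e′ ∈ˢ W′
      within′ e′ e′∈F′ with Subsetₚ.x∈p∪q⁻ F ⁅ e ⁆ e′∈F′
      ... | inj₁ e′∈F = let s , t = within e′ e′∈F in W⊆W′ s , W⊆W′ t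
      ... | inj₂ e′∈e with refl ← Subsetₚ.x∈⁅y⁆⇒x≡y e e′∈e = new ends
        where
        new : (source e ≡ u × target e ≡ x) ⊎ (source e ≡ x × target e ≡ u) →
              source e ∈ˢ W′ × target e ∈ˢ W′
        new (inj₁ (refl , refl)) = W⊆W′ u∈W , x∈W′
        new (inj₂ (refl , refl)) = x∈W′ , W⊆W′ u∈W

    pendant-tree : IsTree W′ F′
    pendant-tree = record
      { nonempty  = x , x∈W′
      ; within    = within′
      ; connected = λ v w v∈W′ w∈W′ → to-u v∈W′ ◅◅ reachable-sym (to-u w∈W′)
      ; acyclic   = acyclic′
      }

    ∣W∣<∣W′∣ : ∣ W ∣ ℕ.< ∣ W′ ∣
    ∣W∣<∣W′∣ = Subsetₚ.p⊂q⇒∣p∣<∣q∣ (W⊆W′ , x , x∈W′ , x∉W)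

  singleton-tree : ∀ r → IsTree ⁅ r ⁆ ⊥
  singleton-tree r = record
    { nonempty  = r , Subsetₚ.x∈⁅x⁆ r
    ; within    = λ e e∈⊥ → contradiction e∈⊥ Subsetₚ.∉⊥
    ; connected = λ u v u∈r v∈r → subst₂ (Reachable ⊥)
        (sym (Subsetₚ.x∈⁅y⁆⇒x≡y r u∈r)) (sym (Subsetₚ.x∈⁅y⁆⇒x≡y r v∈r)) Star.ε
    ; acyclic   = λ C → let e , e∈⊥ , _ = Cycle.close C in Subsetₚ.∉⊥ e∈⊥
    }

  Closed : EdgeSet → Subset (Graph.order G) → Set
  Closed E W = ∀ {v w} → v ∈ˢ W → Adjacent E v w → w ∈ˢ W

  closed-reachable : ∀ {E W} → Closed E W → ∀ {v w} → v ∈ˢ W → Reachable E v w → w ∈ˢ W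
  closed-reachable closed v∈W Star.ε           = v∈W
  closed-reachable closed v∈W (adj ◅ path) = closed-reachable closed (closed v∈W adj) path

  -- A verb, not the leaves of a tree: the edge crosses from `W` to its complement.
  Leaves : EdgeSet → Subset (Graph.order G) → Edge → Set
  Leaves E W e = e ∈ˢ E × ((source e ∈ˢ W × target e ∉ W) ⊎ (target e ∈ˢ W × source e ∉ W))

  leaves? : ∀ E W e → Dec (Leaves E W e)
  leaves? E W e = (e Subsetₚ.∈? E) ×-dec
    (((source e Subsetₚ.∈? W) ×-dec ¬? (target e Subsetₚ.∈? W)) ⊎-dec
     ((target e Subsetₚ.∈? W) ×-dec ¬? (source e Subsetₚ.∈? W)))

  no-leaves⇒closed : ∀ {E W} → ¬ (∃[ e ] Leaves E W e) → Closed E W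
  no-leaves⇒closed {W = W} none {w = w} v∈W (e , e∈E , inj₁ (refl , refl)) with w Subsetₚ.∈? W
  ... | yes w∈W = w∈W
  ... | no  w∉W = contradiction (e , e∈E , inj₁ (v∈W , w∉W)) none
  no-leaves⇒closed {W = W} none {w = w} v∈W (e , e∈E , inj₂ (refl , refl)) with w Subsetₚ.∈? W
  ... | yes w∈W = w∈W
  ... | no  w∉W = contradiction (e , e∈E , inj₂ (v∈W , w∉W)) none

  -- An edge of `E` that crosses out of `W` attaches its outer end as a pendant vertex; when no such
  -- edge remains, `W` is closed. Each round spends one unit of fuel and enlarges `W`, which
  -- preserves the bound on the order.
  grow : ∀ fuel E r W F → Graph.order G ℕ.≤ fuel ℕ.+ ∣ W ∣ → r ∈ˢ W → F ⊆ E → IsTree W F →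
         ∃[ W′ ] ∃[ F′ ] (r ∈ˢ W′ × F′ ⊆ E × IsTree W′ F′ × Closed E W′)
  grow fuel E r W F enough r∈W F⊆E tree with Finₚ.any? (leaves? E W)
  ... | no  none           = W , F , r∈W , F⊆E , tree , no-leaves⇒closed none
  ... | yes (e , e∈E , side) = attach fuel enough side
    where
    extend-⊆ : F ∪ ⁅ e ⁆ ⊆ E
    extend-⊆ e′∈ = [ F⊆E , (λ e′∈e → subst (_∈ˢ E) (sym (Subsetₚ.x∈⁅y⁆⇒x≡y e e′∈e)) e∈E) ]′
      (Subsetₚ.x∈p∪q⁻ F ⁅ e ⁆ e′∈)

    continue : ∀ fuel {u x} → u ∈ˢ W → x ∉ W →
               (source e ≡ u × target e ≡ x) ⊎ (source e ≡ x × target e ≡ u) →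
               Graph.order G ℕ.≤ fuel ℕ.+ ∣ W ∣ →
               ∃[ W′ ] ∃[ F′ ] (r ∈ˢ W′ × F′ ⊆ E × IsTree W′ F′ × Closed E W′)
    -- Without fuel, `W` already has as many vertices as the graph, which leaves no room for `x`.
    continue zero {x = x} u∈W x∉W ends enough = contradiction
      (ℕₚ.<-≤-trans ∣W∣<∣W′∣ (ℕₚ.≤-trans (Subsetₚ.∣p∣≤n (W ∪ ⁅ x ⁆)) enough)) (ℕₚ.<-irrefl refl)
      where open Pendant tree u∈W x∉W e ends
    continue (suc fuel) {x = x} u∈W x∉W ends enough =
      grow fuel E r (W ∪ ⁅ x ⁆) (F ∪ ⁅ e ⁆)
        (ℕₚ.≤-trans enough (ℕₚ.≤-trans (ℕₚ.≤-reflexive (sym (ℕₚ.+-suc fuel ∣ W ∣)))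
          (ℕₚ.+-monoʳ-≤ fuel ∣W∣<∣W′∣)))
        (Subsetₚ.p⊆p∪q ⁅ x ⁆ r∈W) extend-⊆ pendant-tree
      where open Pendant tree u∈W x∉W e ends

    attach : ∀ fuel → Graph.order G ℕ.≤ fuel ℕ.+ ∣ W ∣ →
             (source e ∈ˢ W × target e ∉ W) ⊎ (target e ∈ˢ W × source e ∉ W) →
             ∃[ W′ ] ∃[ F′ ] (r ∈ˢ W′ × F′ ⊆ E × IsTree W′ F′ × Closed E W′)
    attach fuel enough (inj₁ (s∈W , t∉W)) = continue fuel s∈W t∉W (inj₁ (refl , refl)) enough
    attach fuel enough (inj₂ (t∈W , s∉W)) = continue fuel t∈W s∉W (inj₂ (refl , refl)) enough

  -- The tree grown from one terminal has an `E`-closed vertex set, which contains everything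
  -- reachable from that terminal, hence all of `T`.
  spans⇒steiner : ∀ E T → Vertex → Spans E T → ∃[ F ] (F ⊆ E × IsSteinerTree T F)
  spans⇒steiner E T v₀ spans with Subsetₚ.nonempty? T
  ... | yes (r , r∈T) =
    let W , F , r∈W , F⊆E , tree , closed =
          grow (Graph.order G) E r ⁅ r ⁆ ⊥ (ℕₚ.m≤m+n _ _) (Subsetₚ.x∈⁅x⁆ r) Subsetₚ.⊥⊆ (singleton-tree r)
    in F , F⊆E , W , (λ {v} v∈T → closed-reachable closed r∈W (spans r v r∈T v∈T)) , tree
  -- A tree must be nonempty, so without terminals the given vertex `v₀` serves as a one-vertex
  -- tree.
  ... | no T-empty =
    ⊥ , Subsetₚ.⊥⊆ , ⁅ v₀ ⁆ , (λ v∈T → contradiction (_ , v∈T) T-empty) , singleton-tree v₀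

-- The embedding of the natural numbers into the rationals

abstract
  ι-+ : ∀ m n → ι (m ℕ.+ n) ≡ ι m ℚ.+ ι n
  ι-+ m n = ℚₚ.toℚᵘ-injective $ begin
    ℚ.toℚᵘ (ι (m ℕ.+ n))                                ≈⟨ ℚₚ.toℚᵘ-fromℚᵘ (ℚᵘ.mkℚᵘ (ℤ.+ (m ℕ.+ n)) 0) ⟩
    ℚᵘ.mkℚᵘ (ℤ.+ (m ℕ.+ n)) 0
      ≈⟨ ℚᵘ.*≡* (cong (ℤ._* ℤ.+ 1)
          (sym (cong₂ ℤ._+_ (ℤₚ.*-identityʳ (ℤ.+ m)) (ℤₚ.*-identityʳ (ℤ.+ n))))) ⟩
    ℚᵘ.mkℚᵘ (ℤ.+ m) 0 ℚᵘ.+ ℚᵘ.mkℚᵘ (ℤ.+ n) 0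
      ≈⟨ ℚᵘₚ.+-cong (ℚₚ.toℚᵘ-fromℚᵘ (ℚᵘ.mkℚᵘ (ℤ.+ m) 0)) (ℚₚ.toℚᵘ-fromℚᵘ (ℚᵘ.mkℚᵘ (ℤ.+ n) 0)) ⟨
    ℚ.toℚᵘ (ι m) ℚᵘ.+ ℚ.toℚᵘ (ι n)                      ≈⟨ ℚₚ.toℚᵘ-homo-+ (ι m) (ι n) ⟨
    ℚ.toℚᵘ (ι m ℚ.+ ι n)                                ∎
    where open ℚᵘₚ.≃-Reasoning

  ι-suc : ∀ n → ι (suc n) ≡ ι n ℚ.+ 1ℚ
  ι-suc n = trans (ι-+ 1 n) (ℚₚ.+-comm 1ℚ (ι n))

-- Sums over edge sets

if-mono : ∀ b {x y} → x ≤ y → (if b then x else 0ℝ) ≤ (if b then y else 0ℝ)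
if-mono true  x≤y = x≤y
if-mono false x≤y = ≤-refl {0ℝ}

∑∈-mono-≤ : ∀ {n} (S : Subset n) {f g : Fin n → ℝ} → (∀ i → f i ≤ g i) → ∑∈ S f ≤ ∑∈ S g
∑∈-mono-≤ S {f} {g} f≤g = ∑-mono-≤ λ i → if-mono (lookup S i) {f i} {g i} (f≤g i)

∑∈-⊆ : ∀ {n} {S S′ : Subset n} {f : Fin n → ℝ} → (∀ i → 0ℝ ≤ f i) → S ⊆ S′ → ∑∈ S f ≤ ∑∈ S′ f
∑∈-⊆ {S = S} {S′} {f} 0≤f S⊆S′ = ∑-mono-≤ λ i →
  go i (lookup S i) (lookup S′ i) λ eq → Vecₚ.[]=⇒lookup (S⊆S′ (Vecₚ.lookup⇒[]= i S eq))
  where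
  go : ∀ i b b′ → (b ≡ true → b′ ≡ true) → (if b then f i else 0ℝ) ≤ (if b′ then f i else 0ℝ)
  go i true  true  _ = ≤-refl {f i}
  go i true  false p = contradiction (p refl) λ ()
  go i false true  _ = 0≤f i
  go i false false _ = ≤-refl {0ℝ}

∑∈-⊥ : ∀ {n} (f : Fin n → ℝ) → ∑∈ ⊥ f ≤ 0ℝ
∑∈-⊥ {n} f = ≤-pointwise-≡ {∑∈ ⊥ f} {0ℝ} λ k →
  trans (seq-∑ (λ i → if lookup (⊥ {n}) i then f i else 0ℝ) k)
    (trans (sum-cong-≗ λ i → cong (λ b → seq (if b then f i else 0ℝ) k) (Vecₚ.lookup-replicate i outside))
      (sum-replicate-zero n))

∑-nonneg : ∀ {n} {f : Fin n → ℝ} → (∀ i → 0ℝ ≤ f i) → 0ℝ ≤ ∑ f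
∑-nonneg {n} {f} 0≤f = ≤-trans {0ℝ} {∑ {n} (λ _ → 0ℝ)} {∑ f}
  (≤-pointwise-≡ {0ℝ} {∑ {n} (λ _ → 0ℝ)} λ k → sym (trans (seq-∑ {n} (λ _ → 0ℝ) k) (sum-replicate-zero n)))
  (∑-mono-≤ 0≤f)

∑-*ˡ : ∀ {n} r (f : Fin n → ℝ) k → seq (∑ λ i → r * f i) k ≡ seq (r * ∑ f) k
∑-*ˡ r f k = trans (seq-∑ (λ i → r * f i) k)
  (trans (sym (*-distribˡ-sum (seq r k) (λ i → seq (f i) k))) (cong (seq r k ℚ.*_) (sym (seq-∑ f k))))

-- The subroutine against arbitrary spanning edge sets

-- A minimum over finitely many reals is attained only up to double negation, which is harmless
-- here because inequalities between reals are stable.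
¬¬-minimiser : ∀ {A : Set} (P : A → Set) (f : A → ℝ) x₀ → P x₀ → ∀ xs →
               ¬ ¬ (∃[ x ] (P x × (∀ {x′} → x′ ∈ xs → P x′ → f x ≤ f x′)))
¬¬-minimiser P f x₀ px₀ []       k = k (x₀ , px₀ , λ ())
¬¬-minimiser P f x₀ px₀ (x ∷ xs) k =
  ¬¬-minimiser P f x₀ px₀ xs λ (m , pm , min) →
  ¬¬-excluded-middle {A = P x × ¬ (f m ≤ f x)} λ where
    (yes (px , m≰x)) → k (x , px , λ where
      (here refl)  _   → ≤-refl {f x}
      {x′} (there x′∈) px′ → ≤-trans {f x} {f m} {f x′} (≰⇒≥ {f m} {f x} m≰x) (min x′∈ px′))
    (no ¬p) → k (m , pm , λ where
      (here refl)  px  → ≤-stable {f m} {f x} λ m≰x → ¬p (px , m≰x)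
      (there x′∈) px′ → min x′∈ px′)

module _ {ρ : ℝ} (1≤ρ : 1ℝ ≤ ρ) (A : SteinerSubroutine ρ) where
  open SteinerSubroutine A

  -- `ratio` compares with an attained minimum `μ`. Under the double negation some Steiner tree `M`
  -- attains it among all edge subsets, and `M` costs at most `F`.
  solve-steiner : ∀ G w T → Graph.Connected G → NonNegative w → ∀ F → Graph.IsSteinerTree G T F →
                  ∑∈ (solve G w T) w ≤ ρ * ∑∈ F w
  solve-steiner G w T conn 0≤w F F-steiner = ≤-stable {∑∈ (solve G w T) w} {ρ * ∑∈ F w} λ ≰ →
    ¬¬-minimiser (Graph.IsSteinerTree G T) (λ S → ∑∈ S w) F F-steiner (subsets (size G))
      λ (M , M-steiner , M-min) → ≰ $
        ≤-trans {∑∈ (solve G w T) w} {ρ * ∑∈ M w} {ρ * ∑∈ F w}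
          (ratio G w T conn 0≤w (∑∈ M w)
            ( (M , M-steiner , ≤-refl {∑∈ M w} , ≤-refl {∑∈ M w})
            , λ x (S , S-steiner , S≤x , _) →
                ≤-trans {∑∈ M w} {∑∈ S w} {x} (M-min (∈-subsets S) S-steiner) S≤x))
          (*-monoˡ-≤ ρ {∑∈ M w} {∑∈ F w} (1≤⇒eventuallyNonneg {ρ} 1≤ρ)
            (M-min (∈-subsets F) F-steiner))

  solve-spanning : ∀ G w T → Graph.Connected G → NonNegative w → ∀ F → Graph.Spans G F T →
                   ∑∈ (solve G w T) w ≤ ρ * ∑∈ F w
  solve-spanning G w T conn 0≤w F spans =
    let F′ , F′⊆F , F′-steiner = spans⇒steiner G F T (proj₁ conn) spans in
    ≤-trans {∑∈ (solve G w T) w} {ρ * ∑∈ F′ w} {ρ * ∑∈ F w}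
      (solve-steiner G w T conn 0≤w F′ F′-steiner)
      (*-monoˡ-≤ ρ {∑∈ F′ w} {∑∈ F w} (1≤⇒eventuallyNonneg {ρ} 1≤ρ) (∑∈-⊆ 0≤w F′⊆F))

-- Positions relative to a set of selected levels

-- `before` cannot occur once level 1 is selected, but the recursion passes to suffixes of `Q` that
-- may begin with unselected levels.
data Position {ℓ} (Q : Subset ℓ) (j : Fin ℓ) : Set where
  before   : toℕ j ℕ.< toℕ (least Q) → Position Q j
  selected : j ∈ˢ Q → Position Q j
  after    : ∀ i → i ∈ˢ Q → i Fin.< j → toℕ j ℕ.< toℕ (next Q i) → Position Q j

position : ∀ {ℓ} (Q : Subset ℓ) j → Position Q j
position (inside  ∷ Q) zero = selected here
position (outside ∷ Q) zero = before ℕ.z<s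
position (b ∷ Q) (suc j) with position Q j
... | selected j∈Q = selected (there j∈Q)
... | after i i∈Q i<j j<n = after (suc i) (there i∈Q) (ℕ.s<s i<j) (ℕ.s<s j<n)
position (inside  ∷ Q) (suc j) | before j<l = after zero here ℕ.z<s (ℕ.s<s j<l)
position (outside ∷ Q) (suc j) | before j<l = before (ℕ.s<s j<l)

i<next : ∀ {ℓ} (Q : Subset ℓ) i → toℕ i ℕ.< toℕ (next Q i)
i<next (_ ∷ Q) zero    = ℕ.z<s
i<next (_ ∷ Q) (suc i) = ℕ.s<s (i<next Q i)

extend-inject₁ : ∀ {ℓ n} (E : Fin ℓ → Subset n) i → extend E (inject₁ i) ≡ E i
extend-inject₁ E zero    = refl
extend-inject₁ E (suc i) = extend-inject₁ (E ∘ suc) i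

nested⁺ : ∀ {ℓ n} (E : Fin ℓ → Subset n) → (∀ j → extend E (suc j) ⊆ E j) →
          ∀ i j → i Fin.≤ j → E j ⊆ E i
nested⁺ E step zero zero _ = λ x∈ → x∈
nested⁺ {suc (suc ℓ)} E step zero (suc j) _ =
  step zero ∘ nested⁺ (E ∘ suc) (step ∘ suc) zero j ℕ.z≤n
nested⁺ E step (suc i) (suc j) (ℕ.s≤s i≤j) = nested⁺ (E ∘ suc) (step ∘ suc) i j i≤j

extendℝ : ∀ {ℓ} → (Fin ℓ → ℝ) → Fin (suc ℓ) → ℝ
extendℝ {zero}  a _       = 0ℝ
extendℝ {suc ℓ} a zero    = a zero
extendℝ {suc ℓ} a (suc p) = extendℝ (a ∘ suc) p

extend-cost : ∀ {ℓ n} (E : Fin ℓ → Subset n) c p → ∑∈ (extend E p) c ≤ extendℝ (λ i → ∑∈ (E i) c) p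
extend-cost {zero}  E c p       = ∑∈-⊥ c
extend-cost {suc ℓ} E c zero    = ≤-refl {∑∈ (E zero) c}
extend-cost {suc ℓ} E c (suc p) = extend-cost (E ∘ suc) c p

-- The coefficients are positions, not gaps. Prepending a level raises each of them by one, which
-- costs one extra copy of `∑∈ Q z`.
∑∈-suc : ∀ {ℓ} (Q : Subset ℓ) (n : Fin ℓ → ℕ) z k →
         seq (∑∈ Q λ i → fromℕ′ (suc (n i)) * z i) k
         ≡ seq (∑∈ Q λ i → fromℕ′ (n i) * z i) k ℚ.+ seq (∑∈ Q z) k
∑∈-suc Q n z k = trans (seq-∑ (λ i → if lookup Q i then fromℕ′ (suc (n i)) * z i else 0ℝ) k)
  (trans (sum-cong-≗ λ i → go (lookup Q i) i)
    (trans (∑-distrib-+ (λ i → seq (if lookup Q i then fromℕ′ (n i) * z i else 0ℝ) k)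
                        (λ i → seq (if lookup Q i then z i else 0ℝ) k))
      (sym (cong₂ ℚ._+_ (seq-∑ (λ i → if lookup Q i then fromℕ′ (n i) * z i else 0ℝ) k)
                        (seq-∑ (λ i → if lookup Q i then z i else 0ℝ) k)))))
  where
  go : ∀ b i → seq (if b then fromℕ′ (suc (n i)) * z i else 0ℝ) k
       ≡ seq (if b then fromℕ′ (n i) * z i else 0ℝ) k ℚ.+ seq (if b then z i else 0ℝ) k
  go true  i = trans (cong (ℚ._* seq (z i) k) (ι-suc (n i)))
    (+-*-Solver.solve 2 (λ n z → (n :+ con 1ℚ) :* z := n :* z :+ z) refl (ι (n i)) (seq (z i) k))
  go false i = refl

-- The l levels before the first selected one are charged B instead of the cost of the selected
-- level; the l copies of the latter stand on the left so that no subtraction occurs.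
telescope : ∀ {ℓ} (Q : Subset ℓ) (a z : Fin ℓ → ℝ) B →
  (∀ i → i ∈ˢ Q → a i ≤ extendℝ a (next Q i) + z i) →
  (∀ i → i ∈ˢ Q → ∀ j → i Fin.< j → toℕ j ℕ.< toℕ (next Q i) → a j ≤ a i) →
  (∀ j → toℕ j ℕ.< toℕ (least Q) → a j ≤ B) →
  extendℝ a (least Q) ≤ ∑∈ Q z ×
  ∑ a + fromℕ′ (toℕ (least Q)) * extendℝ a (least Q)
    ≤ fromℕ′ (toℕ (least Q)) * B + ∑∈ Q (λ i → fromℕ′ (toℕ (next Q i)) * z i)
telescope [] a z B _ _ _ = ≤-refl {0ℝ} , ≤-pointwise-≡ {0ℝ + 0ℝ * 0ℝ} {0ℝ * B + 0ℝ} λ k →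
  sym (cong (ℚ._+ 0ℚ) (ℚₚ.*-zeroˡ (seq B k)))
telescope (outside ∷ Q) a z B step prune start = conclude (telescope Q (a ∘ suc) (z ∘ suc) B
         (λ i i∈Q → step (suc i) (there i∈Q))
         (λ i i∈Q j i<j j<n → prune (suc i) (there i∈Q) (suc j) (ℕ.s<s i<j) (ℕ.s<s j<n))
         (λ j j<l → start (suc j) (ℕ.s<s j<l)))
  where
  l : ℕ
  l = toℕ (least Q)
  A ∑a S V V⁺ : ℝ
  A  = extendℝ (a ∘ suc) (least Q)
  ∑a = ∑ (a ∘ suc)
  S  = ∑∈ Q (z ∘ suc)
  V  = ∑∈ Q λ i → fromℕ′ (toℕ (next Q i)) * z (suc i)
  V⁺ = ∑∈ Q λ i → fromℕ′ (suc (toℕ (next Q i))) * z (suc i)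
  conclude : A ≤ S × ∑a + fromℕ′ l * A ≤ fromℕ′ l * B + V →
             A ≤ 0ℝ + S × a zero + ∑a + fromℕ′ (suc l) * A ≤ fromℕ′ (suc l) * B + (0ℝ + V⁺)
  conclude (first , rest) =
    ≤-trans {A} {S} {0ℝ + S} first (≤-pointwise-≡ {S} {0ℝ + S} λ k → sym (ℚₚ.+-identityˡ (seq S k))) ,
    (nonneg⇒≤ {a zero + ∑a + fromℕ′ (suc l) * A} {fromℕ′ (suc l) * B + (0ℝ + V⁺)} $ nonneg-resp
      (λ k → sym (trans
        (cong₂ (λ v n → n ℚ.* seq B k ℚ.+ (0ℚ ℚ.+ v) ℚ.- (seq (a zero) k ℚ.+ seq ∑a k ℚ.+ n ℚ.* seq A k))
          (∑∈-suc Q (toℕ ∘ next Q) (z ∘ suc) k) (ι-suc l))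
        (+-*-Solver.solve 7 (λ n b v s a₀ r x →
            (n :+ con 1ℚ) :* b :+ (con 0ℚ :+ (v :+ s)) :- (a₀ :+ r :+ (n :+ con 1ℚ) :* x)
            := (b :- a₀) :+ ((n :* b :+ v :- (r :+ n :* x)) :+ (s :- x))) refl
          (ι l) (seq B k) (seq V k) (seq S k) (seq (a zero) k) (seq ∑a k) (seq A k))))
      (nonneg-+ (≤⇒nonneg {a zero} {B} (start zero ℕ.z<s))
        (nonneg-+ (≤⇒nonneg {∑a + fromℕ′ l * A} {fromℕ′ l * B + V} rest) (≤⇒nonneg {A} {S} first))))
-- The levels before the next selected one are pruned from this level, so its cost `a zero` takes
-- the place of `B`.
telescope (inside ∷ Q) a z B step prune start = conclude (telescope Q (a ∘ suc) (z ∘ suc) (a zero)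
         (λ i i∈Q → step (suc i) (there i∈Q))
         (λ i i∈Q j i<j j<n → prune (suc i) (there i∈Q) (suc j) (ℕ.s<s i<j) (ℕ.s<s j<n))
         (λ j j<l → prune zero here (suc j) ℕ.z<s (ℕ.s<s j<l)))
  where
  l : ℕ
  l = toℕ (least Q)
  A ∑a S V V⁺ : ℝ
  A  = extendℝ (a ∘ suc) (least Q)
  ∑a = ∑ (a ∘ suc)
  S  = ∑∈ Q (z ∘ suc)
  V  = ∑∈ Q λ i → fromℕ′ (toℕ (next Q i)) * z (suc i)
  V⁺ = ∑∈ Q λ i → fromℕ′ (suc (toℕ (next Q i))) * z (suc i)
  step₀ : Nonneg λ k → seq A k ℚ.+ seq (z zero) k ℚ.- seq (a zero) k
  step₀ = ≤⇒nonneg {a zero} {A + z zero} (step zero here)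
  conclude : A ≤ S × ∑a + fromℕ′ l * A ≤ fromℕ′ l * a zero + V →
             a zero ≤ z zero + S ×
             a zero + ∑a + 0ℝ * a zero ≤ 0ℝ * B + (fromℕ′ (suc l) * z zero + V⁺)
  conclude (first , rest) =
    (nonneg⇒≤ {a zero} {z zero + S} $ nonneg-resp
      (λ k → +-*-Solver.solve 4 (λ a₀ x z₀ s → (x :+ z₀ :- a₀) :+ (s :- x) := z₀ :+ s :- a₀) refl
        (seq (a zero) k) (seq A k) (seq (z zero) k) (seq S k))
      (nonneg-+ step₀ (≤⇒nonneg {A} {S} first))) ,
    (nonneg⇒≤ {a zero + ∑a + 0ℝ * a zero} {0ℝ * B + (fromℕ′ (suc l) * z zero + V⁺)} $ nonneg-resp
      (λ k → sym (trans
        (cong₂ (λ v n → 0ℚ ℚ.* seq B k ℚ.+ (n ℚ.* seq (z zero) k ℚ.+ v)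
                          ℚ.- (seq (a zero) k ℚ.+ seq ∑a k ℚ.+ 0ℚ ℚ.* seq (a zero) k))
          (∑∈-suc Q (toℕ ∘ next Q) (z ∘ suc) k) (ι-suc l))
        -- The bound `a₀ ≤ x + z₀` is used once for the level itself and `n` times for the levels
        -- charged `a₀`: these are the `n + 1` copies of `z₀`, and the `n` copies of `x` cancel.
        (+-*-Solver.solve 8 (λ n b v s a₀ r x z₀ →
            con 0ℚ :* b :+ ((n :+ con 1ℚ) :* z₀ :+ (v :+ s)) :- (a₀ :+ r :+ con 0ℚ :* a₀)
            := (x :+ z₀ :- a₀) :+ (n :* (x :+ z₀ :- a₀)
                 :+ ((n :* a₀ :+ v :- (r :+ n :* x)) :+ (s :- x)))) refl
          (ι l) (seq B k) (seq V k) (seq S k) (seq (a zero) k) (seq ∑a k) (seq A k) (seq (z zero) k))))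
      (nonneg-+ step₀ (nonneg-+ (nonneg-scale (0≤ι l) step₀)
        (nonneg-+ (≤⇒nonneg {∑a + fromℕ′ l * A} {fromℕ′ l * a zero + V} rest) (≤⇒nonneg {A} {S} first)))))

-- The outcome of the composite approach and its cost

module _ {ℓ} (I : Instance ℓ) {ρ : ℝ} (1≤ρ : 1ℝ ≤ ρ) (A : SteinerSubroutine ρ) where
  open Instance I
  open SteinerSubroutine A
  open Graph graph using (EdgeSet; Spans)

  0≤c : NonNegative c
  0≤c e = <⇒≤ {0ℝ} {c e} (positive e)

  0≤zeroOn : ∀ F → NonNegative (zeroOn I A F)
  0≤zeroOn F e with lookup F e
  ... | true  = ≤-refl {0ℝ}
  ... | false = 0≤c e

  zeroOn≤c : ∀ F e → zeroOn I A F e ≤ c e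
  zeroOn≤c F e with lookup F e
  ... | true  = 0≤c e
  ... | false = ≤-refl {c e}

  ∑∈-∪ : ∀ F S → ∑∈ (F ∪ S) c ≤ ∑∈ F c + ∑∈ S (zeroOn I A F)
  ∑∈-∪ F S = ≤-trans {∑∈ (F ∪ S) c} {∑ λ e → old e + new e} {∑ old + ∑ new}
    (∑-mono-≤ λ e → subst (λ b → (if b then c e else 0ℝ) ≤ old e + new e)
      (sym (Vecₚ.lookup-zipWith _∨_ e F S)) (go e (lookup F e) (lookup S e)))
    (∑-+ old new)
    where
    old new : Fin (size graph) → ℝ
    old e = if lookup F e then c e else 0ℝ
    new e = if lookup S e then zeroOn I A F e else 0ℝ
    go : ∀ e f s → (if f ∨ s then c e else 0ℝ)
         ≤ (if f then c e else 0ℝ) + (if s then (if f then 0ℝ else c e) else 0ℝ)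
    go e true  true  = ≤-pointwise-≡ {c e} {c e + 0ℝ} λ k → sym (ℚₚ.+-identityʳ (seq (c e) k))
    go e true  false = ≤-pointwise-≡ {c e} {c e + 0ℝ} λ k → sym (ℚₚ.+-identityʳ (seq (c e) k))
    go e false true  = ≤-pointwise-≡ {c e} {0ℝ + c e} λ k → sym (ℚₚ.+-identityˡ (seq (c e) k))
    go e false false = ≤-pointwise-≡ {0ℝ} {0ℝ + 0ℝ} λ k → refl

  module _ {Q : Subset ℓ} (starts : StartsAtOne Q) {E : Fin ℓ → EdgeSet} (cmp : IsCMP I A Q E) where
    open IsCMP cmp renaming (selected to selected-levels)

    private
      not-before : ∀ {j : Fin ℓ} → ¬ (toℕ j ℕ.< toℕ (least Q))
      not-before j<l with () ← subst (λ p → _ ℕ.< toℕ p) starts j<l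

      selected-⊇ : ∀ i → i ∈ˢ Q → extend E (next Q i) ⊆ E i
      selected-⊇ i i∈Q = subst (extend E (next Q i) ⊆_) (sym (selected-levels i i∈Q)) (Subsetₚ.p⊆p∪q _)

      consecutive : ∀ j → extend E (suc j) ⊆ E j
      consecutive j with position Q j
      ... | before j<l            = contradiction j<l (not-before {j})
      ... | after i i∈Q i<j j<n   = proj₁ (pruned i i∈Q j i<j j<n)
      ... | selected j∈Q with suc j Finₚ.≟ next Q j
      ...   | yes eq = subst (λ p → extend E p ⊆ E j) (sym eq) (selected-⊇ j j∈Q)
      -- Level `j + 1` lies strictly before the next selected position, so it is a genuine level,
      -- not the extra position at the top, and it was pruned from `E j`.
      ...   | no neq = within-gap (suc j) refl
        where
        sj<n : suc (toℕ j) ℕ.< toℕ (next Q j)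
        sj<n = ℕₚ.≤∧≢⇒< (i<next Q j) λ eq → neq (Finₚ.toℕ-injective eq)
        within-gap : ∀ p → toℕ p ≡ suc (toℕ j) → extend E p ⊆ E j
        within-gap p eq with view p
        ... | ‵fromℕ     = contradiction
          (ℕₚ.<-≤-trans (subst (ℕ._< toℕ (next Q j)) (trans (sym eq) (Finₚ.toℕ-fromℕ ℓ)) sj<n)
            (ℕ.s≤s⁻¹ (Finₚ.toℕ<n (next Q j)))) (ℕₚ.<-irrefl refl)
        ... | ‵inject₁ j′ = subst (_⊆ E j) (sym (extend-inject₁ E j′))
          (proj₁ (proj₂ (pruned j j∈Q j′
            (ℕₚ.≤-reflexive (sym toℕj′)) (subst (ℕ._< toℕ (next Q j)) (sym toℕj′) sj<n))))
          where
          toℕj′ : toℕ j′ ≡ suc (toℕ j)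
          toℕj′ = trans (sym (Finₚ.toℕ-inject₁ j′)) eq

      spanning : ∀ i → Spans (E i) (T i)
      spanning i with position Q i
      ... | before i<l          = contradiction i<l (not-before {i})
      ... | after j j∈Q j<i i<n = proj₂ (proj₂ (pruned j j∈Q i j<i i<n))
      ... | selected i∈Q        = steiner⇒spans graph
        (sound graph (zeroOn I A F) (T i) connected (0≤zeroOn F))
        (subst (solve graph (zeroOn I A F) (T i) ⊆_) (sym (selected-levels i i∈Q)) (Subsetₚ.q⊆p∪q F _))
        where F = extend E (next Q i)

    cmp-isMLST : IsMLST I E
    cmp-isMLST = nested⁺ E consecutive , spanning

    module _ {E* : Fin ℓ → EdgeSet} (E*-spans : ∀ i → Spans (E* i) (T i)) where
      private
        level-cost : ∀ i → i ∈ˢ Q →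
          ∑∈ (E i) c ≤ extendℝ (λ j → ∑∈ (E j) c) (next Q i) + ρ * ∑∈ (E* i) c
        level-cost i i∈Q = begin
          ∑∈ (E i) c
            ≤⟨ subst (λ S → ∑∈ S c ≤ ∑∈ (F ∪ S₀) c) (sym (selected-levels i i∈Q)) (≤-refl {∑∈ (F ∪ S₀) c}) ⟩
          ∑∈ (F ∪ S₀) c                ≤⟨ ∑∈-∪ F S₀ ⟩
          ∑∈ F c + ∑∈ S₀ w
            ≤⟨ +-mono-≤ {∑∈ F c} {extendℝ (λ j → ∑∈ (E j) c) (next Q i)} {∑∈ S₀ w} {ρ * ∑∈ (E* i) c}
                 (extend-cost E c (next Q i)) added ⟩
          extendℝ (λ j → ∑∈ (E j) c) (next Q i) + ρ * ∑∈ (E* i) c ∎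
          where
          open ≤-Reasoning
          F = extend E (next Q i)
          w = zeroOn I A F
          S₀ = solve graph w (T i)
          -- `E* i` competes in the reweighted graph as well, and setting weights to zero only makes
          -- it cheaper.
          added : ∑∈ S₀ w ≤ ρ * ∑∈ (E* i) c
          added = ≤-trans {∑∈ S₀ w} {ρ * ∑∈ (E* i) w} {ρ * ∑∈ (E* i) c}
            (solve-spanning 1≤ρ A graph w (T i) connected (0≤zeroOn F) (E* i) (E*-spans i))
            (*-monoˡ-≤ ρ {∑∈ (E* i) w} {∑∈ (E* i) c} (1≤⇒eventuallyNonneg {ρ} 1≤ρ)
              (∑∈-mono-≤ (E* i) (zeroOn≤c F)))

      -- The edges bought at a selected level `i` can recur on every level before the next selected
      -- one, including all levels below `i`; their number is `toℕ (next Q i)`.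
      cmp-cost : cost I E ≤ ∑∈ Q λ i → fromℕ′ (toℕ (next Q i)) * (ρ * ∑∈ (E* i) c)
      cmp-cost = begin
        cost I E
          ≤⟨ ≤-pointwise-≡ {cost I E} {cost I E + fromℕ′ l * X} (λ k → sym (at-zero k (seq (cost I E) k))) ⟩
        cost I E + fromℕ′ l * X
          ≤⟨ proj₂ (telescope Q (λ j → ∑∈ (E j) c) (λ i → ρ * ∑∈ (E* i) c) X level-cost
               (λ i i∈Q j i<j j<n → ∑∈-⊆ 0≤c (proj₁ (proj₂ (pruned i i∈Q j i<j j<n))))
               (λ j j<l → contradiction j<l (not-before {j}))) ⟩
        fromℕ′ l * X + V
          ≤⟨ ≤-pointwise-≡ {fromℕ′ l * X + V} {V} (λ k → trans (ℚₚ.+-comm _ (seq V k)) (at-zero k (seq V k))) ⟩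
        V ∎
        where
        open ≤-Reasoning
        l : ℕ
        l = toℕ (least Q)
        X V : ℝ
        X = extendℝ (λ j → ∑∈ (E j) c) (least Q)
        V = ∑∈ Q λ i → fromℕ′ (toℕ (next Q i)) * (ρ * ∑∈ (E* i) c)
        at-zero : ∀ k q → q ℚ.+ ι l ℚ.* seq X k ≡ q
        at-zero k q = trans (cong (λ n → q ℚ.+ ι (toℕ n) ℚ.* seq X k) starts)
          (+-*-Solver.solve 2 (λ q x → q :+ con 0ℚ :* x := q) refl q (seq X k))

-- The approximation ratio

module _ {m} (o : LPOptimum m) {ρ : ℝ} (1≤ρ : 1ℝ ≤ ρ) (A : SteinerSubroutine ρ)
         (I : Instance (suc m)) (run : CompositeRun I A) where
  open LPOptimum o
  open Instance I
  open CompositeRun run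

  composite-ratio : ∀ opt → IsOPT I opt → cost I output ≤ fromℚ value * ρ * opt
  composite-ratio opt ((E* , (E*-nested , E*-spans) , E*≤opt , _) , _) = begin
    -- The cost of the output plays the role of `t`: being the cheapest, it obeys the constraint of
    -- every set at once.
    cost I output                   ≤⟨ maximal (cost I output) (∑ z) z z-antitone 0≤z
                                         (≤-refl {∑ z} , ≤-refl {∑ z}) bound ⟩
    fromℚ value * ∑ z
      ≤⟨ ≤-pointwise-≡ {fromℚ value * ∑ z} {fromℚ value * ρ * cost I E*} (λ k →
           trans (cong (value ℚ.*_) (∑-*ˡ ρ (λ i → ∑∈ (E* i) c) k))
             (sym (ℚₚ.*-assoc value (seq ρ k) (seq (cost I E*) k)))) ⟩
    fromℚ value * ρ * cost I E*     ≤⟨ *-monoˡ-≤ (fromℚ value * ρ) {cost I E*} {opt}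
                                         (N , λ n N≤n → 0≤* 0≤value (0≤ρ n N≤n)) E*≤opt ⟩
    fromℚ value * ρ * opt           ∎
    where
    open ≤-Reasoning
    eventually-ρ : EventuallyNonneg ρ
    eventually-ρ = 1≤⇒eventuallyNonneg {ρ} 1≤ρ
    N : ℕ
    N = proj₁ eventually-ρ
    0≤ρ : ∀ n → N ℕ.≤ n → 0ℚ ℚ.≤ seq ρ n
    0≤ρ = proj₂ eventually-ρ
    z : Fin (suc m) → ℝ
    z i = ρ * ∑∈ (E* i) c
    z-antitone : ∀ i j → i Fin.≤ j → z j ≤ z i
    z-antitone i j i≤j = *-monoˡ-≤ ρ {∑∈ (E* j) c} {∑∈ (E* i) c} eventually-ρ
      (∑∈-⊆ (0≤c I 1≤ρ A) (E*-nested i j i≤j))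
    0≤z : ∀ i → 0ℝ ≤ z i
    0≤z i = ≤-trans {0ℝ} {ρ * 0ℝ} {z i}
      (≤-pointwise-≡ {0ℝ} {ρ * 0ℝ} λ k → sym (ℚₚ.*-zeroʳ (seq ρ k)))
      (*-monoˡ-≤ ρ {0ℝ} {∑∈ (E* i) c} eventually-ρ (∑-nonneg λ e → if-nonneg (lookup (E* i) e) e))
      where
      if-nonneg : ∀ b e → 0ℝ ≤ (if b then c e else 0ℝ)
      if-nonneg true  e = 0≤c I 1≤ρ A e
      if-nonneg false e = ≤-refl {0ℝ}
    bound : ∀ Q → StartsAtOne Q → cost I output ≤ ∑∈ Q λ i → fromℕ′ (toℕ (next Q i)) * z i
    bound Q s = ≤-trans {cost I output} {cost I (result Q)} {∑∈ Q λ i → fromℕ′ (toℕ (next Q i)) * z i}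
      (cheapest Q s) (cmp-cost I 1≤ρ A s (computed Q s) E*-spans)

-- Certificates for the listed values

abstract
  ι-* : ∀ m n → ι (m ℕ.* n) ≡ ι m ℚ.* ι n
  ι-* zero    n = sym (ℚₚ.*-zeroˡ (ι n))
  ι-* (suc m) n = trans (ι-+ n (m ℕ.* n)) (trans (cong (ι n ℚ.+_) (ι-* m n))
    (trans (+-*-Solver.solve 2 (λ m n → n :+ m :* n := (m :+ con 1ℚ) :* n) refl (ι m) (ι n))
      (cong (ℚ._* ι n) (sym (ι-suc m)))))

  ι-mono-≤ : ∀ {m n} → m ℕ.≤ n → ι m ℚ.≤ ι n
  ι-mono-≤ {m} {n} m≤n = subst₂ ℚ._≤_ (ℚₚ.+-identityʳ (ι m))
    (trans (sym (ι-+ m (n ℕ.∸ m))) (cong ι (ℕₚ.m+[n∸m]≡n m≤n)))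
    (ℚₚ.+-monoʳ-≤ (ι m) (0≤ι (n ℕ.∸ m)))

  ι-mono-< : ∀ {m n} → m ℕ.< n → ι m ℚ.< ι n
  ι-mono-< {m} m<n = ℚₚ.<-≤-trans
    (subst₂ ℚ._<_ (ℚₚ.+-identityʳ (ι m)) (sym (ι-suc m)) (ℚₚ.+-monoʳ-< (ι m) (ℚₚ.positive⁻¹ 1ℚ)))
    (ι-mono-≤ m<n)

  ι-∸ : ∀ {m n} → n ℕ.≤ m → ι (m ℕ.∸ n) ≡ ι m ℚ.- ι n
  ι-∸ {m} {n} n≤m = trans
    (+-*-Solver.solve 2 (λ d n → d := d :+ n :- n) refl (ι (m ℕ.∸ n)) (ι n))
    (cong (ℚ._- ι n) (trans (sym (ι-+ (m ℕ.∸ n) n)) (cong ι (ℕₚ.m∸n+n≡m n≤m))))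

  thousandths : ∀ n → ι 1000 ℚ.* (ℤ.+ n ℚ./ 1000) ≡ ι n
  thousandths n = ℚₚ.toℚᵘ-injective $ begin
    ℚ.toℚᵘ (ι 1000 ℚ.* (ℤ.+ n ℚ./ 1000))              ≈⟨ ℚₚ.toℚᵘ-homo-* (ι 1000) (ℤ.+ n ℚ./ 1000) ⟩
    ℚ.toℚᵘ (ι 1000) ℚᵘ.* ℚ.toℚᵘ (ℤ.+ n ℚ./ 1000)
      ≈⟨ ℚᵘₚ.*-congˡ {ℚ.toℚᵘ (ι 1000)} (ℚₚ.toℚᵘ-fromℚᵘ (ℚᵘ.mkℚᵘ (ℤ.+ n) 999)) ⟩
    ℚᵘ.mkℚᵘ (ℤ.+ 1000) 0 ℚᵘ.* ℚᵘ.mkℚᵘ (ℤ.+ n) 999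
      ≈⟨ ℚᵘ.*≡* (trans (ℤₚ.*-identityʳ (ℤ.+ 1000 ℤ.* ℤ.+ n)) (ℤₚ.*-comm (ℤ.+ 1000) (ℤ.+ n))) ⟩
    ℚᵘ.mkℚᵘ (ℤ.+ n) 0                                 ≈⟨ ℚₚ.toℚᵘ-fromℚᵘ (ℚᵘ.mkℚᵘ (ℤ.+ n) 0) ⟨
    ℚ.toℚᵘ (ι n)                                      ∎
    where open ℚᵘₚ.≃-Reasoning

⟦_⟧ : ∀ {n} → Vec ℕ n → Fin n → ℚ
⟦ ws ⟧ i = ι (lookup ws i)

-- Certificates are evaluated during type checking, hence in `ℕ` with its built-in arithmetic; `ι`
-- carries the results to `ℚ` inside proofs only.
dotℕ : ∀ {n} → Vec ℕ n → Vec ℕ n → ℕ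
dotℕ []       []       = 0
dotℕ (c ∷ cs) (w ∷ ws) = c ℕ.* w ℕ.+ dotℕ cs ws

ι-dotℕ : ∀ {n} (cs ws : Vec ℕ n) → ι (dotℕ cs ws) ≡ dot ⟦ cs ⟧ ⟦ ws ⟧
ι-dotℕ []       []       = refl
ι-dotℕ (c ∷ cs) (w ∷ ws) = trans (ι-+ (c ℕ.* w) (dotℕ cs ws)) (cong₂ ℚ._+_ (ι-* c w) (ι-dotℕ cs ws))

ι-sum : ∀ {n} (ws : Vec ℕ n) → ι (Vec.sum ws) ≡ sum ⟦ ws ⟧
ι-sum []       = refl
ι-sum (w ∷ ws) = trans (ι-+ w (Vec.sum ws)) (cong (ι w ℚ.+_) (ι-sum ws))

-- The weights of a suffix Q of a set of levels that is preceded by d levels.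
weightsℕ : ∀ {n} → ℕ → Subset n → Vec ℕ n
weightsℕ d []            = []
weightsℕ d (inside  ∷ Q) = (suc d ℕ.+ toℕ (least Q)) ∷ weightsℕ (suc d) Q
weightsℕ d (outside ∷ Q) = 0 ∷ weightsℕ (suc d) Q

lookup-weightsℕ : ∀ {n} d (Q : Subset n) i →
  lookup (weightsℕ d Q) i ≡ (if lookup Q i then d ℕ.+ toℕ (next Q i) else 0)
lookup-weightsℕ d (inside  ∷ Q) zero    = sym (ℕₚ.+-suc d (toℕ (least Q)))
lookup-weightsℕ d (outside ∷ Q) zero    = refl
lookup-weightsℕ d (b ∷ Q)       (suc i) = trans (tail b) (trans (lookup-weightsℕ (suc d) Q i)
  (cong (λ n → if lookup Q i then n else 0) (sym (ℕₚ.+-suc d (toℕ (next Q i))))))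
  where
  tail : ∀ b → lookup (weightsℕ d (b ∷ Q)) (suc i) ≡ lookup (weightsℕ (suc d) Q) i
  tail true  = refl
  tail false = refl

weightsℕ≗weight : ∀ {n} (Q : Subset n) i → ⟦ weightsℕ 0 Q ⟧ i ≡ weight Q i
weightsℕ≗weight Q i = trans (cong ι (lookup-weightsℕ 0 Q i))
  (Boolₚ.if-float ι (lookup Q i))

-- _⊓′_ instead of _⊓_, because the unary recursion of the latter is too slow on the certificates.
relax : ∀ {n} → ℕ → ℕ → Vec ℕ (suc n) → ℕ
relax k w (h ∷ [])      = k ℕ.* w ℕ.+ h
relax k w (h ∷ h′ ∷ hs) = (k ℕ.* w ℕ.+ h) ℕ.⊓′ relax (suc k) w (h′ ∷ hs)

-- For a level of weight `w`, the term `(k + j) w` is the arc to position `j` of the rest and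
-- `lookup hs j` the cost of continuing from there.
relax-≤ : ∀ {n} k w (hs : Vec ℕ (suc n)) j → relax k w hs ℕ.≤ (k ℕ.+ toℕ j) ℕ.* w ℕ.+ lookup hs j
relax-≤ k w (h ∷ []) zero = ℕₚ.≤-reflexive (cong (λ k → k ℕ.* w ℕ.+ h) (sym (ℕₚ.+-identityʳ k)))
relax-≤ k w (h ∷ h′ ∷ hs) zero = ℕₚ.≤-trans
  (ℕₚ.≤-reflexive (sym (ℕₚ.⊓≡⊓′ (k ℕ.* w ℕ.+ h) (relax (suc k) w (h′ ∷ hs)))))
  (ℕₚ.≤-trans (ℕₚ.m⊓n≤m _ _) (relax-≤ k w (h ∷ []) zero))
relax-≤ k w (h ∷ h′ ∷ hs) (suc j) = ℕₚ.≤-trans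
  (ℕₚ.≤-reflexive (sym (ℕₚ.⊓≡⊓′ (k ℕ.* w ℕ.+ h) (relax (suc k) w (h′ ∷ hs)))))
  (ℕₚ.≤-trans (ℕₚ.m⊓n≤n _ _) (ℕₚ.≤-trans (relax-≤ (suc k) w (h′ ∷ hs) j)
    (ℕₚ.≤-reflexive (cong (λ k → k ℕ.* w ℕ.+ lookup (h′ ∷ hs) j) (sym (ℕₚ.+-suc k (toℕ j)))))))

-- shortest d ws lists, for each position p, the least cost of a set Q with least Q ≡ p: a set of
-- levels is a path whose arc from i to j costs (j - 1) wᵢ.
shortest-step : ∀ {n} → ℕ → ℕ → Vec ℕ (suc n) → Vec ℕ (suc (suc n))
shortest-step k w hs = relax k w hs ∷ hs

shortest : ∀ {n} → ℕ → Vec ℕ n → Vec ℕ (suc n)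
shortest d []       = 0 ∷ []
shortest d (w ∷ ws) = shortest-step (suc d) w (shortest (suc d) ws)

shortest-≤ : ∀ {n} d (ws : Vec ℕ n) Q → lookup (shortest d ws) (least Q) ℕ.≤ dotℕ (weightsℕ d Q) ws
shortest-≤ d []       []            = ℕ.z≤n
shortest-≤ d (w ∷ ws) (inside  ∷ Q) = ℕₚ.≤-trans
  (relax-≤ (suc d) w (shortest (suc d) ws) (least Q))
  (ℕₚ.+-monoʳ-≤ ((suc d ℕ.+ toℕ (least Q)) ℕ.* w) (shortest-≤ (suc d) ws Q))
shortest-≤ d (w ∷ ws) (outside ∷ Q) = shortest-≤ (suc d) ws Q

decreasing : ∀ {n} → Vec ℕ n → Bool
decreasing []            = true
decreasing (w ∷ [])      = true
decreasing (w ∷ w′ ∷ ws) = (w′ ℕ.≤ᵇ w) ∧ decreasing (w′ ∷ ws)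

T-∧⁻ : ∀ {x y} → Bool.T (x ∧ y) → Bool.T x × Bool.T y
T-∧⁻ {x} {y} = Equivalence.to (Boolₚ.T-∧ {x} {y})

decreasing-drops : ∀ {n} (ws : Vec ℕ (suc n)) → Bool.T (decreasing ws) →
                   ∀ i → ⟦ ws ⟧ (suc i) ℚ.≤ ⟦ ws ⟧ (inject₁ i)
decreasing-drops (w ∷ w′ ∷ ws) ok zero    =
  ι-mono-≤ (ℕₚ.≤ᵇ⇒≤ w′ w (proj₁ (T-∧⁻ {w′ ℕ.≤ᵇ w} {decreasing (w′ ∷ ws)} ok)))
decreasing-drops (w ∷ w′ ∷ ws) ok (suc i) =
  decreasing-drops (w′ ∷ ws) (proj₂ (T-∧⁻ {w′ ℕ.≤ᵇ w} {decreasing (w′ ∷ ws)} ok)) i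

-- Every prefix sum must be at most `u` times its length, with `acc` as the slack so far. The slacks
-- are the dual multipliers of the constraints that `y` decreases, and the last one that of its
-- nonnegativity, so `u` bounds the combination when `∑ y = 1`.
prefixes : ∀ {n} → ℕ → ℕ → Vec ℕ n → Bool
prefixes u acc []       = true
prefixes u acc (c ∷ cs) = (c ℕ.≤ᵇ acc ℕ.+ u) ∧ prefixes u (acc ℕ.+ u ℕ.∸ c) cs

prefixes-head : ∀ {n} u acc c (cs : Vec ℕ n) → Bool.T (prefixes u acc (c ∷ cs)) → c ℕ.≤ acc ℕ.+ u
prefixes-head u acc c cs ok = ℕₚ.≤ᵇ⇒≤ c (acc ℕ.+ u)
  (proj₁ (T-∧⁻ {c ℕ.≤ᵇ acc ℕ.+ u} {prefixes u (acc ℕ.+ u ℕ.∸ c) cs} ok))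

-- Summation by parts: the slack left over from a prefix is carried to the next, smaller, entry.
abel : ∀ {n} u acc (cs : Vec ℕ (suc n)) (y : Fin (suc n) → ℚ) → Bool.T (prefixes u acc cs) →
       (∀ i → y (suc i) ℚ.≤ y (inject₁ i)) → (∀ i → 0ℚ ℚ.≤ y i) →
       dot ⟦ cs ⟧ y ℚ.≤ ι u ℚ.* sum y ℚ.+ ι acc ℚ.* y zero
abel u acc (c ∷ []) y ok drops 0≤y = 0≤q-p⇒p≤q (subst (0ℚ ℚ.≤_)
  (+-*-Solver.solve 4 (λ a u c y → (a :+ u :- c) :* y
     := u :* (y :+ con 0ℚ) :+ a :* y :- (c :* y :+ con 0ℚ)) refl (ι acc) (ι u) (ι c) (y zero))
  (0≤* (p≤q⇒0≤q-p (subst (ι c ℚ.≤_) (ι-+ acc u) (ι-mono-≤ (prefixes-head u acc c [] ok)))) (0≤y zero)))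
abel u acc (c ∷ c′ ∷ cs) y ok drops 0≤y = 0≤q-p⇒p≤q (subst (0ℚ ℚ.≤_)
  (+-*-Solver.solve 7 (λ a u c y y′ r d →
      u :* r :+ (a :+ u :- c) :* y′ :- d :+ (a :+ u :- c) :* (y :- y′)
      := u :* (y :+ r) :+ a :* y :- (c :* y :+ d)) refl
    (ι acc) (ι u) (ι c) (y zero) (y (suc zero)) (sum (y ∘ suc)) (dot ⟦ c′ ∷ cs ⟧ (y ∘ suc)))
  (0≤+ (p≤q⇒0≤q-p (subst (λ r → dot ⟦ c′ ∷ cs ⟧ (y ∘ suc) ℚ.≤ ι u ℚ.* sum (y ∘ suc) ℚ.+ r ℚ.* y (suc zero))
          slack rest))
       (0≤* (subst (0ℚ ℚ.≤_) slack (0≤ι (acc ℕ.+ u ℕ.∸ c))) (p≤q⇒0≤q-p (drops zero)))))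
  where
  c≤ : c ℕ.≤ acc ℕ.+ u
  c≤ = prefixes-head u acc c (c′ ∷ cs) ok
  slack : ι (acc ℕ.+ u ℕ.∸ c) ≡ ι acc ℚ.+ ι u ℚ.- ι c
  slack = trans (ι-∸ c≤) (cong (ℚ._- ι c) (ι-+ acc u))
  rest : dot ⟦ c′ ∷ cs ⟧ (y ∘ suc) ℚ.≤ ι u ℚ.* sum (y ∘ suc) ℚ.+ ι (acc ℕ.+ u ℕ.∸ c) ℚ.* y (suc zero)
  rest = abel u (acc ℕ.+ u ℕ.∸ c) (c′ ∷ cs) (y ∘ suc)
    (proj₂ (T-∧⁻ {c ℕ.≤ᵇ acc ℕ.+ u} {prefixes u (acc ℕ.+ u ℕ.∸ c) (c′ ∷ cs)} ok)) (drops ∘ suc) (0≤y ∘ suc)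

-- levels m k is is the set of the levels in the increasing list is, among the m levels from k on.
levels : ∀ m → ℕ → List ℕ → Subset m
levels zero    k is       = []
levels (suc m) k []       = outside ∷ levels m (suc k) []
levels (suc m) k (i ∷ is) = if i ℕ.≡ᵇ k then inside ∷ levels m (suc k) is
                                        else outside ∷ levels m (suc k) (i ∷ is)

-- A pair (k , is) stands for k copies of the set {1} ∪ is.
Mixture : Set
Mixture = List (ℕ × List ℕ)

member : ∀ m → List ℕ → Subset (suc m)
member m is = inside ∷ levels m 2 is

copies : Mixture → ℕ
copies []             = 0
copies ((k , _) ∷ ms) = k ℕ.+ copies ms

addMultiple : ∀ {n} → ℕ → Vec ℕ n → Vec ℕ n → Vec ℕ n
addMultiple k []       []       = []
addMultiple k (c ∷ cs) (d ∷ ds) = (k ℕ.* c ℕ.+ d) ∷ addMultiple k cs ds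

dot-addMultiple : ∀ {n} k (cs ds : Vec ℕ n) y →
                  dot ⟦ addMultiple k cs ds ⟧ y ≡ ι k ℚ.* dot ⟦ cs ⟧ y ℚ.+ dot ⟦ ds ⟧ y
dot-addMultiple k []       []       y = sym (trans (ℚₚ.+-identityʳ _) (ℚₚ.*-zeroʳ (ι k)))
dot-addMultiple k (c ∷ cs) (d ∷ ds) y = trans
  (cong₂ (λ p q → p ℚ.* y zero ℚ.+ q)
    (trans (ι-+ (k ℕ.* c) d) (cong (ℚ._+ ι d) (ι-* k c))) (dot-addMultiple k cs ds (y ∘ suc)))
  (+-*-Solver.solve 6 (λ k c d y p q → (k :* c :+ d) :* y :+ (k :* p :+ q)
     := k :* (c :* y :+ p) :+ (d :* y :+ q)) refl
    (ι k) (ι c) (ι d) (y zero) (dot ⟦ cs ⟧ (y ∘ suc)) (dot ⟦ ds ⟧ (y ∘ suc)))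

mixed : ∀ m → Mixture → Vec ℕ (suc m)
mixed m []              = Vec.replicate (suc m) 0
mixed m ((k , is) ∷ ms) = addMultiple k (weightsℕ 0 (member m is)) (mixed m ms)

-- The largest u with 1000 u < (v + 1) copies, if the mixture is not empty.
upperNumerator : ℕ → Mixture → ℕ
upperNumerator v mix = (suc v ℕ.* copies mix ℕ.∸ 1) ℕ./ 1000

-- Adding the constraints of the mixture bounds `copies mix` times the optimum by `u`. The first
-- test makes `u / copies mix` less than `(v + 1) / 1000`, and it fails for an empty mixture.
upper-ok : ∀ m → ℕ → Mixture → Bool
upper-ok m v mix = (1000 ℕ.* upperNumerator v mix ℕ.<ᵇ suc v ℕ.* copies mix)
                 ∧ prefixes (upperNumerator v mix) 0 (mixed m mix)

-- For `W` the total of `ws` and `H` its least constraint, this is `(v - 1) / 1000 < H / W`, cleared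
-- of denominators and of subtraction.
lower-ok : ∀ {m} → ℕ → Vec ℕ (suc m) → Bool
lower-ok v ws = (v ℕ.* Vec.sum ws ℕ.<ᵇ 1000 ℕ.* lookup (shortest 0 ws) zero ℕ.+ Vec.sum ws)
              ∧ decreasing ws

module _ {m} (o : LPOptimum m) where
  open LPOptimum o

  mixed-bound : ∀ mix → ι (copies mix) ℚ.* value ℚ.≤ dot ⟦ mixed m mix ⟧ y
  mixed-bound [] = ℚₚ.≤-reflexive (trans (ℚₚ.*-zeroˡ value)
    (sym (trans (sum-cong-≗ λ i → cong (λ n → ι n ℚ.* y i) (Vecₚ.lookup-replicate i 0)) (dot-zero y))))
  mixed-bound ((k , is) ∷ ms) = subst₂ ℚ._≤_
    (trans (sym (ℚₚ.*-distribʳ-+ value (ι k) (ι (copies ms)))) (cong (ℚ._* value) (sym (ι-+ k (copies ms)))))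
    (sym (dot-addMultiple k (weightsℕ 0 Q) (mixed m ms) y))
    (ℚₚ.+-mono-≤
      (ℚₚ.*-monoˡ-≤-nonNeg (ι k) {{ℚ.nonNegative (0≤ι k)}}
        (subst (value ℚ.≤_) (sum-cong-≗ λ i → cong (ℚ._* y i) (sym (weightsℕ≗weight Q i))) (bounded Q refl)))
      (mixed-bound ms))
    where Q = member m is

  upper-bound : ∀ v mix → Bool.T (upper-ok m v mix) →
                value ℚ.< ℤ.+ v ℚ./ 1000 ℚ.+ ℤ.+ 1 ℚ./ 1000
  upper-bound v mix ok = ℚₚ.*-cancelˡ-<-nonNeg (ι N ℚ.* ι 1000)
    {{ℚ.nonNegative (0≤* (0≤ι N) (0≤ι 1000))}}
    (subst₂ ℚ._<_
      (+-*-Solver.solve 3 (λ n t x → t :* (n :* x) := n :* t :* x) refl (ι N) (ι 1000) value)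
      (trans (ι-* (suc v) N) (trans (cong (ℚ._* ι N) (trans (ι-suc v) (cong₂ ℚ._+_
          (sym (thousandths v)) (sym (thousandths 1)))))
        (+-*-Solver.solve 4 (λ n t a b → (t :* a :+ t :* b) :* n := n :* t :* (a :+ b)) refl
          (ι N) (ι 1000) (ℤ.+ v ℚ./ 1000) (ℤ.+ 1 ℚ./ 1000))))
      (ℚₚ.≤-<-trans
        (ℚₚ.*-monoˡ-≤-nonNeg (ι 1000) {{ℚ.nonNegative (0≤ι 1000)}} N*value≤u)
        (subst (ℚ._< ι (suc v ℕ.* N)) (ι-* 1000 u)
          (ι-mono-< (ℕₚ.<ᵇ⇒< (1000 ℕ.* u) (suc v ℕ.* N) (proj₁ oks))))))
    where
    N u : ℕ
    N = copies mix
    u = upperNumerator v mix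
    oks : Bool.T (1000 ℕ.* u ℕ.<ᵇ suc v ℕ.* N) × Bool.T (prefixes u 0 (mixed m mix))
    oks = T-∧⁻ {1000 ℕ.* u ℕ.<ᵇ suc v ℕ.* N} {prefixes u 0 (mixed m mix)} ok
    N*value≤u : ι N ℚ.* value ℚ.≤ ι u
    N*value≤u = ℚₚ.≤-trans (mixed-bound mix) (subst (dot ⟦ mixed m mix ⟧ y ℚ.≤_)
      (trans (cong (λ s → ι u ℚ.* s ℚ.+ 0ℚ ℚ.* y zero) total)
        (+-*-Solver.solve 2 (λ u y → u :* con 1ℚ :+ con 0ℚ :* y := u) refl (ι u) (y zero)))
      (abel u 0 (mixed m mix) y (proj₂ oks) drops 0≤y))

  lower-bound : ∀ v (ws : Vec ℕ (suc m)) → Bool.T (lower-ok v ws) →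
                ℤ.+ v ℚ./ 1000 ℚ.- ℤ.+ 1 ℚ./ 1000 ℚ.< value
  lower-bound v ws ok = ℚₚ.*-cancelˡ-<-nonNeg (ι W ℚ.* ι 1000)
    {{ℚ.nonNegative (0≤* (0≤ι W) (0≤ι 1000))}}
    (subst₂ ℚ._<_
      (trans (cong (ℚ._- ι W) (ι-* v W)) (trans
        (+-*-Solver.solve 2 (λ v w → v :* w :- w := (v :- con 1ℚ) :* w) refl (ι v) (ι W))
        (trans (cong (ℚ._* ι W) (cong₂ (λ p q → p ℚ.- q) (sym (thousandths v)) (sym (thousandths 1))))
          (+-*-Solver.solve 4 (λ n t a b → (t :* a :- t :* b) :* n := n :* t :* (a :- b)) refl
            (ι W) (ι 1000) (ℤ.+ v ℚ./ 1000) (ℤ.+ 1 ℚ./ 1000)))))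
      (+-*-Solver.solve 3 (λ n t x → t :* (x :* n) := n :* t :* x) refl (ι W) (ι 1000) value)
      (ℚₚ.<-≤-trans
        (subst (ι (v ℕ.* W) ℚ.- ι W ℚ.<_)
          (trans (cong (ℚ._- ι W) (trans (ι-+ (1000 ℕ.* H) W) (cong (ℚ._+ ι W) (ι-* 1000 H))))
            (+-*-Solver.solve 2 (λ h w → h :+ w :- w := h) refl (ι 1000 ℚ.* ι H) (ι W)))
          (ℚₚ.+-monoˡ-< (ℚ.- ι W) (ι-mono-< (ℕₚ.<ᵇ⇒< (v ℕ.* W) (1000 ℕ.* H ℕ.+ W) (proj₁ oks)))))
        (ℚₚ.*-monoˡ-≤-nonNeg (ι 1000) {{ℚ.nonNegative (0≤ι 1000)}} H≤value*W)))
    where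
    W H : ℕ
    W = Vec.sum ws
    H = lookup (shortest 0 ws) zero
    oks : Bool.T (v ℕ.* W ℕ.<ᵇ 1000 ℕ.* H ℕ.+ W) × Bool.T (decreasing ws)
    oks = T-∧⁻ {v ℕ.* W ℕ.<ᵇ 1000 ℕ.* H ℕ.+ W} {decreasing ws} ok
    z : Fin (suc m) → ℝ
    z = fromℚ ∘ ⟦ ws ⟧
    ∑z : ∀ k → seq (∑ z) k ≡ ι W
    ∑z k = trans (seq-∑ z k) (sym (ι-sum ws))
    H≤value*W : ι H ℚ.≤ value ℚ.* ι W
    -- The integer vector enters with its own total `W`; homogeneity spares the division.
    H≤value*W = fromℚ-≤⁻¹ $ maximal (fromℚ (ι H)) (fromℚ (ι W)) z
      (λ i j i≤j → fromℚ-≤ (antitone⁺ ⟦ ws ⟧ (decreasing-drops ws (proj₂ oks)) i j i≤j))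
      (λ i → fromℚ-≤ (0≤ι (lookup ws i)))
      (≤-pointwise-≡ {∑ z} {fromℚ (ι W)} ∑z , ≤-pointwise-≡ {fromℚ (ι W)} {∑ z} (sym ∘ ∑z))
      λ Q s → ≤-pointwise {fromℚ (ι H)} {∑∈ Q λ i → fromℕ′ (toℕ (next Q i)) * z i} λ k →
        ℚₚ.≤-trans
          (ι-mono-≤ (subst (λ p → lookup (shortest 0 ws) p ℕ.≤ dotℕ (weightsℕ 0 Q) ws) s (shortest-≤ 0 ws Q)))
          (ℚₚ.≤-reflexive (trans (ι-dotℕ (weightsℕ 0 Q) ws)
            (trans (sum-cong-≗ λ i → cong (ℚ._* ⟦ ws ⟧ i) (weightsℕ≗weight Q i)) (sym (seq-bound Q z k)))))

lp-value-of : ℕ → ℚ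
lp-value-of m = LPOptimum.value (lp-optimum m)

data Listed : ℕ × ℕ → Set where
  within : ∀ {m v} → Within (fromℚ (lp-value-of m)) v → Listed (suc m , v)

-- On closed data both checks reduce to the unit type, so the implicit arguments are filled in by
-- computation.
listed : ∀ {m v} (ws : Vec ℕ (suc m)) (mix : Mixture) →
         {Bool.T (upper-ok m v mix)} → {Bool.T (lower-ok v ws)} →
         Listed (suc m , v)
listed {m} {v} ws mix {mix-ok} {ws-ok} = within
  (fromℚ-< (upper-bound (lp-optimum m) v mix mix-ok) , fromℚ-< (lower-bound (lp-optimum m) v ws ws-ok))

-- For each entry: an optimal y and an optimal mixture of sets of levels, rounded to integers.
table-listed : All Listed table
table-listed =
  listed
    (20 ∷ 10 ∷ [])
    ((10 , []) ∷ (20 , 2 ∷ []) ∷ [])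
  ∷ listed
    (15 ∷ 10 ∷ 5 ∷ [])
    ((5 , 2 ∷ []) ∷ (5 , 3 ∷ []) ∷ [])
  ∷ listed
    (36 ∷ 24 ∷ 15 ∷ 6 ∷ [])
    ((15 , 2 ∷ []) ∷ (24 , 2 ∷ 4 ∷ []) ∷ (33 , 3 ∷ []) ∷ (9 , 4 ∷ []) ∷ [])
  ∷ listed
    (120 ∷ 80 ∷ 50 ∷ 26 ∷ 10 ∷ [])
    ((46 , 2 ∷ 4 ∷ []) ∷ (88 , 2 ∷ 5 ∷ []) ∷ (90 , 3 ∷ []) ∷ (10 , 3 ∷ 5 ∷ []) ∷ (52 , 4 ∷ []) ∷ [])
  ∷ listed
    (1121 ∷ 748 ∷ 523 ∷ 336 ∷ 212 ∷ 87 ∷ [])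
    ((6 , 2 ∷ 4 ∷ []) ∷ (24 , 2 ∷ 5 ∷ []) ∷ (6 , 2 ∷ 6 ∷ []) ∷ (9 , 3 ∷ []) ∷ (18 , 3 ∷ 6 ∷ []) ∷
    (18 , 4 ∷ []) ∷ [])
  ∷ listed
    (2385 ∷ 1590 ∷ 1113 ∷ 715 ∷ 488 ∷ 261 ∷ 102 ∷ [])
    ((8 , 2 ∷ 4 ∷ []) ∷ (126 , 2 ∷ 5 ∷ []) ∷ (71 , 2 ∷ 6 ∷ []) ∷ (55 , 3 ∷ 6 ∷ []) ∷ (101 , 3 ∷ 7 ∷
    []) ∷ (97 , 4 ∷ []) ∷ (25 , 4 ∷ 7 ∷ []) ∷ [])
  ∷ listed
    (904 ∷ 678 ∷ 497 ∷ 368 ∷ 255 ∷ 170 ∷ 108 ∷ 46 ∷ [])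
    ((106 , 2 ∷ 5 ∷ []) ∷ (96 , 2 ∷ 6 ∷ []) ∷ (17 , 3 ∷ 6 ∷ []) ∷ (113 , 3 ∷ 7 ∷ []) ∷ (20 , 3 ∷ 8 ∷
    []) ∷ (32 , 4 ∷ []) ∷ (93 , 4 ∷ 8 ∷ []) ∷ (7 , 5 ∷ []) ∷ [])
  ∷ listed
    (649 ∷ 487 ∷ 379 ∷ 286 ∷ 205 ∷ 151 ∷ 97 ∷ 55 ∷ 23 ∷ [])
    ((213 , 2 ∷ 5 ∷ []) ∷ (118 , 2 ∷ 5 ∷ 9 ∷ []) ∷ (379 , 2 ∷ 6 ∷ []) ∷ (32 , 2 ∷ 7 ∷ []) ∷ (347 , 3
    ∷ 7 ∷ []) ∷ (190 , 3 ∷ 8 ∷ []) ∷ (189 , 4 ∷ 8 ∷ []) ∷ (261 , 4 ∷ 9 ∷ []) ∷ (61 , 5 ∷ []) ∷ [])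
  ∷ listed
    (1766 ∷ 1324 ∷ 1030 ∷ 778 ∷ 582 ∷ 449 ∷ 317 ∷ 214 ∷ 136 ∷ 58 ∷ [])
    ((171 , 2 ∷ 5 ∷ 10 ∷ []) ∷ (205 , 2 ∷ 6 ∷ []) ∷ (57 , 2 ∷ 7 ∷ []) ∷ (148 , 3 ∷ 7 ∷ []) ∷ (166 ,
    3 ∷ 8 ∷ []) ∷ (39 , 4 ∷ 8 ∷ []) ∷ (205 , 4 ∷ 9 ∷ []) ∷ (15 , 4 ∷ 10 ∷ []) ∷ (34 , 5 ∷ []) ∷ (19
    , 5 ∷ 10 ∷ []) ∷ [])
  ∷ listed
    (1687 ∷ 1265 ∷ 984 ∷ 773 ∷ 586 ∷ 459 ∷ 344 ∷ 255 ∷ 165 ∷ 95 ∷ 42 ∷ [])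
    ((56 , 2 ∷ 5 ∷ 10 ∷ []) ∷ (139 , 2 ∷ 5 ∷ 11 ∷ []) ∷ (148 , 2 ∷ 6 ∷ []) ∷ (107 , 2 ∷ 6 ∷ 11 ∷ [])
    ∷ (108 , 2 ∷ 7 ∷ []) ∷ (138 , 3 ∷ 7 ∷ []) ∷ (246 , 3 ∷ 8 ∷ []) ∷ (20 , 3 ∷ 9 ∷ []) ∷ (226 , 4 ∷
    9 ∷ []) ∷ (99 , 4 ∷ 10 ∷ []) ∷ (91 , 5 ∷ 10 ∷ []) ∷ [])
  ∷ listed
    (2143 ∷ 1607 ∷ 1250 ∷ 982 ∷ 744 ∷ 583 ∷ 449 ∷ 345 ∷ 241 ∷ 159 ∷ 97 ∷ 49 ∷ [])
    ((49 , 2 ∷ 5 ∷ 10 ∷ []) ∷ (84 , 2 ∷ 5 ∷ 11 ∷ []) ∷ (7 , 2 ∷ 6 ∷ []) ∷ (9 , 2 ∷ 6 ∷ 11 ∷ []) ∷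
    (175 , 2 ∷ 6 ∷ 12 ∷ []) ∷ (103 , 2 ∷ 7 ∷ []) ∷ (73 , 3 ∷ 7 ∷ []) ∷ (175 , 3 ∷ 8 ∷ []) ∷ (55 , 3
    ∷ 9 ∷ []) ∷ (120 , 4 ∷ 9 ∷ []) ∷ (127 , 4 ∷ 10 ∷ []) ∷ (82 , 5 ∷ 11 ∷ []) ∷ [])
  ∷ listed
    (3468 ∷ 2601 ∷ 2023 ∷ 1589 ∷ 1243 ∷ 1006 ∷ 789 ∷ 634 ∷ 478 ∷ 356 ∷ 234 ∷ 138 ∷ 61 ∷ [])
    ((40 , 2 ∷ 5 ∷ 11 ∷ []) ∷ (28 , 2 ∷ 5 ∷ 12 ∷ []) ∷ (68 , 2 ∷ 6 ∷ 12 ∷ []) ∷ (42 , 2 ∷ 6 ∷ 13 ∷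
    []) ∷ (46 , 2 ∷ 7 ∷ []) ∷ (26 , 2 ∷ 7 ∷ 13 ∷ []) ∷ (29 , 3 ∷ 7 ∷ 13 ∷ []) ∷ (97 , 3 ∷ 8 ∷ []) ∷
    (51 , 3 ∷ 9 ∷ []) ∷ (46 , 4 ∷ 9 ∷ []) ∷ (97 , 4 ∷ 10 ∷ []) ∷ (2 , 4 ∷ 11 ∷ []) ∷ (55 , 5 ∷ 11 ∷
    []) ∷ [])
  ∷ listed
    (3425 ∷ 2569 ∷ 1998 ∷ 1570 ∷ 1227 ∷ 994 ∷ 780 ∷ 626 ∷ 483 ∷ 371 ∷ 259 ∷ 171 ∷ 100 ∷ 45 ∷ [])
    ((9 , 2 ∷ 5 ∷ 11 ∷ []) ∷ (160 , 2 ∷ 5 ∷ 12 ∷ []) ∷ (99 , 2 ∷ 6 ∷ 12 ∷ []) ∷ (212 , 2 ∷ 6 ∷ 13 ∷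
    []) ∷ (233 , 2 ∷ 7 ∷ 14 ∷ []) ∷ (48 , 3 ∷ 7 ∷ 13 ∷ []) ∷ (2 , 3 ∷ 7 ∷ 14 ∷ []) ∷ (237 , 3 ∷ 8 ∷
    []) ∷ (24 , 3 ∷ 8 ∷ 14 ∷ []) ∷ (188 , 3 ∷ 9 ∷ []) ∷ (71 , 4 ∷ 9 ∷ []) ∷ (259 , 4 ∷ 10 ∷ []) ∷
    (73 , 4 ∷ 11 ∷ []) ∷ (177 , 5 ∷ 11 ∷ []) ∷ [])
  ∷ listed
    (1974 ∷ 1480 ∷ 1151 ∷ 905 ∷ 707 ∷ 573 ∷ 459 ∷ 377 ∷ 300 ∷ 239 ∷ 179 ∷ 132 ∷ 94 ∷ 56 ∷ 25 ∷ [])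
    ((116 , 2 ∷ 5 ∷ 11 ∷ []) ∷ (33 , 2 ∷ 5 ∷ 12 ∷ []) ∷ (17 , 2 ∷ 6 ∷ 12 ∷ []) ∷ (244 , 2 ∷ 6 ∷ 13 ∷
    []) ∷ (42 , 2 ∷ 6 ∷ 14 ∷ []) ∷ (202 , 2 ∷ 7 ∷ 14 ∷ []) ∷ (56 , 2 ∷ 7 ∷ 15 ∷ []) ∷ (18 , 3 ∷ 7 ∷
    15 ∷ []) ∷ (85 , 3 ∷ 8 ∷ []) ∷ (170 , 3 ∷ 8 ∷ 15 ∷ []) ∷ (221 , 3 ∷ 9 ∷ []) ∷ (23 , 4 ∷ 9 ∷ [])
    ∷ (244 , 4 ∷ 10 ∷ []) ∷ (128 , 4 ∷ 11 ∷ []) ∷ (194 , 5 ∷ 12 ∷ []) ∷ [])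
  ∷ listed
    (1821 ∷ 1366 ∷ 1106 ∷ 903 ∷ 721 ∷ 607 ∷ 502 ∷ 405 ∷ 331 ∷ 262 ∷ 205 ∷ 160 ∷ 115 ∷ 77 ∷ 46 ∷ 21 ∷
    [])
    ((128 , 2 ∷ 5 ∷ 12 ∷ []) ∷ (182 , 2 ∷ 6 ∷ 13 ∷ []) ∷ (115 , 2 ∷ 6 ∷ 14 ∷ []) ∷ (115 , 2 ∷ 7 ∷ 14
    ∷ []) ∷ (156 , 2 ∷ 7 ∷ 15 ∷ []) ∷ (8 , 2 ∷ 8 ∷ 15 ∷ []) ∷ (66 , 3 ∷ 8 ∷ 15 ∷ []) ∷ (177 , 3 ∷ 8
    ∷ 16 ∷ []) ∷ (180 , 3 ∷ 9 ∷ []) ∷ (54 , 3 ∷ 9 ∷ 16 ∷ []) ∷ (13 , 3 ∷ 10 ∷ []) ∷ (217 , 4 ∷ 10 ∷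
    []) ∷ (173 , 4 ∷ 11 ∷ []) ∷ (57 , 5 ∷ 11 ∷ []) ∷ (102 , 5 ∷ 12 ∷ []) ∷ (48 , 5 ∷ 13 ∷ []) ∷ [])
  ∷ listed
    (3010 ∷ 2258 ∷ 1828 ∷ 1493 ∷ 1192 ∷ 1004 ∷ 830 ∷ 680 ∷ 566 ∷ 458 ∷ 370 ∷ 300 ∷ 230 ∷ 171 ∷ 122 ∷
    73 ∷ 33 ∷ [])
    ((5 , 2 ∷ 5 ∷ 12 ∷ []) ∷ (61 , 2 ∷ 5 ∷ 13 ∷ []) ∷ (68 , 2 ∷ 6 ∷ 13 ∷ []) ∷ (106 , 2 ∷ 6 ∷ 14 ∷
    []) ∷ (24 , 2 ∷ 7 ∷ 14 ∷ []) ∷ (129 , 2 ∷ 7 ∷ 15 ∷ []) ∷ (5 , 2 ∷ 7 ∷ 16 ∷ []) ∷ (16 , 2 ∷ 8 ∷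
    17 ∷ []) ∷ (124 , 3 ∷ 8 ∷ 16 ∷ []) ∷ (5 , 3 ∷ 8 ∷ 17 ∷ []) ∷ (28 , 3 ∷ 9 ∷ []) ∷ (108 , 3 ∷ 9 ∷
    17 ∷ []) ∷ (23 , 3 ∷ 10 ∷ []) ∷ (106 , 4 ∷ 10 ∷ []) ∷ (124 , 4 ∷ 11 ∷ []) ∷ (5 , 5 ∷ 11 ∷ []) ∷
    (124 , 5 ∷ 12 ∷ []) ∷ [])
  ∷ listed
    (2916 ∷ 2187 ∷ 1771 ∷ 1447 ∷ 1181 ∷ 999 ∷ 843 ∷ 697 ∷ 586 ∷ 482 ∷ 402 ∷ 322 ∷ 256 ∷ 200 ∷ 145 ∷
    98 ∷ 59 ∷ 27 ∷ [])
    ((74 , 2 ∷ 5 ∷ 13 ∷ []) ∷ (46 , 2 ∷ 6 ∷ 13 ∷ []) ∷ (159 , 2 ∷ 6 ∷ 14 ∷ []) ∷ (18 , 2 ∷ 6 ∷ 15 ∷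
    []) ∷ (142 , 2 ∷ 7 ∷ 15 ∷ []) ∷ (59 , 2 ∷ 7 ∷ 16 ∷ []) ∷ (36 , 2 ∷ 8 ∷ 16 ∷ []) ∷ (64 , 3 ∷ 8 ∷
    16 ∷ []) ∷ (85 , 3 ∷ 8 ∷ 17 ∷ []) ∷ (74 , 3 ∷ 9 ∷ 17 ∷ []) ∷ (99 , 3 ∷ 9 ∷ 18 ∷ []) ∷ (49 , 3 ∷
    10 ∷ []) ∷ (54 , 4 ∷ 10 ∷ []) ∷ (60 , 4 ∷ 10 ∷ 18 ∷ []) ∷ (159 , 4 ∷ 11 ∷ []) ∷ (23 , 4 ∷ 12 ∷
    []) ∷ (137 , 5 ∷ 12 ∷ []) ∷ (39 , 5 ∷ 13 ∷ []) ∷ [])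
  ∷ listed
    (1702 ∷ 1277 ∷ 1033 ∷ 844 ∷ 690 ∷ 583 ∷ 492 ∷ 407 ∷ 342 ∷ 285 ∷ 240 ∷ 196 ∷ 160 ∷ 129 ∷ 98 ∷ 72
    ∷ 51 ∷ 33 ∷ 15 ∷ [])
    ((187 , 2 ∷ 5 ∷ 12 ∷ []) ∷ (23 , 2 ∷ 6 ∷ 13 ∷ []) ∷ (434 , 2 ∷ 6 ∷ 14 ∷ []) ∷ (166 , 2 ∷ 6 ∷ 15
    ∷ []) ∷ (268 , 2 ∷ 7 ∷ 15 ∷ []) ∷ (300 , 2 ∷ 7 ∷ 16 ∷ []) ∷ (139 , 2 ∷ 8 ∷ 17 ∷ []) ∷ (134 , 3 ∷
    8 ∷ 16 ∷ []) ∷ (250 , 3 ∷ 8 ∷ 17 ∷ []) ∷ (45 , 3 ∷ 9 ∷ 17 ∷ []) ∷ (434 , 3 ∷ 9 ∷ 18 ∷ []) ∷ (9 ,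
    3 ∷ 9 ∷ 19 ∷ []) ∷ (31 , 3 ∷ 10 ∷ []) ∷ (153 , 3 ∷ 10 ∷ 19 ∷ []) ∷ (272 , 4 ∷ 10 ∷ 19 ∷ []) ∷
    (434 , 4 ∷ 11 ∷ []) ∷ (132 , 4 ∷ 12 ∷ []) ∷ (115 , 5 ∷ 12 ∷ []) ∷ (411 , 5 ∷ 13 ∷ []) ∷ [])
  ∷ listed
    (3662 ∷ 2747 ∷ 2223 ∷ 1816 ∷ 1484 ∷ 1272 ∷ 1076 ∷ 893 ∷ 762 ∷ 639 ∷ 543 ∷ 452 ∷ 378 ∷ 304 ∷ 240
    ∷ 187 ∷ 142 ∷ 97 ∷ 59 ∷ 27 ∷ [])
    ((55 , 2 ∷ 5 ∷ 13 ∷ []) ∷ (123 , 2 ∷ 6 ∷ 14 ∷ []) ∷ (93 , 2 ∷ 6 ∷ 15 ∷ []) ∷ (52 , 2 ∷ 7 ∷ 15 ∷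
    []) ∷ (145 , 2 ∷ 7 ∷ 16 ∷ []) ∷ (60 , 2 ∷ 8 ∷ 17 ∷ []) ∷ (85 , 3 ∷ 8 ∷ 17 ∷ []) ∷ (34 , 3 ∷ 8 ∷
    18 ∷ []) ∷ (111 , 3 ∷ 9 ∷ 18 ∷ []) ∷ (56 , 3 ∷ 9 ∷ 19 ∷ []) ∷ (81 , 3 ∷ 10 ∷ 19 ∷ []) ∷ (8 , 4 ∷
    10 ∷ 19 ∷ []) ∷ (69 , 4 ∷ 10 ∷ 20 ∷ []) ∷ (72 , 4 ∷ 11 ∷ []) ∷ (77 , 4 ∷ 11 ∷ 20 ∷ []) ∷ (66 , 4
    ∷ 12 ∷ []) ∷ (79 , 5 ∷ 12 ∷ []) ∷ (90 , 5 ∷ 13 ∷ []) ∷ (22 , 5 ∷ 14 ∷ []) ∷ [])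
  ∷ listed
    (8284 ∷ 6628 ∷ 5592 ∷ 4839 ∷ 4202 ∷ 3649 ∷ 3281 ∷ 2950 ∷ 2648 ∷ 2415 ∷ 2200 ∷ 2001 ∷ 1834 ∷ 1678
    ∷ 1550 ∷ 1427 ∷ 1323 ∷ 1224 ∷ 1128 ∷ 1044 ∷ 964 ∷ 894 ∷ 825 ∷ 765 ∷ 706 ∷ 653 ∷ 603 ∷ 558 ∷ 514
    ∷ 474 ∷ 437 ∷ 401 ∷ 367 ∷ 334 ∷ 303 ∷ 274 ∷ 248 ∷ 221 ∷ 197 ∷ 174 ∷ 153 ∷ 132 ∷ 113 ∷ 95 ∷ 79 ∷
    63 ∷ 49 ∷ 36 ∷ 23 ∷ 11 ∷ [])
    ((3 , 2 ∷ 6 ∷ 16 ∷ 35 ∷ []) ∷ (4 , 2 ∷ 6 ∷ 17 ∷ 36 ∷ []) ∷ (17 , 2 ∷ 6 ∷ 17 ∷ 37 ∷ []) ∷ (48 , 2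
    ∷ 6 ∷ 17 ∷ 38 ∷ []) ∷ (89 , 2 ∷ 6 ∷ 18 ∷ 38 ∷ []) ∷ (93 , 2 ∷ 6 ∷ 18 ∷ 39 ∷ []) ∷ (37 , 2 ∷ 6 ∷
    19 ∷ 39 ∷ []) ∷ (7 , 2 ∷ 7 ∷ 19 ∷ 39 ∷ []) ∷ (133 , 2 ∷ 7 ∷ 19 ∷ 40 ∷ []) ∷ (4 , 2 ∷ 7 ∷ 20 ∷ 40
    ∷ []) ∷ (137 , 2 ∷ 7 ∷ 20 ∷ 41 ∷ []) ∷ (30 , 2 ∷ 7 ∷ 20 ∷ 42 ∷ []) ∷ (55 , 2 ∷ 7 ∷ 21 ∷ 42 ∷ [])
    ∷ (53 , 2 ∷ 8 ∷ 21 ∷ 42 ∷ []) ∷ (58 , 2 ∷ 8 ∷ 21 ∷ 43 ∷ []) ∷ (79 , 2 ∷ 8 ∷ 22 ∷ 43 ∷ []) ∷ (83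
    , 2 ∷ 8 ∷ 22 ∷ 44 ∷ []) ∷ (55 , 2 ∷ 8 ∷ 23 ∷ 44 ∷ []) ∷ (2 , 2 ∷ 8 ∷ 23 ∷ 45 ∷ []) ∷ (112 , 2 ∷
    9 ∷ 24 ∷ 46 ∷ []) ∷ (100 , 3 ∷ 9 ∷ 23 ∷ 45 ∷ []) ∷ (35 , 3 ∷ 9 ∷ 24 ∷ 45 ∷ []) ∷ (7 , 3 ∷ 9 ∷ 24
    ∷ 46 ∷ []) ∷ (19 , 3 ∷ 9 ∷ 25 ∷ 46 ∷ []) ∷ (28 , 3 ∷ 9 ∷ 25 ∷ 47 ∷ []) ∷ (102 , 3 ∷ 10 ∷ 25 ∷ 47
    ∷ []) ∷ (6 , 3 ∷ 10 ∷ 26 ∷ 47 ∷ []) ∷ (137 , 3 ∷ 10 ∷ 26 ∷ 48 ∷ []) ∷ (3 , 3 ∷ 10 ∷ 26 ∷ 49 ∷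
    []) ∷ (29 , 3 ∷ 10 ∷ 27 ∷ 49 ∷ []) ∷ (106 , 3 ∷ 11 ∷ 27 ∷ 49 ∷ []) ∷ (8 , 3 ∷ 11 ∷ 27 ∷ 50 ∷ [])
    ∷ (11 , 3 ∷ 11 ∷ 28 ∷ []) ∷ (129 , 3 ∷ 11 ∷ 28 ∷ 50 ∷ []) ∷ (4 , 3 ∷ 11 ∷ 29 ∷ []) ∷ (25 , 3 ∷
    12 ∷ 29 ∷ []) ∷ (108 , 4 ∷ 12 ∷ 29 ∷ []) ∷ (108 , 4 ∷ 12 ∷ 30 ∷ []) ∷ (29 , 4 ∷ 13 ∷ 30 ∷ []) ∷
    (137 , 4 ∷ 13 ∷ 31 ∷ []) ∷ (62 , 4 ∷ 13 ∷ 32 ∷ []) ∷ (76 , 4 ∷ 14 ∷ 32 ∷ []) ∷ (55 , 4 ∷ 14 ∷ 33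
    ∷ []) ∷ (4 , 4 ∷ 14 ∷ 34 ∷ []) ∷ (82 , 5 ∷ 14 ∷ 33 ∷ []) ∷ (133 , 5 ∷ 15 ∷ 34 ∷ []) ∷ (72 , 5 ∷
    15 ∷ 35 ∷ []) ∷ (61 , 5 ∷ 16 ∷ 35 ∷ []) ∷ (133 , 5 ∷ 16 ∷ 36 ∷ []) ∷ (120 , 6 ∷ 17 ∷ 37 ∷ []) ∷
    [])
  ∷ listed
    (18041 ∷ 14433 ∷ 12178 ∷ 10538 ∷ 9249 ∷ 8188 ∷ 7466 ∷ 6810 ∷ 6209 ∷ 5758 ∷ 5338 ∷ 4945 ∷ 4635 ∷
    4342 ∷ 4065 ∷ 3834 ∷ 3613 ∷ 3403 ∷ 3225 ∷ 3055 ∷ 2888 ∷ 2741 ∷ 2600 ∷ 2477 ∷ 2357 ∷ 2250 ∷ 2147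
    ∷ 2046 ∷ 1955 ∷ 1866 ∷ 1786 ∷ 1707 ∷ 1635 ∷ 1566 ∷ 1497 ∷ 1434 ∷ 1373 ∷ 1316 ∷ 1260 ∷ 1208 ∷
    1158 ∷ 1110 ∷ 1064 ∷ 1021 ∷ 979 ∷ 939 ∷ 900 ∷ 863 ∷ 827 ∷ 793 ∷ 762 ∷ 731 ∷ 702 ∷ 673 ∷ 646 ∷
    619 ∷ 594 ∷ 569 ∷ 545 ∷ 523 ∷ 500 ∷ 479 ∷ 457 ∷ 437 ∷ 417 ∷ 398 ∷ 379 ∷ 361 ∷ 343 ∷ 326 ∷ 310 ∷
    294 ∷ 278 ∷ 263 ∷ 248 ∷ 234 ∷ 220 ∷ 207 ∷ 194 ∷ 181 ∷ 169 ∷ 157 ∷ 146 ∷ 135 ∷ 124 ∷ 114 ∷ 104 ∷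
    95 ∷ 86 ∷ 77 ∷ 69 ∷ 61 ∷ 53 ∷ 45 ∷ 38 ∷ 31 ∷ 24 ∷ 18 ∷ 12 ∷ 6 ∷ [])
    ((21 , 2 ∷ 6 ∷ 19 ∷ 48 ∷ 89 ∷ []) ∷ (155 , 2 ∷ 6 ∷ 19 ∷ 48 ∷ 90 ∷ []) ∷ (49 , 2 ∷ 6 ∷ 20 ∷ 49 ∷
    91 ∷ []) ∷ (141 , 2 ∷ 6 ∷ 20 ∷ 50 ∷ 92 ∷ []) ∷ (9 , 2 ∷ 7 ∷ 21 ∷ 50 ∷ 93 ∷ []) ∷ (125 , 2 ∷ 7 ∷
    21 ∷ 51 ∷ 93 ∷ []) ∷ (44 , 2 ∷ 7 ∷ 21 ∷ 51 ∷ 94 ∷ []) ∷ (55 , 2 ∷ 7 ∷ 21 ∷ 52 ∷ 94 ∷ []) ∷ (55 ,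
    2 ∷ 7 ∷ 21 ∷ 52 ∷ 95 ∷ []) ∷ (36 , 2 ∷ 7 ∷ 22 ∷ 52 ∷ 94 ∷ []) ∷ (101 , 2 ∷ 7 ∷ 22 ∷ 53 ∷ 95 ∷
    []) ∷ (65 , 2 ∷ 7 ∷ 22 ∷ 53 ∷ 96 ∷ []) ∷ (92 , 2 ∷ 7 ∷ 22 ∷ 54 ∷ 96 ∷ []) ∷ (6 , 2 ∷ 7 ∷ 22 ∷ 54
    ∷ 97 ∷ []) ∷ (66 , 2 ∷ 7 ∷ 23 ∷ 54 ∷ 97 ∷ []) ∷ (19 , 2 ∷ 7 ∷ 23 ∷ 55 ∷ 97 ∷ []) ∷ (78 , 2 ∷ 7 ∷
    23 ∷ 55 ∷ 98 ∷ []) ∷ (66 , 2 ∷ 8 ∷ 23 ∷ 55 ∷ 97 ∷ []) ∷ (62 , 2 ∷ 8 ∷ 23 ∷ 56 ∷ 99 ∷ []) ∷ (79 ,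
    2 ∷ 8 ∷ 24 ∷ 56 ∷ 98 ∷ []) ∷ (20 , 2 ∷ 8 ∷ 24 ∷ 56 ∷ 99 ∷ []) ∷ (75 , 2 ∷ 8 ∷ 24 ∷ 57 ∷ 99 ∷ [])
    ∷ (84 , 2 ∷ 8 ∷ 24 ∷ 57 ∷ 100 ∷ []) ∷ (23 , 2 ∷ 8 ∷ 24 ∷ 58 ∷ 100 ∷ []) ∷ (85 , 2 ∷ 8 ∷ 25 ∷ 58
    ∷ []) ∷ (43 , 2 ∷ 8 ∷ 25 ∷ 58 ∷ 100 ∷ []) ∷ (138 , 2 ∷ 8 ∷ 25 ∷ 59 ∷ []) ∷ (6 , 2 ∷ 9 ∷ 25 ∷ 58
    ∷ 100 ∷ []) ∷ (18 , 2 ∷ 9 ∷ 26 ∷ 59 ∷ []) ∷ (156 , 2 ∷ 9 ∷ 26 ∷ 60 ∷ []) ∷ (89 , 2 ∷ 9 ∷ 26 ∷ 61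
    ∷ []) ∷ (67 , 2 ∷ 9 ∷ 27 ∷ 61 ∷ []) ∷ (121 , 2 ∷ 9 ∷ 27 ∷ 62 ∷ []) ∷ (33 , 2 ∷ 9 ∷ 27 ∷ 63 ∷ [])
    ∷ (82 , 2 ∷ 9 ∷ 28 ∷ 63 ∷ []) ∷ (35 , 3 ∷ 9 ∷ 27 ∷ 62 ∷ []) ∷ (41 , 3 ∷ 10 ∷ 28 ∷ 63 ∷ []) ∷
    (127 , 3 ∷ 10 ∷ 28 ∷ 64 ∷ []) ∷ (29 , 3 ∷ 10 ∷ 29 ∷ 64 ∷ []) ∷ (156 , 3 ∷ 10 ∷ 29 ∷ 65 ∷ []) ∷
    (58 , 3 ∷ 10 ∷ 29 ∷ 66 ∷ []) ∷ (98 , 3 ∷ 10 ∷ 30 ∷ 66 ∷ []) ∷ (49 , 3 ∷ 10 ∷ 30 ∷ 67 ∷ []) ∷ (91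
    , 3 ∷ 11 ∷ 30 ∷ 67 ∷ []) ∷ (16 , 3 ∷ 11 ∷ 31 ∷ 67 ∷ []) ∷ (156 , 3 ∷ 11 ∷ 31 ∷ 68 ∷ []) ∷ (60 ,
    3 ∷ 11 ∷ 31 ∷ 69 ∷ []) ∷ (62 , 3 ∷ 11 ∷ 32 ∷ 69 ∷ []) ∷ (132 , 3 ∷ 11 ∷ 32 ∷ 70 ∷ []) ∷ (34 , 3
    ∷ 12 ∷ 32 ∷ 69 ∷ []) ∷ (24 , 3 ∷ 12 ∷ 33 ∷ 70 ∷ []) ∷ (142 , 3 ∷ 12 ∷ 33 ∷ 71 ∷ []) ∷ (42 , 3 ∷
    12 ∷ 33 ∷ 72 ∷ []) ∷ (114 , 3 ∷ 12 ∷ 34 ∷ 72 ∷ []) ∷ (105 , 3 ∷ 12 ∷ 34 ∷ 73 ∷ []) ∷ (6 , 3 ∷ 12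
    ∷ 35 ∷ 74 ∷ []) ∷ (15 , 4 ∷ 12 ∷ 33 ∷ 71 ∷ []) ∷ (52 , 4 ∷ 13 ∷ 35 ∷ 73 ∷ []) ∷ (150 , 4 ∷ 13 ∷
    35 ∷ 74 ∷ []) ∷ (7 , 4 ∷ 13 ∷ 35 ∷ 75 ∷ []) ∷ (150 , 4 ∷ 13 ∷ 36 ∷ 75 ∷ []) ∷ (61 , 4 ∷ 13 ∷ 36
    ∷ 76 ∷ []) ∷ (33 , 4 ∷ 13 ∷ 37 ∷ 77 ∷ []) ∷ (95 , 4 ∷ 14 ∷ 37 ∷ 76 ∷ []) ∷ (79 , 4 ∷ 14 ∷ 37 ∷
    77 ∷ []) ∷ (45 , 4 ∷ 14 ∷ 38 ∷ 77 ∷ []) ∷ (156 , 4 ∷ 14 ∷ 38 ∷ 78 ∷ []) ∷ (2 , 4 ∷ 14 ∷ 38 ∷ 79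
    ∷ []) ∷ (48 , 4 ∷ 14 ∷ 39 ∷ 79 ∷ []) ∷ (106 , 4 ∷ 15 ∷ 39 ∷ 79 ∷ []) ∷ (110 , 4 ∷ 15 ∷ 40 ∷ 80 ∷
    []) ∷ (51 , 4 ∷ 15 ∷ 40 ∷ 81 ∷ []) ∷ (55 , 4 ∷ 15 ∷ 41 ∷ 82 ∷ []) ∷ (46 , 5 ∷ 15 ∷ 39 ∷ 80 ∷ [])
    ∷ (35 , 5 ∷ 15 ∷ 40 ∷ 81 ∷ []) ∷ (70 , 5 ∷ 16 ∷ 41 ∷ 81 ∷ []) ∷ (69 , 5 ∷ 16 ∷ 41 ∷ 82 ∷ []) ∷
    (32 , 5 ∷ 16 ∷ 42 ∷ 82 ∷ []) ∷ (156 , 5 ∷ 16 ∷ 42 ∷ 83 ∷ []) ∷ (2 , 5 ∷ 16 ∷ 42 ∷ 84 ∷ []) ∷ (54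
    , 5 ∷ 16 ∷ 43 ∷ 84 ∷ []) ∷ (101 , 5 ∷ 17 ∷ 43 ∷ 84 ∷ []) ∷ (34 , 5 ∷ 17 ∷ 43 ∷ 85 ∷ []) ∷ (122 ,
    5 ∷ 17 ∷ 44 ∷ 85 ∷ []) ∷ (63 , 5 ∷ 17 ∷ 44 ∷ 86 ∷ []) ∷ (46 , 5 ∷ 17 ∷ 45 ∷ 87 ∷ []) ∷ (72 , 5 ∷
    18 ∷ 45 ∷ 86 ∷ []) ∷ (67 , 5 ∷ 18 ∷ 46 ∷ 87 ∷ []) ∷ (32 , 5 ∷ 18 ∷ 47 ∷ 88 ∷ []) ∷ (22 , 6 ∷ 18
    ∷ 45 ∷ 86 ∷ []) ∷ (44 , 6 ∷ 18 ∷ 45 ∷ 87 ∷ []) ∷ (114 , 6 ∷ 18 ∷ 46 ∷ 88 ∷ []) ∷ (11 , 6 ∷ 19 ∷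
    47 ∷ 88 ∷ []) ∷ (135 , 6 ∷ 19 ∷ 47 ∷ 89 ∷ []) ∷ (14 , 6 ∷ 19 ∷ 49 ∷ 91 ∷ []) ∷ (1 , 6 ∷ 20 ∷ 49
    ∷ 90 ∷ []) ∷ (94 , 6 ∷ 20 ∷ 49 ∷ 91 ∷ []) ∷ (16 , 6 ∷ 20 ∷ 49 ∷ 92 ∷ []) ∷ (22 , 6 ∷ 20 ∷ 50 ∷
    93 ∷ []) ∷ (21 , 6 ∷ 21 ∷ 52 ∷ 94 ∷ []) ∷ [])
  ∷ []

theorem2p8 : ∀ (ℓ : ℕ) → 2 ℕ.≤ ℓ → ℓ ℕ.≤ 100 →
    ∃[ t ] (IsLPValue ℓ t
    × (∀ v → (ℓ , v) ∈ table → Within t v)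
    × (∀ (ρ : ℝ) → 1ℝ ≤ ρ → (A : SteinerSubroutine ρ) →
    ∀ (I : Instance ℓ) (run : CompositeRun I A) →
    IsMLST I (CompositeRun.output run)
    × (∀ opt → IsOPT I opt →
    cost I (CompositeRun.output run) ≤ t * ρ * opt)))
theorem2p8 (suc m) _ _ =
  fromℚ (lp-value-of m)
  , lp-value (lp-optimum m)
  , (λ v v∈ → listed⁻ (All.lookup table-listed v∈))
  , λ ρ 1≤ρ A I run →
      cmp-isMLST I 1≤ρ A (CompositeRun.starts run) (CompositeRun.computed run _ (CompositeRun.starts run))
      , composite-ratio (lp-optimum m) 1≤ρ A I run
  where
  listed⁻ : ∀ {v} → Listed (suc m , v) → Within (fromℚ (lp-value-of m)) v
  listed⁻ (within w) = w
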